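{- There exists a test which, given parameters $\delta\in(0,1)$ and $\epsilon>0$ and sample access to two distributions $\mathbf{p}$ and $\mathbf{q}$ over a set of $n$ elements, has running time $O(\epsilon^{ -4}\log(1/\delta))$ (with no dependence on $n$) and satisfies: (1) if $\|\mathbf{p}-\mathbf{q}\|_2\le\epsilon/2$, then the test accepts with probability at least $1-\delta$; (2) if $\|\mathbf{p}-\mathbf{q}\|_2>\epsilon$, then the test rejects with probability at least $1-\delta$.
   Context: A distribution over $n$ elements (labelled by $[n]=\{1,\dots,n\}$) is a vector $\mathbf{p}=(p_1,\dots,p_n)$ with $p_i$ the probability of outputting $i$; $\|\mathbf{v}\|_2=\sqrt{\sum_i v_i^2}$. A test is a randomized algorithm that outputs accept or reject. Its only access to $\mathbf{p}$ and $\mathbf{q}$ is through black boxes: each query to a black box returns (at unit cost) an independent sample from the corresponding distribution. Elements of $[n]$ can be stored and used as array indices at unit cost. The constants hidden in $O(\cdot)$ are absolute.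
   Formalization: The running time is stated as at most C(1 + ε⁻⁴ log₂(1/δ)) with C absolute; without the added 1 the bound O(ε⁻⁴ log(1/δ)) is false, since it tends to 0 as ε grows or δ tends to 1 while the test needs at least one step. -}

module Defs where

open import Algebra.Bundles using (CommutativeRing)
import Algebra.Properties.CommutativeSemiring.Exp as Exp
open import Data.Bool.Base using (if_then_else_)
open import Data.Empty using (⊥)
open import Data.Fin.Base using (Fin; toℕ)
import Data.Integer.Base as ℤ
import Data.Integer.DivMod as ℤ
import Data.Integer.Properties as ℤ
open import Data.List.Base using (List; []; _∷_; _++_)
open import Data.Nat.Base as ℕ using (ℕ; zero; suc; NonZero)
open import Data.Nat.Logarithm
  using (⌊log₂_⌋; ⌊log₂⌋-mono-≤; ⌊log₂[2^n]⌋≡n; ⌊log₂⌊n/2⌋⌋≡⌊log₂n⌋∸1)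
import Data.Nat.DivMod as ℕ
import Data.Nat.Properties as ℕ
open import Data.Product.Base using (∃; ∃₂; _×_; _,_; proj₁; proj₂)
open import Data.Rational.Base as ℚ using (ℚ; mkℚ; 0ℚ; 1ℚ; ½; floor)
import Data.Rational.Properties as ℚ
open import Data.Rational.Solver using (module +-*-Solver)
import Data.Rational.Unnormalised.Base as ℚᵘ
import Data.Rational.Unnormalised.Properties as ℚᵘ
open import Data.Sum.Base using (inj₁; inj₂)
open import Data.Unit.Base using (⊤)
open import Data.Vec.Functional using (Vector; head; tail; zipWith)
open import Relation.Nullary using (yes; no)
open import Relation.Nullary.Negation using (contradiction)
open import Relation.Binary.PropositionalEquality
  using (_≡_; refl; sym; trans; cong; cong₂; subst; subst₂)

open +-*-Solver using (solve; _:=_; _:+_; _:*_; :-_; _:-_; con)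
open CommutativeRing ℚ.+-*-commutativeRing using (commutativeSemiring)
module ℚ^ = Exp commutativeSemiring
open ℚ^ using () renaming (_^_ to _^ℚ_)

ι : ℕ → ℚ
ι k = ℤ.+ k ℚ./ 1

_/suc_ : ℕ → ℕ → ℚ
a /suc n = ℤ.+ a ℚ./ suc n

toι : ∀ k → ℚ.toℚᵘ (ι k) ℚᵘ.≃ ℚᵘ.mkℚᵘ (ℤ.+ k) 0
toι k = ℚ.toℚᵘ-fromℚᵘ (ℚᵘ.mkℚᵘ (ℤ.+ k) 0)

ι-+ : ∀ a b → ι (a ℕ.+ b) ≡ ι a ℚ.+ ι b
ι-+ a b = ℚ.toℚᵘ-injective
  (ℚᵘ.≃-trans (toι (a ℕ.+ b))
  (ℚᵘ.≃-trans (ℚᵘ.*≡* (cong (ℤ._* ℤ.+ 1)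
     (sym (trans (cong₂ ℤ._+_ (ℤ.*-identityʳ (ℤ.+ a)) (ℤ.*-identityʳ (ℤ.+ b))) refl))))
  (ℚᵘ.≃-sym (ℚᵘ.≃-trans (ℚ.toℚᵘ-homo-+ (ι a) (ι b)) (ℚᵘ.+-cong (toι a) (toι b))))))

ι-* : ∀ a b → ι (a ℕ.* b) ≡ ι a ℚ.* ι b
ι-* a b = ℚ.toℚᵘ-injective
  (ℚᵘ.≃-trans (toι (a ℕ.* b))
  (ℚᵘ.≃-trans (ℚᵘ.*≡* (cong (ℤ._* ℤ.+ 1) (ℤ.pos-* a b)))
  (ℚᵘ.≃-sym (ℚᵘ.≃-trans (ℚ.toℚᵘ-homo-* (ι a) (ι b)) (ℚᵘ.*-cong (toι a) (toι b))))))

/suc-* : ∀ a n → a /suc n ℚ.* ι (suc n) ≡ ι a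
/suc-* a n = ℚ.toℚᵘ-injective
  (ℚᵘ.≃-trans (ℚ.toℚᵘ-homo-* (a /suc n) (ι (suc n)))
  (ℚᵘ.≃-trans (ℚᵘ.*-cong (ℚ.toℚᵘ-fromℚᵘ (ℚᵘ.mkℚᵘ (ℤ.+ a) n)) (toι (suc n)))
  (ℚᵘ.≃-trans (ℚᵘ.*≡* (trans (ℤ.*-identityʳ (ℤ.+ a ℤ.* ℤ.+ suc n))
     (cong (λ d → ℤ.+ a ℤ.* ℤ.+ suc d) (sym (ℕ.*-identityʳ n)))))
  (ℚᵘ.≃-sym (toι a)))))

ι-mono : ∀ {a b} → a ℕ.≤ b → ι a ℚ.≤ ι b
ι-mono {a} {b} a≤b = ℚ.toℚᵘ-cancel-≤
  (ℚᵘ.≤-trans (ℚᵘ.≤-reflexive (toι a))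
  (ℚᵘ.≤-trans (ℚᵘ.*≤* (ℤ.*-monoʳ-≤-nonNeg (ℤ.+ 1) (ℤ.+≤+ a≤b)))
  (ℚᵘ.≤-reflexive (ℚᵘ.≃-sym (toι b)))))

ι-mono-< : ∀ {a b} → a ℕ.< b → ι a ℚ.< ι b
ι-mono-< {a} {b} a<b = ℚ.toℚᵘ-cancel-<
  (ℚᵘ.≤-<-trans (ℚᵘ.≤-reflexive (toι a))
  (ℚᵘ.<-≤-trans (ℚᵘ.*<* (ℤ.*-monoʳ-<-pos (ℤ.+ 1) (ℤ.+<+ a<b)))
  (ℚᵘ.≤-reflexive (ℚᵘ.≃-sym (toι b)))))

ι-cancel-< : ∀ {a b} → ι a ℚ.< ι b → a ℕ.< b
ι-cancel-< {a} {b} a<b with a ℕ.<? b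
... | yes p = p
... | no  p = contradiction (ℚ.<-≤-trans a<b (ι-mono {b} {a} (ℕ.≮⇒≥ p))) (ℚ.<-irrefl refl)

ι-nonNeg : ∀ k → 0ℚ ℚ.≤ ι k
ι-nonNeg k = ι-mono {0} {k} ℕ.z≤n

ι-pos : ∀ k → 0ℚ ℚ.< ι (suc k)
ι-pos k = ι-mono-< {0} {suc k} (ℕ.s≤s ℕ.z≤n)

floor-bounds : ∀ q → 0ℚ ℚ.≤ q →
               ι ℤ.∣ floor q ∣ ℚ.≤ q × q ℚ.< ι (suc ℤ.∣ floor q ∣)
floor-bounds q@(mkℚ (ℤ.+ m) d _) _ = lower , upper
  where
  k = m ℕ./ suc d
  ∣floor∣ : ℤ.∣ floor q ∣ ≡ k
  ∣floor∣ = cong ℤ.∣_∣ (ℤ.*-identityˡ (ℤ.+ k))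
  lower : ι ℤ.∣ floor q ∣ ℚ.≤ q
  lower = subst (λ j → ι j ℚ.≤ q) (sym ∣floor∣) (ℚ.toℚᵘ-cancel-≤
    (ℚᵘ.≤-respˡ-≃ (ℚᵘ.≃-sym (toι k)) (ℚᵘ.*≤*
      (subst₂ ℤ._≤_ (ℤ.pos-* k (suc d)) (ℤ.pos-* m 1)
        (ℤ.+≤+ (subst (k ℕ.* suc d ℕ.≤_) (sym (ℕ.*-identityʳ m)) (ℕ.m/n*n≤m m (suc d))))))))
  upper : q ℚ.< ι (suc ℤ.∣ floor q ∣)
  upper = subst (λ j → q ℚ.< ι (suc j)) (sym ∣floor∣) (ℚ.toℚᵘ-cancel-<
    (ℚᵘ.<-respʳ-≃ (ℚᵘ.≃-sym (toι (suc k))) (ℚᵘ.*<*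
      (subst₂ ℤ._<_ (ℤ.pos-* m 1) (ℤ.pos-* (suc k) (suc d))
        (ℤ.+<+ (subst (ℕ._< suc k ℕ.* suc d) (sym (ℕ.*-identityʳ m))
          (subst (ℕ._< suc k ℕ.* suc d) (sym (ℕ.m≡m%n+[m/n]*n m (suc d)))
            (ℕ.+-monoˡ-< (k ℕ.* suc d) (ℕ.m%n<n m (suc d))))))))))
floor-bounds (mkℚ ℤ.-[1+ _ ] _ _) (ℚ.*≤* ())

*-monoˡ : ∀ {a b c} → 0ℚ ℚ.≤ c → a ℚ.≤ b → a ℚ.* c ℚ.≤ b ℚ.* c
*-monoˡ {c = c} 0≤c = ℚ.*-monoʳ-≤-nonNeg c {{ℚ.nonNegative 0≤c}}

*-monoʳ : ∀ {a b c} → 0ℚ ℚ.≤ c → a ℚ.≤ b → c ℚ.* a ℚ.≤ c ℚ.* b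
*-monoʳ {c = c} 0≤c = ℚ.*-monoˡ-≤-nonNeg c {{ℚ.nonNegative 0≤c}}

*-mono : ∀ {a b c d} → 0ℚ ℚ.≤ a → 0ℚ ℚ.≤ d → a ℚ.≤ b → c ℚ.≤ d → a ℚ.* c ℚ.≤ b ℚ.* d
*-mono 0≤a 0≤d a≤b c≤d = ℚ.≤-trans (*-monoʳ 0≤a c≤d) (*-monoˡ 0≤d a≤b)

*-cancelʳ : ∀ {a b c} → 0ℚ ℚ.< c → a ℚ.* c ℚ.≤ b ℚ.* c → a ℚ.≤ b
*-cancelʳ {c = c} 0<c = ℚ.*-cancelʳ-≤-pos c {{ℚ.positive 0<c}}

*-nonNeg : ∀ {a b} → 0ℚ ℚ.≤ a → 0ℚ ℚ.≤ b → 0ℚ ℚ.≤ a ℚ.* b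
*-nonNeg {a} {b} 0≤a 0≤b = subst (ℚ._≤ a ℚ.* b) (ℚ.*-zeroˡ b) (*-monoˡ 0≤b 0≤a)

*-pos : ∀ {a b} → 0ℚ ℚ.< a → 0ℚ ℚ.< b → 0ℚ ℚ.< a ℚ.* b
*-pos {a} {b} 0<a 0<b =
  subst (ℚ._< a ℚ.* b) (ℚ.*-zeroˡ b) (ℚ.*-monoˡ-<-pos b {{ℚ.positive 0<b}} 0<a)

x≤x+y : ∀ {x y} → 0ℚ ℚ.≤ y → x ℚ.≤ x ℚ.+ y
x≤x+y {x} {y} 0≤y = subst (ℚ._≤ x ℚ.+ y) (ℚ.+-identityʳ x) (ℚ.+-monoʳ-≤ x 0≤y)

0≤1 : 0ℚ ℚ.≤ 1ℚ
0≤1 = ι-nonNeg 1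

0<½ : 0ℚ ℚ.< ½
0<½ = ℚ.positive⁻¹ ½

half : ℚ → ℚ
half e = ½ ℚ.* e

half-pos : ∀ {e} → 0ℚ ℚ.< e → 0ℚ ℚ.< half e
half-pos = *-pos 0<½

half+half : ∀ e → half e ℚ.+ half e ≡ e
half+half = solve 1 (λ e → con ½ :* e :+ con ½ :* e := e) refl

divide : ∀ {D e} → 0ℚ ℚ.< D → 0ℚ ℚ.< e → ∃ λ d → 0ℚ ℚ.< d × D ℚ.* d ≡ e
divide {D} {e} 0<D 0<e = ℚ.1/ D ℚ.* e , *-pos (ℚ.positive⁻¹ (ℚ.1/ D) {{ℚ.1/pos⇒pos D}}) 0<e ,
  trans (sym (ℚ.*-assoc D (ℚ.1/ D) e))
    (trans (cong (ℚ._* e) (ℚ.*-inverseʳ D)) (ℚ.*-identityˡ e))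
  where
  instance
    D⁺ = ℚ.positive 0<D
    D≢0 = ℚ.pos⇒nonZero D {{D⁺}}

/suc-≤ : ∀ a n {q} → ι a ℚ.≤ q ℚ.* ι (suc n) → a /suc n ℚ.≤ q
/suc-≤ a n {q} h =
  *-cancelʳ (ι-pos n) (subst (ℚ._≤ q ℚ.* ι (suc n)) (sym (/suc-* a n)) h)

/suc-nonNeg : ∀ a n → 0ℚ ℚ.≤ a /suc n
/suc-nonNeg a n = *-cancelʳ (ι-pos n)
  (subst₂ ℚ._≤_ (sym (ℚ.*-zeroˡ (ι (suc n)))) (sym (/suc-* a n)) (ι-nonNeg a))

/suc-pos : ∀ a n → 0ℚ ℚ.< suc a /suc n
/suc-pos a n = ℚ.*-cancelʳ-<-nonNeg (ι (suc n)) {{ℚ.nonNegative (ι-nonNeg (suc n))}}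
  (subst₂ ℚ._<_ (sym (ℚ.*-zeroˡ (ι (suc n)))) (sym (/suc-* (suc a) n)) (ι-pos a))

/suc-antimono : ∀ {k n} → k ℕ.≤ n → 1 /suc n ℚ.≤ 1 /suc k
/suc-antimono {k} {n} k≤n = /suc-≤ 1 n
  (subst (ℚ._≤ 1 /suc k ℚ.* ι (suc n)) (/suc-* 1 k)
    (*-monoʳ (/suc-nonNeg 1 k) (ι-mono {suc k} {suc n} (ℕ.s≤s k≤n))))

archimedean : ∀ e → 0ℚ ℚ.< e → ∃ λ k → 1 /suc k ℚ.≤ e
archimedean (mkℚ (ℤ.+ zero)    d _) (ℚ.*<* (ℤ.+<+ ()))
archimedean (mkℚ ℤ.-[1+ _ ]    d _) (ℚ.*<* ())
archimedean (mkℚ (ℤ.+ (suc m)) d _) _ = d , ℚ.toℚᵘ-cancel-≤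
  (ℚᵘ.≤-respˡ-≃ (ℚᵘ.≃-sym (ℚ.toℚᵘ-fromℚᵘ (ℚᵘ.mkℚᵘ (ℤ.+ 1) d)))
    (ℚᵘ.*≤* (ℤ.*-monoʳ-≤-nonNeg (ℤ.+ suc d) (ℤ.+≤+ (ℕ.s≤s (ℕ.z≤n {m}))))))

^-nonNeg : ∀ {a} n → 0ℚ ℚ.≤ a → 0ℚ ℚ.≤ a ^ℚ n
^-nonNeg zero    0≤a = 0≤1
^-nonNeg (suc n) 0≤a = *-nonNeg 0≤a (^-nonNeg n 0≤a)

^-mono : ∀ {a b} n → 0ℚ ℚ.≤ a → a ℚ.≤ b → a ^ℚ n ℚ.≤ b ^ℚ n
^-mono zero    0≤a a≤b = ℚ.≤-refl
^-mono (suc n) 0≤a a≤b =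
  *-mono 0≤a (^-nonNeg n (ℚ.≤-trans 0≤a a≤b)) a≤b (^-mono n 0≤a a≤b)

1≤^ : ∀ {a} n → 1ℚ ℚ.≤ a → 1ℚ ℚ.≤ a ^ℚ n
1≤^ zero    1≤a = ℚ.≤-refl
1≤^ (suc n) 1≤a = *-mono 0≤1 (^-nonNeg n (ℚ.≤-trans 0≤1 1≤a)) 1≤a (1≤^ n 1≤a)

^-mono-< : ∀ {a b} n → 0ℚ ℚ.≤ a → a ℚ.< b → a ^ℚ suc n ℚ.< b ^ℚ suc n
^-mono-< {a} {b} n 0≤a a<b = ℚ.≤-<-trans
  (*-monoʳ {a ^ℚ n} {b ^ℚ n} {a} 0≤a (^-mono n 0≤a (ℚ.<⇒≤ a<b)))
  (ℚ.*-monoˡ-<-pos (b ^ℚ n) {{ℚ.positive (bⁿ n)}} a<b)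
  where
  bⁿ : ∀ n → 0ℚ ℚ.< b ^ℚ n
  bⁿ zero    = ι-pos 0
  bⁿ (suc n) = *-pos (ℚ.≤-<-trans 0≤a a<b) (bⁿ n)

ι-^ : ∀ a n → ι (a ℕ.^ n) ≡ ι a ^ℚ n
ι-^ a zero    = refl
ι-^ a (suc n) = trans (ι-* a (a ℕ.^ n)) (cong (ι a ℚ.*_) (ι-^ a n))

bernoulli : ∀ {η} n → 0ℚ ℚ.≤ η → η ℚ.≤ 1ℚ → 1ℚ ℚ.- ι n ℚ.* η ℚ.≤ (1ℚ ℚ.- η) ^ℚ n
bernoulli {η} zero 0≤η η≤1 = ℚ.≤-reflexive (trans (cong (λ z → 1ℚ ℚ.- z) (ℚ.*-zeroˡ η)) refl)
bernoulli {η} (suc n) 0≤η η≤1 = ℚ.≤-trans step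
  (*-monoʳ {1ℚ ℚ.- ι n ℚ.* η} {(1ℚ ℚ.- η) ^ℚ n} {1ℚ ℚ.- η} 0≤1-η (bernoulli n 0≤η η≤1))
  where
  0≤1-η : 0ℚ ℚ.≤ 1ℚ ℚ.- η
  0≤1-η = subst (ℚ._≤ 1ℚ ℚ.- η) (ℚ.+-inverseʳ η) (ℚ.+-monoˡ-≤ (ℚ.- η) η≤1)
  step : 1ℚ ℚ.- ι (suc n) ℚ.* η ℚ.≤ (1ℚ ℚ.- η) ℚ.* (1ℚ ℚ.- ι n ℚ.* η)
  step = subst₂ ℚ._≤_
    (cong (λ z → 1ℚ ℚ.- z ℚ.* η) (sym (ι-+ 1 n)))
    (solve 2 (λ k e → (con 1ℚ :- (con 1ℚ :+ k) :* e) :+ k :* (e :* e)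
                   := (con 1ℚ :- e) :* (con 1ℚ :- k :* e)) refl (ι n) η)
    (x≤x+y (*-nonNeg (ι-nonNeg n) (*-nonNeg 0≤η 0≤η)))

⌊√_⌋ : ℕ → ℕ
⌊√ zero  ⌋ = 0
⌊√ suc m ⌋ with ⌊√ m ⌋
... | r with suc r ℕ.* suc r ℕ.≤? suc m
...   | yes _ = suc r
...   | no  _ = r

⌊√⌋-bounds : ∀ m → ⌊√ m ⌋ ℕ.* ⌊√ m ⌋ ℕ.≤ m × m ℕ.< suc ⌊√ m ⌋ ℕ.* suc ⌊√ m ⌋
⌊√⌋-bounds zero = ℕ.z≤n , ℕ.s≤s ℕ.z≤n
⌊√⌋-bounds (suc m) with ⌊√ m ⌋ | ⌊√⌋-bounds m
... | r | lower , upper with suc r ℕ.* suc r ℕ.≤? suc m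
...   | yes p = p , ℕ.≤-<-trans upper (ℕ.*-mono-< {suc r} {suc (suc r)} {suc r} {suc (suc r)} (ℕ.n<1+n _) (ℕ.n<1+n _))
...   | no ¬p = ℕ.≤-trans lower (ℕ.n≤1+n m) , ℕ.≰⇒> ¬p

⌊log₂⌋-< : ∀ l f .{{_ : NonZero f}} → f ℕ.< 2 ℕ.^ l → ⌊log₂ f ⌋ ℕ.< l
⌊log₂⌋-< zero    (suc f) (ℕ.s≤s ())
⌊log₂⌋-< (suc l) 1             h = ℕ.s≤s ℕ.z≤n
⌊log₂⌋-< (suc l) f@(suc (suc f′)) h =
  ℕ.<-≤-trans (ℕ.s≤s (ℕ.m≤n+m∸n ⌊log₂ f ⌋ 1))
    (ℕ.s≤s (subst (λ z → suc z ℕ.≤ l) (⌊log₂⌊n/2⌋⌋≡⌊log₂n⌋∸1 f)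
      (⌊log₂⌋-< l (ℕ.⌊ f /2⌋) (ℕ.*-cancelˡ-< 2 _ _ (ℕ.≤-<-trans halve h)))))
  where
  halve : 2 ℕ.* ℕ.⌊ f /2⌋ ℕ.≤ f
  halve = subst (2 ℕ.* ℕ.⌊ f /2⌋ ℕ.≤_) (ℕ.⌊n/2⌋+⌈n/2⌉≡n f)
    (ℕ.+-monoʳ-≤ ℕ.⌊ f /2⌋ (subst (ℕ._≤ ℕ.⌈ f /2⌉) (sym (ℕ.+-identityʳ _)) (ℕ.⌊n/2⌋≤⌈n/2⌉ f)))

⌊log₂⌋-bounds : ∀ f .{{_ : NonZero f}} →
                2 ℕ.^ ⌊log₂ f ⌋ ℕ.≤ f × f ℕ.< 2 ℕ.^ suc ⌊log₂ f ⌋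
⌊log₂⌋-bounds f =
    ℕ.≮⇒≥ (λ h → ℕ.<-irrefl refl (⌊log₂⌋-< ⌊log₂ f ⌋ f h))
  , ℕ.≰⇒> (λ h → ℕ.<-irrefl refl
      (subst (ℕ._≤ ⌊log₂ f ⌋) (⌊log₂[2^n]⌋≡n (suc ⌊log₂ f ⌋)) (⌊log₂⌋-mono-≤ h)))

Cauchy : (ℕ → ℚ) → Set
Cauchy x = ∀ e → 0ℚ ℚ.< e →
  ∃ λ N → ∀ m n → N ℕ.≤ m → N ℕ.≤ n → ℚ.∣ x m ℚ.- x n ∣ ℚ.≤ e

-- Exchanging m and n shows that the absolute value may be dropped.
Cauchy⁺ : (ℕ → ℚ) → Set
Cauchy⁺ x = ∀ e → 0ℚ ℚ.< e →
  ∃ λ N → ∀ m n → N ℕ.≤ m → N ℕ.≤ n → x m ℚ.≤ x n ℚ.+ e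

p≤∣p∣ : ∀ p → p ℚ.≤ ℚ.∣ p ∣
p≤∣p∣ p with ℚ.≤-total 0ℚ p
... | inj₁ 0≤p = ℚ.≤-reflexive (sym (ℚ.0≤p⇒∣p∣≡p 0≤p))
... | inj₂ p≤0 = ℚ.≤-trans p≤0 (ℚ.0≤∣p∣ p)

∣p∣≤ : ∀ {p q} → p ℚ.≤ q → ℚ.- p ℚ.≤ q → ℚ.∣ p ∣ ℚ.≤ q
∣p∣≤ {p} p≤q -p≤q with ℚ.∣p∣≡p∨∣p∣≡-p p
... | inj₁ eq = subst (ℚ._≤ _) (sym eq) p≤q
... | inj₂ eq = subst (ℚ._≤ _) (sym eq) -p≤q

∣∣≤⇒≤+ : ∀ {a b e} → ℚ.∣ a ℚ.- b ∣ ℚ.≤ e → a ℚ.≤ b ℚ.+ e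
∣∣≤⇒≤+ {a} {b} {e} h = subst (ℚ._≤ b ℚ.+ e)
  (solve 2 (λ a b → b :+ (a :- b) := a) refl a b)
  (ℚ.+-monoʳ-≤ b (ℚ.≤-trans (p≤∣p∣ (a ℚ.- b)) h))

≤+⇒-≤ : ∀ {a b e} → a ℚ.≤ b ℚ.+ e → a ℚ.- b ℚ.≤ e
≤+⇒-≤ {a} {b} {e} h = subst (a ℚ.- b ℚ.≤_)
  (solve 2 (λ b e → (b :+ e) :- b := e) refl b e) (ℚ.+-monoˡ-≤ (ℚ.- b) h)

toCauchy⁺ : ∀ x → Cauchy x → Cauchy⁺ x
toCauchy⁺ x c e 0<e with c e 0<e
... | N , h = N , λ m n N≤m N≤n → ∣∣≤⇒≤+ (h m n N≤m N≤n)

fromCauchy⁺ : ∀ x → Cauchy⁺ x → Cauchy x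
fromCauchy⁺ x c e 0<e with c e 0<e
... | N , h = N , λ m n N≤m N≤n → ∣p∣≤
  (≤+⇒-≤ (h m n N≤m N≤n))
  (subst (ℚ._≤ e) (solve 2 (λ a b → b :- a := :- (a :- b)) refl (x m) (x n))
    (≤+⇒-≤ (h n m N≤n N≤m)))

record ℝ : Set where
  constructor mkℝ
  field
    seq    : ℕ → ℚ
    cauchy : Cauchy seq

open ℝ public

infix  4 _≤_ _<_ _≃_
infixl 6 _+_ _-_
infixl 7 _*_
infix  8 -_

_≤_ : ℝ → ℝ → Set
x ≤ y = ∀ e → 0ℚ ℚ.< e → ∃ λ N → ∀ n → N ℕ.≤ n → seq x n ℚ.≤ seq y n ℚ.+ e

_<_ : ℝ → ℝ → Set
x < y = ∃ λ c → 0ℚ ℚ.< c × ∃ λ N → ∀ n → N ℕ.≤ n → seq x n ℚ.+ c ℚ.≤ seq y n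

_≃_ : ℝ → ℝ → Set
x ≃ y = x ≤ y × y ≤ x

fromℚ : ℚ → ℝ
fromℚ q = mkℝ (λ _ → q) (fromCauchy⁺ (λ _ → q) λ e 0<e → 0 , λ _ _ _ _ → x≤x+y (ℚ.<⇒≤ 0<e))

0ℝ 1ℝ ½ℝ : ℝ
0ℝ = fromℚ 0ℚ
1ℝ = fromℚ 1ℚ
½ℝ = fromℚ ½

fromℕ : ℕ → ℝ
fromℕ k = fromℚ (ι k)

⊔ˡ : ∀ a b {c} → a ℕ.⊔ b ℕ.≤ c → a ℕ.≤ c
⊔ˡ a b = ℕ.≤-trans (ℕ.m≤m⊔n a b)

⊔ʳ : ∀ a b {c} → a ℕ.⊔ b ℕ.≤ c → b ℕ.≤ c
⊔ʳ a b = ℕ.≤-trans (ℕ.m≤n⊔m a b)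

abstract
  +-cauchy : ∀ x y → Cauchy (λ n → seq x n ℚ.+ seq y n)
  +-cauchy x y = fromCauchy⁺ _ λ e 0<e →
    let N₁ , h₁ = toCauchy⁺ (seq x) (cauchy x) (half e) (half-pos 0<e)
        N₂ , h₂ = toCauchy⁺ (seq y) (cauchy y) (half e) (half-pos 0<e)
    in N₁ ℕ.⊔ N₂ , λ m n N≤m N≤n →
      subst (seq x m ℚ.+ seq y m ℚ.≤_)
        (solve 3 (λ a b e → (a :+ con ½ :* e) :+ (b :+ con ½ :* e) := (a :+ b) :+ e)
          refl (seq x n) (seq y n) e)
        (ℚ.+-mono-≤ (h₁ m n (⊔ˡ N₁ N₂ N≤m) (⊔ˡ N₁ N₂ N≤n))
                    (h₂ m n (⊔ʳ N₁ N₂ N≤m) (⊔ʳ N₁ N₂ N≤n)))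

_+_ : ℝ → ℝ → ℝ
x + y = mkℝ (λ n → seq x n ℚ.+ seq y n) (+-cauchy x y)

abstract
  neg-cauchy : ∀ x → Cauchy (λ n → ℚ.- seq x n)
  neg-cauchy x e 0<e =
    let N , h = cauchy x e 0<e
    in N , λ m n N≤m N≤n →
      subst (λ z → ℚ.∣ z ∣ ℚ.≤ e)
        (solve 2 (λ a b → b :- a := :- a :- :- b) refl (seq x m) (seq x n))
        (h n m N≤n N≤m)

-_ : ℝ → ℝ
- x = mkℝ (λ n → ℚ.- seq x n) (neg-cauchy x)

_-_ : ℝ → ℝ → ℝ
x - y = x + - y

abstract
  ∣∣-cauchy : ∀ x → Cauchy (λ n → ℚ.∣ seq x n ∣)
  ∣∣-cauchy x = fromCauchy⁺ _ λ e 0<e →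
    let N , h = cauchy x e 0<e
    in N , λ m n N≤m N≤n →
      ℚ.≤-trans
        (subst (λ z → ℚ.∣ z ∣ ℚ.≤ ℚ.∣ seq x n ∣ ℚ.+ ℚ.∣ seq x m ℚ.- seq x n ∣)
          (solve 2 (λ a b → b :+ (a :- b) := a) refl (seq x m) (seq x n))
          (ℚ.∣p+q∣≤∣p∣+∣q∣ (seq x n) (seq x m ℚ.- seq x n)))
        (ℚ.+-monoʳ-≤ ℚ.∣ seq x n ∣ (h m n N≤m N≤n))

∣_∣ : ℝ → ℝ
∣ x ∣ = mkℝ (λ n → ℚ.∣ seq x n ∣) (∣∣-cauchy x)

bounded : ∀ x → ∃₂ λ B N → 1ℚ ℚ.≤ B × (∀ n → N ℕ.≤ n → ℚ.∣ seq x n ∣ ℚ.≤ B)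
bounded x =
  let N , h = toCauchy⁺ (seq ∣ x ∣) (cauchy ∣ x ∣) 1ℚ (ι-pos 0)
      a = ℚ.∣ seq x N ∣
  in a ℚ.+ 1ℚ , N , subst (1ℚ ℚ.≤_) (ℚ.+-comm 1ℚ a) (x≤x+y (ℚ.0≤∣p∣ (seq x N))) ,
     λ n N≤n → h n N N≤n ℕ.≤-refl

abstract
  *-cauchy : ∀ x y → Cauchy (λ n → seq x n ℚ.* seq y n)
  *-cauchy x y e 0<e =
    let B , N₀ , 1≤B , hB = bounded x
        C , M₀ , 1≤C , hC = bounded y
        0≤B = ℚ.≤-trans 0≤1 1≤B
        0≤C = ℚ.≤-trans 0≤1 1≤C
        D = B ℚ.+ C
        0<D = ℚ.<-≤-trans (ι-pos 0) (ℚ.≤-trans 1≤B (x≤x+y 0≤C))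
        d , 0<d , Dd≡e = divide 0<D 0<e
        N₁ , h₁ = cauchy x d 0<d
        N₂ , h₂ = cauchy y d 0<d
        N₀₀ = N₀ ℕ.⊔ M₀
        N₁₂ = N₁ ℕ.⊔ N₂
    in N₀₀ ℕ.⊔ N₁₂ , λ m n N≤m N≤n →
      let a = seq x m; a′ = seq x n; b = seq y m; b′ = seq y n in
      subst₂ ℚ._≤_
        (cong ℚ.∣_∣ (solve 4 (λ a a′ b b′ → a :* (b :- b′) :+ (a :- a′) :* b′ := a :* b :- a′ :* b′)
          refl a a′ b b′))
        (trans (solve 3 (λ B C d → B :* d :+ d :* C := (B :+ C) :* d) refl B C d) Dd≡e)
        (ℚ.≤-trans (ℚ.∣p+q∣≤∣p∣+∣q∣ (a ℚ.* (b ℚ.- b′)) ((a ℚ.- a′) ℚ.* b′))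
          (subst₂ (λ u v → u ℚ.+ v ℚ.≤ B ℚ.* d ℚ.+ d ℚ.* C)
            (sym (ℚ.∣p*q∣≡∣p∣*∣q∣ a (b ℚ.- b′))) (sym (ℚ.∣p*q∣≡∣p∣*∣q∣ (a ℚ.- a′) b′))
            (ℚ.+-mono-≤
              (*-mono (ℚ.0≤∣p∣ a) (ℚ.<⇒≤ 0<d)
                (hB m (⊔ˡ N₀ M₀ (⊔ˡ N₀₀ N₁₂ N≤m)))
                (h₂ m n (⊔ʳ N₁ N₂ (⊔ʳ N₀₀ N₁₂ N≤m)) (⊔ʳ N₁ N₂ (⊔ʳ N₀₀ N₁₂ N≤n))))
              (*-mono (ℚ.0≤∣p∣ (a ℚ.- a′)) 0≤C
                (h₁ m n (⊔ˡ N₁ N₂ (⊔ʳ N₀₀ N₁₂ N≤m)) (⊔ˡ N₁ N₂ (⊔ʳ N₀₀ N₁₂ N≤n)))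
                (hC n (⊔ʳ N₀ M₀ (⊔ˡ N₀₀ N₁₂ N≤n)))))))

_*_ : ℝ → ℝ → ℝ
x * y = mkℝ (λ n → seq x n ℚ.* seq y n) (*-cauchy x y)

inv : ∀ {q} → 0ℚ ℚ.< q → ℚ
inv {q} 0<q = (ℚ.1/ q) {{ℚ.pos⇒nonZero q {{ℚ.positive 0<q}}}}

0<c⊔q : ∀ {c} q → 0ℚ ℚ.< c → 0ℚ ℚ.< c ℚ.⊔ q
0<c⊔q {c} q 0<c = ℚ.<-≤-trans 0<c (ℚ.p≤p⊔q c q)

⊔-lip : ∀ c a b {e} → 0ℚ ℚ.≤ e → a ℚ.≤ b ℚ.+ e → c ℚ.⊔ a ℚ.≤ (c ℚ.⊔ b) ℚ.+ e
⊔-lip c a b {e} 0≤e h = ℚ.⊔-lub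
  (ℚ.≤-trans (ℚ.p≤p⊔q c b) (x≤x+y 0≤e))
  (ℚ.≤-trans h (ℚ.+-monoˡ-≤ e (ℚ.p≤q⊔p c b)))

inv-* : ∀ {q} (0<q : 0ℚ ℚ.< q) → inv 0<q ℚ.* q ≡ 1ℚ
inv-* {q} 0<q = ℚ.*-inverseˡ q {{ℚ.pos⇒nonZero q {{ℚ.positive 0<q}}}}

abstract
  ⁻¹-cauchy : ∀ x {c} (0<c : 0ℚ ℚ.< c) → Cauchy (λ n → inv (0<c⊔q (seq x n) 0<c))
  ⁻¹-cauchy x {c} 0<c = fromCauchy⁺ (λ n → inv (0<c⊔q (seq x n) 0<c)) λ e 0<e →
    let d = e ℚ.* (c ℚ.* c)
        0<d = *-pos 0<e (*-pos 0<c 0<c)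
        N , h = toCauchy⁺ (seq x) (cauchy x) d 0<d
    in N , λ m n N≤m N≤n →
      let a = c ℚ.⊔ seq x m
          b = c ℚ.⊔ seq x n
          0<a = 0<c⊔q (seq x m) 0<c
          0<b = 0<c⊔q (seq x n) 0<c
          i = inv 0<a
          j = inv 0<b
          b≤a+d = ⊔-lip c (seq x n) (seq x m) (ℚ.<⇒≤ 0<d) (h n m N≤n N≤m)
          cc≤ab = *-mono (ℚ.<⇒≤ 0<c) (ℚ.<⇒≤ 0<b) (ℚ.p≤p⊔q c (seq x m)) (ℚ.p≤p⊔q c (seq x n))
      in *-cancelʳ (*-pos 0<a 0<b) (subst₂ ℚ._≤_
           (trans (sym (ℚ.*-identityˡ b)) (trans (cong (ℚ._* b) (sym (inv-* 0<a)))
             (solve 3 (λ i a b → (i :* a) :* b := i :* (a :* b)) refl i a b)))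
           (trans (cong (ℚ._+ e ℚ.* (a ℚ.* b)) (trans (sym (ℚ.*-identityˡ a)) (cong (ℚ._* a) (sym (inv-* 0<b)))))
             (solve 4 (λ j a b e → (j :* b) :* a :+ e :* (a :* b) := (j :+ e) :* (a :* b)) refl j a b e))
           (ℚ.≤-trans b≤a+d (ℚ.+-monoʳ-≤ a (*-monoʳ (ℚ.<⇒≤ 0<e) cc≤ab))))

-- The positivity proof supplies a rational c > 0 below all but finitely many
-- terms of x, so c ⊔ seq x n differs from seq x n only finitely often.
inverse : ∀ x → 0ℝ < x → ℝ
inverse x (c , 0<c , _) = mkℝ (λ n → inv (0<c⊔q (seq x n) 0<c)) (⁻¹-cauchy x 0<c)

-- √ℚ q n = ⌊√(N²q)⌋ / N with N = n + 1
√ℚ : ℚ → ℕ → ℚ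
√ℚ q n = ⌊√ ℤ.∣ floor (q ℚ.* (ι (suc n) ℚ.* ι (suc n))) ∣ ⌋ /suc n

√ℚ-nonNeg : ∀ q n → 0ℚ ℚ.≤ √ℚ q n
√ℚ-nonNeg q n = /suc-nonNeg ⌊√ ℤ.∣ floor (q ℚ.* (ι (suc n) ℚ.* ι (suc n))) ∣ ⌋ n

√ℚ-bounds : ∀ q n → 0ℚ ℚ.≤ q →
  √ℚ q n ℚ.* √ℚ q n ℚ.≤ q × q ℚ.≤ (√ℚ q n ℚ.+ 1 /suc n) ℚ.* (√ℚ q n ℚ.+ 1 /suc n)
√ℚ-bounds q n 0≤q = lower , upper
  where
  N = ι (suc n)
  0<N : 0ℚ ℚ.< N
  0<N = ι-pos n
  0<NN = *-pos 0<N 0<N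
  z = q ℚ.* (N ℚ.* N)
  f = ℤ.∣ floor z ∣
  s = ⌊√ f ⌋
  r = s /suc n
  u = 1 /suc n
  fb = floor-bounds z (*-nonNeg 0≤q (ℚ.<⇒≤ 0<NN))
  sb = ⌊√⌋-bounds f
  rN≡s : r ℚ.* N ≡ ι s
  rN≡s = /suc-* s n
  square : ∀ a b → (a ℚ.* b) ℚ.* (a ℚ.* b) ≡ (a ℚ.* a) ℚ.* (b ℚ.* b)
  square = solve 2 (λ a b → (a :* b) :* (a :* b) := (a :* a) :* (b :* b)) refl
  lower : r ℚ.* r ℚ.≤ q
  lower = *-cancelʳ 0<NN (subst (ℚ._≤ z)
    (trans (ι-* s s) (trans (cong (λ t → t ℚ.* t) (sym rN≡s)) (square r N)))
    (ℚ.≤-trans (ι-mono {s ℕ.* s} {f} (proj₁ sb)) (proj₁ fb)))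
  1+s : (r ℚ.+ u) ℚ.* N ≡ ι (suc s)
  1+s = trans (ℚ.*-distribʳ-+ N r u)
    (trans (cong₂ ℚ._+_ rN≡s (/suc-* 1 n)) (trans (ℚ.+-comm (ι s) (ι 1)) (sym (ι-+ 1 s))))
  upper : q ℚ.≤ (r ℚ.+ u) ℚ.* (r ℚ.+ u)
  upper = *-cancelʳ 0<NN (subst (z ℚ.≤_)
    (trans (ι-* (suc s) (suc s)) (trans (cong (λ t → t ℚ.* t) (sym 1+s)) (square (r ℚ.+ u) N)))
    (ℚ.≤-trans (ℚ.<⇒≤ (proj₂ fb)) (ι-mono {suc f} {suc s ℕ.* suc s} (proj₂ sb))))

√-mono : ∀ r s → 0ℚ ℚ.≤ s → r ℚ.* r ℚ.≤ s ℚ.* s → r ℚ.≤ s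
√-mono r s 0≤s rr≤ss = ℚ.≮⇒≥ λ s<r → ℚ.<-irrefl refl
  (ℚ.<-≤-trans
    (ℚ.≤-<-trans (*-monoʳ 0≤s (ℚ.<⇒≤ s<r))
      (ℚ.*-monoˡ-<-pos r {{ℚ.positive (ℚ.≤-<-trans 0≤s s<r)}} s<r))
    rr≤ss)

abstract
  √-cauchy : ∀ x → Cauchy (λ n → √ℚ (0ℚ ℚ.⊔ seq x n) n)
  √-cauchy x = fromCauchy⁺ (λ n → √ℚ (0ℚ ℚ.⊔ seq x n) n) λ e 0<e →
    let η = half e
        0<η = half-pos 0<e
        N , h = toCauchy⁺ (seq x) (cauchy x) (η ℚ.* η) (*-pos 0<η 0<η)
        k , 1/k≤η = archimedean η 0<η
    in N ℕ.⊔ k , λ m n N≤m N≤n →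
      let X = 0ℚ ℚ.⊔ seq x m
          Y = 0ℚ ℚ.⊔ seq x n
          r = √ℚ X m
          t = √ℚ Y n
          0≤t : 0ℚ ℚ.≤ t
          0≤t = √ℚ-nonNeg Y n
          0≤t+u = ℚ.+-mono-≤ 0≤t (/suc-nonNeg 1 n)
          t+u≤t+η = ℚ.+-monoʳ-≤ t (ℚ.≤-trans (/suc-antimono (⊔ʳ N k N≤n)) 1/k≤η)
          0≤t+η = ℚ.+-mono-≤ 0≤t (ℚ.<⇒≤ 0<η)
          X≤Y+ηη : X ℚ.≤ Y ℚ.+ η ℚ.* η
          X≤Y+ηη = ⊔-lip 0ℚ (seq x m) (seq x n) (ℚ.<⇒≤ (*-pos 0<η 0<η)) (h m n (⊔ˡ N k N≤m) (⊔ˡ N k N≤n))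
          Y≤ : Y ℚ.≤ (t ℚ.+ η) ℚ.* (t ℚ.+ η)
          Y≤ = ℚ.≤-trans (proj₂ (√ℚ-bounds Y n (ℚ.p≤p⊔q 0ℚ (seq x n))))
                         (*-mono 0≤t+u 0≤t+η t+u≤t+η t+u≤t+η)
          rr≤ : r ℚ.* r ℚ.≤ (t ℚ.+ e) ℚ.* (t ℚ.+ e)
          rr≤ = ℚ.≤-trans (proj₁ (√ℚ-bounds X m (ℚ.p≤p⊔q 0ℚ (seq x m))))
                (ℚ.≤-trans X≤Y+ηη
                (ℚ.≤-trans (ℚ.+-monoˡ-≤ (η ℚ.* η) Y≤)
                (ℚ.≤-trans (x≤x+y (*-nonNeg (ℚ.+-mono-≤ 0≤t+η 0≤t+η) (ℚ.<⇒≤ 0<η)))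
                (ℚ.≤-reflexive (solve 2 (λ t e → let η = con ½ :* e in
                   ((t :+ η) :* (t :+ η) :+ η :* η) :+ ((t :+ η) :+ (t :+ η)) :* η
                   := (t :+ e) :* (t :+ e)) refl t e)))))
      in √-mono r (t ℚ.+ e) (ℚ.+-mono-≤ 0≤t (ℚ.<⇒≤ 0<e)) rr≤

-- √ x = √(max(x,0))
√_ : ℝ → ℝ
√ x = mkℝ (λ n → √ℚ (0ℚ ℚ.⊔ seq x n) n) (√-cauchy x)

log₂ℕ : ℚ → ℕ → ℕ
log₂ℕ q n = ⌊log₂ ℤ.∣ floor (q ^ℚ suc n) ∣ ⌋

log₂ℕ-bounds : ∀ q n → 1ℚ ℚ.≤ q →
  ι 2 ^ℚ log₂ℕ q n ℚ.≤ q ^ℚ suc n × q ^ℚ suc n ℚ.≤ ι 2 ^ℚ suc (log₂ℕ q n)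
log₂ℕ-bounds q n 1≤q = bounds f f-bounds
  where
  z = q ^ℚ suc n
  1≤z : 1ℚ ℚ.≤ z
  1≤z = 1≤^ (suc n) 1≤q
  f = ℤ.∣ floor z ∣
  f-bounds : ι f ℚ.≤ z × z ℚ.< ι (suc f)
  f-bounds = floor-bounds z (ℚ.≤-trans 0≤1 1≤z)
  bounds : ∀ f → ι f ℚ.≤ z × z ℚ.< ι (suc f) →
           ι 2 ^ℚ ⌊log₂ f ⌋ ℚ.≤ z × z ℚ.≤ ι 2 ^ℚ suc ⌊log₂ f ⌋
  bounds zero    (_ , z<1) = contradiction (ℚ.≤-<-trans 1≤z z<1) (ℚ.<-irrefl refl)
  bounds f@(suc _) (f≤z , z<1+f) =
    let lower , upper = ⌊log₂⌋-bounds f in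
      subst (ℚ._≤ z) (ι-^ 2 ⌊log₂ f ⌋)
        (ℚ.≤-trans (ι-mono {2 ℕ.^ ⌊log₂ f ⌋} {f} lower) f≤z)
    , subst (z ℚ.≤_) (ι-^ 2 (suc ⌊log₂ f ⌋))
        (ℚ.≤-trans (ℚ.<⇒≤ z<1+f) (ι-mono {suc f} {2 ℕ.^ suc ⌊log₂ f ⌋} upper))

2^-cancel-≤ : ∀ a b → ι 2 ^ℚ a ℚ.≤ ι 2 ^ℚ b → a ℕ.≤ b
2^-cancel-≤ a b h = ℕ.≮⇒≥ λ b<a → ℚ.<-irrefl refl (ℚ.<-≤-trans
  (subst₂ ℚ._<_ (ι-^ 2 b) (ι-^ 2 a)
    (ι-mono-< {2 ℕ.^ b} {2 ℕ.^ a} (ℕ.^-monoʳ-< 2 (ℕ.s≤s (ℕ.s≤s ℕ.z≤n)) b<a)))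
  h)

-- Raising to the K-th power at most doubles the ratio of X to Y if X ≤ Y + 1/(2K).
^-double : ∀ k X Y → 1ℚ ℚ.≤ X → X ℚ.≤ Y ℚ.+ half (1 /suc k) →
           X ^ℚ suc k ℚ.≤ ι 2 ℚ.* Y ^ℚ suc k
^-double k X Y 1≤X X≤Y+η = subst (ℚ._≤ ι 2 ℚ.* Y ^ℚ K)
  (solve 1 (λ z → con (ι 2) :* (z :* con ½) := z) refl (X ^ℚ K))
  (*-monoʳ {X ^ℚ K ℚ.* ½} {Y ^ℚ K} (ι-nonNeg 2) (ℚ.≤-trans
    (*-monoʳ {½} {(1ℚ ℚ.- η) ^ℚ K} (^-nonNeg K 0≤X) ½≤)
    (subst (ℚ._≤ Y ^ℚ K) (ℚ^.^-distrib-* X (1ℚ ℚ.- η) K) (^-mono K 0≤X[1-η] X[1-η]≤Y))))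
  where
  K = suc k
  η = half (1 /suc k)
  0≤X = ℚ.≤-trans 0≤1 1≤X
  0≤η : 0ℚ ℚ.≤ η
  0≤η = *-nonNeg (ℚ.<⇒≤ 0<½) (/suc-nonNeg 1 k)
  η≤½ : η ℚ.≤ ½
  η≤½ = *-monoʳ {1 /suc k} {1ℚ} (ℚ.<⇒≤ 0<½) (/suc-antimono {0} {k} ℕ.z≤n)
  η≤1 : η ℚ.≤ 1ℚ
  η≤1 = ℚ.≤-trans η≤½ (x≤x+y {½} (ℚ.<⇒≤ 0<½))
  Kη≡½ : ι K ℚ.* η ≡ ½
  Kη≡½ = trans (solve 2 (λ a b → a :* (con ½ :* b) := con ½ :* (b :* a)) refl (ι K) (1 /suc k))
               (cong (½ ℚ.*_) (/suc-* 1 k))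
  ½≤ : ½ ℚ.≤ (1ℚ ℚ.- η) ^ℚ K
  ½≤ = subst (λ z → 1ℚ ℚ.- z ℚ.≤ (1ℚ ℚ.- η) ^ℚ K) Kη≡½ (bernoulli K 0≤η η≤1)
  0≤X[1-η] : 0ℚ ℚ.≤ X ℚ.* (1ℚ ℚ.- η)
  0≤X[1-η] = *-nonNeg 0≤X
    (subst (ℚ._≤ 1ℚ ℚ.- η) (ℚ.+-inverseʳ η) (ℚ.+-monoˡ-≤ (ℚ.- η) η≤1))
  X[1-η]≤Y : X ℚ.* (1ℚ ℚ.- η) ℚ.≤ Y
  X[1-η]≤Y = subst (ℚ._≤ Y) (solve 2 (λ x e → x :- x :* e := x :* (con 1ℚ :- e)) refl X η)
    (≤+⇒-≤ (subst (X ℚ.≤_) (ℚ.+-comm Y (X ℚ.* η)) (ℚ.≤-trans X≤Y+η (ℚ.+-monoʳ-≤ Y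
      (subst (ℚ._≤ X ℚ.* η) (ℚ.*-identityˡ η) (*-monoˡ {1ℚ} {X} 0≤η 1≤X))))))

log₂ℕ-close : ∀ k m n X Y → 1ℚ ℚ.≤ X → 1ℚ ℚ.≤ Y → X ℚ.≤ Y ℚ.+ half (1 /suc k) →
  log₂ℕ X m ℕ.* (suc n ℕ.* suc k) ℕ.≤
  suc m ℕ.* suc n ℕ.+ suc (log₂ℕ Y n) ℕ.* (suc m ℕ.* suc k)
log₂ℕ-close k m n X Y 1≤X 1≤Y X≤ = 2^-cancel-≤ (l ℕ.* (P ℕ.* K)) (M ℕ.* P ℕ.+ suc l′ ℕ.* (M ℕ.* K))
  (subst₂ ℚ._≤_ (ℚ^.^-assocʳ 2ℚ l (P ℕ.* K))
    (trans (cong (2ℚ ^ℚ (M ℕ.* P) ℚ.*_) (ℚ^.^-assocʳ 2ℚ (suc l′) (M ℕ.* K)))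
           (sym (ℚ^.^-homo-* 2ℚ (M ℕ.* P) (suc l′ ℕ.* (M ℕ.* K)))))
    (ℚ.≤-trans (^-mono (P ℕ.* K) (^-nonNeg l 0≤2) (proj₁ (log₂ℕ-bounds X m 1≤X)))
    (ℚ.≤-trans (ℚ.≤-reflexive (swap X M (P ℕ.* K) K (M ℕ.* P) e₁))
    (ℚ.≤-trans (^-mono (M ℕ.* P) (^-nonNeg K 0≤X) (^-double k X Y 1≤X X≤))
    (ℚ.≤-trans (ℚ.≤-reflexive (trans (ℚ^.^-distrib-* 2ℚ (Y ^ℚ K) (M ℕ.* P))
      (cong (2ℚ ^ℚ (M ℕ.* P) ℚ.*_) (swap Y K (M ℕ.* P) P (M ℕ.* K) e₂))))
    (*-monoʳ {(Y ^ℚ P) ^ℚ (M ℕ.* K)} {(2ℚ ^ℚ suc l′) ^ℚ (M ℕ.* K)} (^-nonNeg (M ℕ.* P) 0≤2)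
      (^-mono (M ℕ.* K) (^-nonNeg P 0≤Y) (proj₂ (log₂ℕ-bounds Y n 1≤Y)))))))))
  where
  K = suc k
  M = suc m
  P = suc n
  2ℚ = ι 2
  0≤2 = ι-nonNeg 2
  l = log₂ℕ X m
  l′ = log₂ℕ Y n
  0≤X = ℚ.≤-trans 0≤1 1≤X
  0≤Y = ℚ.≤-trans 0≤1 1≤Y
  swap : ∀ q a b c d → a ℕ.* b ≡ c ℕ.* d → (q ^ℚ a) ^ℚ b ≡ (q ^ℚ c) ^ℚ d
  swap q a b c d eq = trans (ℚ^.^-assocʳ q a b) (trans (cong (q ^ℚ_) eq) (sym (ℚ^.^-assocʳ q c d)))
  e₁ : M ℕ.* (P ℕ.* K) ≡ K ℕ.* (M ℕ.* P)
  e₁ = trans (sym (ℕ.*-assoc M P K)) (ℕ.*-comm (M ℕ.* P) K)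
  e₂ : K ℕ.* (M ℕ.* P) ≡ P ℕ.* (M ℕ.* K)
  e₂ = trans (ℕ.*-comm K (M ℕ.* P)) (trans (cong (ℕ._* K) (ℕ.*-comm M P)) (ℕ.*-assoc P M K))

log₂-scale : ∀ k m n l l′ →
  l ℕ.* (suc n ℕ.* suc k) ℕ.≤ suc m ℕ.* suc n ℕ.+ suc l′ ℕ.* (suc m ℕ.* suc k) →
  l /suc m ℚ.≤ l′ /suc n ℚ.+ (1 /suc n ℚ.+ 1 /suc k)
log₂-scale k m n l l′ h = *-cancelʳ (*-pos (ι-pos m) (*-pos (ι-pos n) (ι-pos k)))
  (subst₂ ℚ._≤_
    (trans (trans (ι-* l (suc n ℕ.* suc k)) (cong₂ ℚ._*_ (sym (/suc-* l m)) (ι-* (suc n) (suc k))))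
      (ℚ.*-assoc (l /suc m) M (P ℚ.* K)))
    (trans (trans (ι-+ (suc m ℕ.* suc n) (suc l′ ℕ.* (suc m ℕ.* suc k)))
      (cong₂ ℚ._+_ (ι-* (suc m) (suc n)) (trans (ι-* (suc l′) (suc m ℕ.* suc k))
        (cong₂ ℚ._*_ (trans (ι-+ 1 l′) (cong₂ ℚ._+_ (sym (/suc-* 1 n)) (sym (/suc-* l′ n))))
          (ι-* (suc m) (suc k))))))
      (trans (cong (ℚ._+ (u ℚ.* P ℚ.+ b ℚ.* P) ℚ.* (M ℚ.* K))
        (trans (sym (ℚ.*-identityˡ (M ℚ.* P))) (cong (ℚ._* (M ℚ.* P)) (sym (/suc-* 1 k)))))
        (solve 6 (λ M P K u v b →
           (v :* K) :* (M :* P) :+ (u :* P :+ b :* P) :* (M :* K)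
           := (b :+ (u :+ v)) :* (M :* (P :* K))) refl M P K u v b)))
    (ι-mono {l ℕ.* (suc n ℕ.* suc k)} {suc m ℕ.* suc n ℕ.+ suc l′ ℕ.* (suc m ℕ.* suc k)} h))
  where
  M = ι (suc m)
  P = ι (suc n)
  K = ι (suc k)
  u = 1 /suc n
  v = 1 /suc k
  b = l′ /suc n

abstract
  log₂-cauchy : ∀ x → Cauchy (λ n → log₂ℕ (1ℚ ℚ.⊔ seq x n) n /suc n)
  log₂-cauchy x = fromCauchy⁺ (λ n → log₂ℕ (1ℚ ℚ.⊔ seq x n) n /suc n) λ e 0<e →
    let k , 1/K≤ = archimedean (half e) (half-pos 0<e)
        η = half (1 /suc k)
        0<η = half-pos {1 /suc k} (/suc-pos 0 k)
        N , h = toCauchy⁺ (seq x) (cauchy x) η 0<η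
    in N ℕ.⊔ k , λ m n N≤m N≤n →
      let X = 1ℚ ℚ.⊔ seq x m
          Y = 1ℚ ℚ.⊔ seq x n
          close = log₂ℕ-close k m n X Y (ℚ.p≤p⊔q 1ℚ (seq x m)) (ℚ.p≤p⊔q 1ℚ (seq x n))
                    (⊔-lip 1ℚ (seq x m) (seq x n) (ℚ.<⇒≤ 0<η) (h m n (⊔ˡ N k N≤m) (⊔ˡ N k N≤n)))
      in ℚ.≤-trans (log₂-scale k m n (log₂ℕ X m) (log₂ℕ Y n) close)
           (ℚ.+-monoʳ-≤ (log₂ℕ Y n /suc n) (subst (1 /suc n ℚ.+ 1 /suc k ℚ.≤_) (half+half e)
             (ℚ.+-mono-≤ (ℚ.≤-trans (/suc-antimono (⊔ʳ N k N≤n)) 1/K≤) 1/K≤)))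

-- log₂ x = log₂ (max(x,1)): each term is a /suc n with 2^a ≤ max(xₙ,1)^(n+1) < 2^(a+1).
log₂ : ℝ → ℝ
log₂ x = mkℝ (λ n → log₂ℕ (1ℚ ℚ.⊔ seq x n) n /suc n) (log₂-cauchy x)

infixr 9 _^_

_^_ : ℝ → ℕ → ℝ
x ^ zero  = 1ℝ
x ^ suc n = x * x ^ n

∑ : ∀ {n} → Vector ℝ n → ℝ
∑ {zero}  v = 0ℝ
∑ {suc n} v = head v + ∑ (tail v)

‖_‖₂ : ∀ {n} → Vector ℝ n → ℝ
‖ v ‖₂ = √ ∑ (λ i → v i ^ 2)

record Distribution (n : ℕ) : Set where
  field
    prob   : Vector ℝ n
    nonNeg : ∀ i → 0ℝ ≤ prob i
    total  : ∑ prob ≃ 1ℝ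

open Distribution public

_⊖_ : ∀ {n} → Distribution n → Distribution n → Vector ℝ n
p ⊖ q = zipWith _-_ (prob p) (prob q)

-- Randomized algorithms are while-programs on natural-number variables and
-- arrays. Every command, and every test of a loop guard, takes one step. Words
-- are unbounded, so multiplication is left out: within t steps addition can
-- only double a word t times.
Var Arr : Set
Var = ℕ
Arr = ℕ

mutual
  Program : Set
  Program = List Cmd

  data Cmd : Set where
    const           : Var → ℕ → Cmd           -- x ← k
    add             : Var → Var → Var → Cmd   -- x ← y + z
    sub             : Var → Var → Var → Cmd   -- x ← max (y − z, 0)
    load            : Var → Arr → Var → Cmd   -- x ← A[y]
    store           : Arr → Var → Var → Cmd   -- A[x] ← y
    sampleP sampleQ : Var → Cmd               -- x ← fresh sample from p (from q)
    flip            : Var → Cmd               -- x ← fair random bit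
    readδ readε     : Var → Var → Cmd         -- x ← a with |δ − a/(y+1)| ≤ 1/(y+1) (likewise ε)
    if≢0            : Var → Program → Program → Cmd
    while≢0         : Var → Program → Cmd

-- A program cannot hold a real parameter; it is given an oracle for rational
-- approximations to it, and may ask for any precision at unit cost.
Approximates : (ℕ → ℕ) → ℝ → Set
Approximates f x = ∀ k → ∣ x - fromℚ (f k /suc k) ∣ ≤ fromℚ (1 /suc k)

record Memory : Set where
  field
    var : Var → ℕ
    arr : Arr → ℕ → ℕ

open Memory public

update : ∀ {A : Set} → (ℕ → A) → ℕ → A → ℕ → A
update f x a y = if y ℕ.≡ᵇ x then a else f y

setVar : Var → ℕ → Memory → Memory
setVar x a s = record s { var = update (var s) x a }

setArr : Arr → ℕ → ℕ → Memory → Memory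
setArr A i a s = record s { arr = update (arr s) A (update (arr s A) i a) }

-- The commands still to be executed, and the current memory.
Config : Set
Config = Program × Memory

start : Program → Config
start T = T , record { var = λ _ → 0 ; arr = λ _ _ → 0 }

data Outcome : Set where
  accept reject : Outcome

outcome : Memory → Outcome
outcome s with var s 0
... | zero  = reject
... | suc _ = accept

-- choose w c enters the configuration c i with probability w i.
data Step : Set where
  goto   : Config → Step
  choose : ∀ {k} → Vector ℝ k → (Fin k → Config) → Step

module Execution {n} (p q : Distribution n) (δ̂ ε̂ : ℕ → ℕ) where

  branch : ℕ → Program → Program → Program
  branch zero    b c = c
  branch (suc _) b c = b

  step : Cmd → Config → Step
  step (const x k)   (K , s) = goto (K , setVar x k s)
  step (add x y z)   (K , s) = goto (K , setVar x (var s y ℕ.+ var s z) s)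
  step (sub x y z)   (K , s) = goto (K , setVar x (var s y ℕ.∸ var s z) s)
  step (load x A y)  (K , s) = goto (K , setVar x (arr s A (var s y)) s)
  step (store A x y) (K , s) = goto (K , setArr A (var s x) (var s y) s)
  step (sampleP x)   (K , s) = choose (prob p) (λ i → K , setVar x (suc (toℕ i)) s)
  step (sampleQ x)   (K , s) = choose (prob q) (λ i → K , setVar x (suc (toℕ i)) s)
  step (flip x)      (K , s) = choose {2} (λ _ → ½ℝ) (λ i → K , setVar x (toℕ i) s)
  step (readδ x y)   (K , s) = goto (K , setVar x (δ̂ (var s y)) s)
  step (readε x y)   (K , s) = goto (K , setVar x (ε̂ (var s y)) s)
  step (if≢0 x b c)  (K , s) = goto (branch (var s x) b c ++ K , s)
  step (while≢0 x b) (K , s) = goto (branch (var s x) (b ++ while≢0 x b ∷ K) K , s)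

  AllNext : (Config → Set) → Step → Set
  AllNext P (goto c)     = P c
  AllNext P (choose w c) = ∀ i → P (c i)

  -- Worst case: every sequence of samples and coin flips is covered, including
  -- those of probability 0.
  HaltsWithin : ℕ → Config → Set
  HaltsWithin t       ([]    , s) = ⊤
  HaltsWithin zero    (_ ∷ _ , s) = ⊥
  HaltsWithin (suc t) (c ∷ K , s) = AllNext (HaltsWithin t) (step c (K , s))

  expect : (Config → ℝ) → Step → ℝ
  expect f (goto c)     = f c
  expect f (choose w c) = ∑ (λ i → w i * f (c i))

  indicator : Outcome → Outcome → ℝ
  indicator accept accept = 1ℝ
  indicator accept reject = 0ℝ
  indicator reject accept = 0ℝ
  indicator reject reject = 1ℝ

  -- The probability of halting after at most t steps with the given outcome.
  Pr : Outcome → ℕ → Config → ℝ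
  Pr o t       ([]    , s) = indicator o (outcome s)
  Pr o zero    (_ ∷ _ , s) = 0ℝ
  Pr o (suc t) (c ∷ K , s) = expect (Pr o t) (step c (K , s))

module Submission where

-- Draw x₁, x₂ from p and y₁, y₂ from q, and let Z be the number of agreements
-- within the samples, [x₁ = x₂] + [y₁ = y₂], minus the number of agreements
-- between them, [x₁ = y₁] + [x₂ = y₂]. The mean of Z is
-- p·p + q·q - 2 p·q = ‖p - q‖², whatever n is (𝔼⁴-excess). The test repeats this
-- trial independently and rejects when the sum of the Z exceeds a threshold that
-- corresponds to a mean between ε²/4 and ε². As Z lies between -2 and 2, of the
-- order of ε⁻⁴ log(1/δ) trials give error probability δ.
--
-- The tail bound is Hoeffding's, in a form that involves rational numbers only.
-- The potential (1 + η)^X (1 - η + η²)^Y, where X and Y are the numbers of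
-- agreements within and between, stands for the exponential moment of X - Y. It
-- is at least 1 when Y ≤ X (1≤weight), and one trial multiplies its mean by at
-- most 1 + 3η² + η‖p - q‖² (weight-bound, drift-up). The threshold of 32R, which
-- the counter of agreements between the samples holds from the start, makes the
-- initial potential small enough for the mean after all trials to be at most δ
-- (rising-potential). Exchanging X and Y gives the bound for distant p and q
-- (drift-down, falling-potential). That the potential bounds the error
-- probability of the program is an induction over the trial loop
-- (trials-succeed).
--
-- The parameters come from integer readings of ε and δ. A linear search finds N
-- with 7 ≤ Nε ≤ 10, and with D = N² the threshold is the fraction 32/D of the
-- number of trials, while ‖p - q‖² is at most 25/D or at least 49/D in the two
-- cases. A doubling search finds L with 2⁻ᴸ ≤ δ and L = O(log(1/δ)). With
-- η = 1/(8D), each block of D trials multiplies the potential by at most 1 - η,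
-- so 8D blocks halve it and D · 8D · L trials suffice. Two cases are separate
-- since ε⁻⁴ log(1/δ) tends to 0 as ε grows or as δ tends to 1: once ε is known to
-- exceed √2 the answer is to accept, as ‖p - q‖ is at most √2, and once δ is known
-- to be at least 1/2 a coin flip is right often enough.

open import Defs
open import Data.Bool.Base using (true; false; if_then_else_)
open import Data.Fin.Base using (Fin; zero; suc; toℕ)
open import Data.List.Base using ([]; _∷_; _++_; replicate)
open import Data.Nat.Base as ℕ using (ℕ; zero; suc)
import Data.Nat.Properties as ℕ
import Data.Nat.Solver as ℕ
open import Data.Product.Base using (∃; Σ-syntax; _×_; _,_; proj₁; proj₂)
open import Data.Rational.Base as ℚ using (ℚ; 0ℚ; 1ℚ; ½)
import Data.Rational.Properties as ℚ
open import Data.Rational.Solver using (module +-*-Solver)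
open import Data.Sum.Base using (inj₁; inj₂)
open import Data.Unit.Base using (tt)
open import Data.Vec.Functional using (Vector; tail)
open import Function.Base using (case_of_)
open import Relation.Binary.Bundles using (Preorder)
open import Relation.Binary.PropositionalEquality
  using (_≡_; _≢_; refl; sym; trans; cong; cong₂; subst; subst₂)
import Relation.Binary.Reasoning.Preorder as PreorderReasoning
open import Relation.Nullary.Negation using (contradiction; ¬_)

open ℚ^ using () renaming (_^_ to _^ℚ_)
open +-*-Solver using (Polynomial; solve; _:=_; _:+_; _:*_; :-_; _:-_; con)
open ℕ.+-*-Solver using ()
  renaming (solve to solveℕ; _:=_ to _:=ℕ_; _:+_ to _:+ℕ_; _:*_ to _:*ℕ_; con to conℕ)

-- The reals as an ordered ring

-- The order of the reals as a record, so that its two sides can be inferred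
-- from a proof; the bare order unfolds to a statement about sequences.
infix 4 _≼_ _≈_

record _≼_ (x y : ℝ) : Set where
  constructor wrap
  field unwrap : x ≤ y

open _≼_

record _≈_ (x y : ℝ) : Set where
  constructor _⊣_
  field
    to   : x ≼ y
    from : y ≼ x

open _≈_

eventually : ∀ {x y} N → (∀ n → N ℕ.≤ n → seq x n ℚ.≤ seq y n) → x ≼ y
eventually N h = wrap λ e 0<e → N , λ n N≤n → ℚ.≤-trans (h n N≤n) (x≤x+y (ℚ.<⇒≤ 0<e))

pointwise-≼ : ∀ {x y} → (∀ n → seq x n ℚ.≤ seq y n) → x ≼ y
pointwise-≼ h = eventually 0 λ n _ → h n

pointwise : ∀ {x y} → (∀ n → seq x n ≡ seq y n) → x ≈ y
pointwise h = pointwise-≼ (λ n → ℚ.≤-reflexive (h n)) ⊣ pointwise-≼ (λ n → ℚ.≤-reflexive (sym (h n)))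

≼-refl : ∀ {x} → x ≼ x
≼-refl = pointwise-≼ λ _ → ℚ.≤-refl

≼-trans : ∀ {x y z} → x ≼ y → y ≼ z → x ≼ z
≼-trans {x} {y} {z} (wrap p) (wrap q) = wrap λ e 0<e →
  let N , h = p (half e) (half-pos 0<e)
      M , k = q (half e) (half-pos 0<e)
  in N ℕ.⊔ M , λ n N≤n → ℚ.≤-trans (h n (⊔ˡ N M N≤n))
       (ℚ.≤-trans (ℚ.+-monoˡ-≤ (half e) (k n (⊔ʳ N M N≤n)))
         (ℚ.≤-reflexive (trans (ℚ.+-assoc (seq z n) (half e) (half e))
           (cong (seq z n ℚ.+_) (half+half e)))))

≼-preorder : Preorder _ _ _
≼-preorder = record
  { Carrier = ℝ ; _≈_ = _≈_ ; _≲_ = _≼_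
  ; isPreorder = record
    { isEquivalence = record
      { refl  = ≼-refl ⊣ ≼-refl
      ; sym   = λ p → from p ⊣ to p
      ; trans = λ p q → ≼-trans (to p) (to q) ⊣ ≼-trans (from q) (from p) }
    ; reflexive = to
    ; trans = ≼-trans } }

open module ≼-Reasoning = PreorderReasoning ≼-preorder
  using (begin_; begin-equality_; step-≲; step-≈-⟩; step-≈-⟨; _∎)

≈-refl : ∀ {x} → x ≈ x
≈-refl = Preorder.Eq.refl ≼-preorder

+-mono-≼ : ∀ {x y u v} → x ≼ y → u ≼ v → x + u ≼ y + v
+-mono-≼ {x} {y} {u} {v} (wrap p) (wrap q) = wrap λ e 0<e →
  let N , h = p (half e) (half-pos 0<e)
      M , k = q (half e) (half-pos 0<e)
  in N ℕ.⊔ M , λ n N≤n → ℚ.≤-trans (ℚ.+-mono-≤ (h n (⊔ˡ N M N≤n)) (k n (⊔ʳ N M N≤n)))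
       (ℚ.≤-reflexive (solve 3 (λ a b e → (a :+ con ½ :* e) :+ (b :+ con ½ :* e) := (a :+ b) :+ e)
         refl (seq y n) (seq v n) e))

neg-anti-≼ : ∀ {x y} → x ≼ y → - y ≼ - x
neg-anti-≼ {x} {y} (wrap p) = wrap λ e 0<e →
  let N , h = p e 0<e
  in N , λ n N≤n → subst₂ ℚ._≤_
       (solve 2 (λ a b → a :+ (:- a :- b) := :- b) refl (seq x n) (seq y n))
       (solve 3 (λ a b e → (b :+ e) :+ (:- a :- b) := :- a :+ e) refl (seq x n) (seq y n) e)
       (ℚ.+-monoˡ-≤ (ℚ.- seq x n ℚ.- seq y n) (h n N≤n))

-- An inequality follows from the nonnegativity of the difference of its sides,
-- which may be given in any form that agrees with it term by term.
difference : ∀ {x y} d → 0ℝ ≼ d → (∀ n → seq x n ℚ.+ seq d n ≡ seq y n) → x ≼ y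
difference {x} {y} d 0≼d eq = begin
  x        ≈⟨ pointwise (λ n → sym (ℚ.+-identityʳ (seq x n))) ⟩
  x + 0ℝ   ≲⟨ +-mono-≼ ≼-refl 0≼d ⟩
  x + d    ≈⟨ pointwise eq ⟩
  y        ∎

0≼difference : ∀ {x y} → x ≼ y → 0ℝ ≼ y - x
0≼difference {x} {y} x≼y = begin
  0ℝ     ≈⟨ pointwise (λ n → sym (ℚ.+-inverseʳ (seq x n))) ⟩
  x - x  ≲⟨ +-mono-≼ x≼y ≼-refl ⟩
  y - x  ∎

⊓-pos : ∀ {a b} → 0ℚ ℚ.< a → 0ℚ ℚ.< b → 0ℚ ℚ.< a ℚ.⊓ b
⊓-pos {a} {b} 0<a 0<b with ℚ.⊓-sel a b
... | inj₁ eq = subst (0ℚ ℚ.<_) (sym eq) 0<a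
... | inj₂ eq = subst (0ℚ ℚ.<_) (sym eq) 0<b

-- If x and y are at least -d and at most B, then (x + d)(y + d) is nonnegative,
-- so xy is at least -d(x + y + d), which is small.
0≼* : ∀ {x y} → 0ℝ ≼ x → 0ℝ ≼ y → 0ℝ ≼ x * y
0≼* {x} {y} (wrap p) (wrap q) = wrap λ e 0<e →
  let B , N₀ , 1≤B , hB = bounded x
      C , M₀ , 1≤C , hC = bounded y
      0≤B = ℚ.≤-trans 0≤1 1≤B
      0≤C = ℚ.≤-trans 0≤1 1≤C
      K = (B ℚ.+ C) ℚ.+ 1ℚ
      0<K = ℚ.≤-<-trans (ℚ.+-mono-≤ 0≤B 0≤C)
        (subst (ℚ._< K) (ℚ.+-identityʳ (B ℚ.+ C)) (ℚ.+-monoʳ-< (B ℚ.+ C) (ι-pos 0)))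
      d′ , 0<d′ , Kd′≡e = divide 0<K 0<e
      d = d′ ℚ.⊓ 1ℚ
      0<d = ⊓-pos 0<d′ (ι-pos 0)
      0≤d = ℚ.<⇒≤ 0<d
      N₁ , h₁ = p d 0<d
      M₁ , k₁ = q d 0<d
      N₀₁ = N₀ ℕ.⊔ N₁
      M₀₁ = M₀ ℕ.⊔ M₁
  in N₀₁ ℕ.⊔ M₀₁ , λ n N≤n →
    let a = seq x n; b = seq y n
        a≤B = ℚ.≤-trans (p≤∣p∣ a) (hB n (⊔ˡ N₀ N₁ (⊔ˡ N₀₁ M₀₁ N≤n)))
        b≤C = ℚ.≤-trans (p≤∣p∣ b) (hC n (⊔ˡ M₀ M₁ (⊔ʳ N₀₁ M₀₁ N≤n)))
        0≤a+d = h₁ n (⊔ʳ N₀ N₁ (⊔ˡ N₀₁ M₀₁ N≤n))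
        0≤b+d = k₁ n (⊔ʳ M₀ M₁ (⊔ʳ N₀₁ M₀₁ N≤n))
        small : ((a ℚ.+ b) ℚ.+ d) ℚ.* d ℚ.≤ e
        small = ℚ.≤-trans
          (*-monoˡ {(a ℚ.+ b) ℚ.+ d} {K} 0≤d (ℚ.+-mono-≤ (ℚ.+-mono-≤ a≤B b≤C) (ℚ.p⊓q≤q d′ 1ℚ)))
          (ℚ.≤-trans (*-monoʳ {d} {d′} {K} (ℚ.<⇒≤ 0<K) (ℚ.p⊓q≤p d′ 1ℚ)) (ℚ.≤-reflexive Kd′≡e))
    in ℚ.≤-trans (*-nonNeg 0≤a+d 0≤b+d) (ℚ.≤-trans
         (ℚ.≤-reflexive (solve 3 (λ a b d → (a :+ d) :* (b :+ d) := a :* b :+ ((a :+ b) :+ d) :* d)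
           refl a b d))
         (ℚ.+-monoʳ-≤ (a ℚ.* b) small))

*-monoˡ-≼ : ∀ {x y} z → 0ℝ ≼ z → x ≼ y → z * x ≼ z * y
*-monoˡ-≼ {x} {y} z 0≼z x≼y = difference (z * (y - x)) (0≼* 0≼z (0≼difference x≼y)) λ n →
  solve 3 (λ x y z → z :* x :+ z :* (y :- x) := z :* y) refl (seq x n) (seq y n) (seq z n)

*-mono-≼ : ∀ {x y u v} → 0ℝ ≼ x → 0ℝ ≼ v → x ≼ y → u ≼ v → x * u ≼ y * v
*-mono-≼ {x} {y} {u} {v} 0≼x 0≼v x≼y u≼v = begin
  x * u  ≲⟨ *-monoˡ-≼ x 0≼x u≼v ⟩
  x * v  ≈⟨ pointwise (λ n → ℚ.*-comm (seq x n) (seq v n)) ⟩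
  v * x  ≲⟨ *-monoˡ-≼ v 0≼v x≼y ⟩
  v * y  ≈⟨ pointwise (λ n → ℚ.*-comm (seq v n) (seq y n)) ⟩
  y * v  ∎

square-mono : ∀ {x y} → 0ℝ ≼ x → x ≼ y → x * x ≼ y * y
square-mono 0≼x x≼y = *-mono-≼ 0≼x (≼-trans 0≼x x≼y) x≼y x≼y

^-mono-≼ : ∀ {x y} k → 0ℝ ≼ x → x ≼ y → 0ℝ ≼ x ^ k × x ^ k ≼ y ^ k
^-mono-≼ zero    0≼x x≼y = pointwise-≼ (λ _ → 0≤1) , ≼-refl
^-mono-≼ (suc k) 0≼x x≼y =
  let 0≼xᵏ , xᵏ≼yᵏ = ^-mono-≼ k 0≼x x≼y
  in 0≼* 0≼x 0≼xᵏ , *-mono-≼ 0≼x (≼-trans 0≼xᵏ xᵏ≼yᵏ) x≼y xᵏ≼yᵏ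

-- A factor of unknown sign is made nonnegative by adding a rational bound B:
-- zx = (z + B)x - Bx.
*-congˡ-≈ : ∀ z {x y} → x ≈ y → z * x ≈ z * y
*-congˡ-≈ z (x≼y ⊣ y≼x) = one-sided x≼y y≼x ⊣ one-sided y≼x x≼y
  where
  B = proj₁ (bounded z)
  N = proj₁ (proj₂ (bounded z))
  ∣z∣≤B = proj₂ (proj₂ (proj₂ (bounded z)))
  0≼B : 0ℝ ≼ fromℚ B
  0≼B = pointwise-≼ λ _ → ℚ.≤-trans 0≤1 (proj₁ (proj₂ (proj₂ (bounded z))))
  0≼z+B : 0ℝ ≼ z + fromℚ B
  0≼z+B = eventually N λ n N≤n → subst (ℚ._≤ seq z n ℚ.+ B) (ℚ.+-inverseʳ (seq z n))
    (ℚ.+-monoʳ-≤ (seq z n) (ℚ.≤-trans (p≤∣p∣ (ℚ.- seq z n))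
      (subst (ℚ._≤ B) (sym (ℚ.∣-p∣≡∣p∣ (seq z n))) (∣z∣≤B n N≤n))))
  one-sided : ∀ {x y} → x ≼ y → y ≼ x → z * x ≼ z * y
  one-sided {x} {y} x≼y y≼x =
    difference ((z + fromℚ B) * (y - x) + fromℚ B * (x - y))
      (≼-trans (pointwise-≼ λ _ → ℚ.≤-refl)
        (+-mono-≼ (0≼* 0≼z+B (0≼difference x≼y)) (0≼* 0≼B (0≼difference y≼x))))
      λ n → solve 4 (λ x y z b → z :* x :+ ((z :+ b) :* (y :- x) :+ b :* (x :- y)) := z :* y)
              refl (seq x n) (seq y n) (seq z n) B

fromℚ-mono : ∀ {a b} → a ℚ.≤ b → fromℚ a ≼ fromℚ b
fromℚ-mono a≤b = pointwise-≼ λ _ → a≤b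

fromℚ-cancel : ∀ {a b} → fromℚ a ≼ fromℚ b → a ℚ.≤ b
fromℚ-cancel {a} {b} (wrap h) = ℚ.≮⇒≥ λ b<a →
  let c , b<c , c<a = ℚ.<-dense b<a
      N , k = h (c ℚ.- b) (subst (ℚ._< c ℚ.- b) (ℚ.+-inverseʳ b) (ℚ.+-monoˡ-< (ℚ.- b) b<c))
  in ℚ.<-irrefl refl (ℚ.≤-<-trans (k N ℕ.≤-refl)
       (subst (ℚ._< a) (solve 2 (λ b c → c := b :+ (c :- b)) refl b c) c<a))

<⇒≼ : ∀ {x y} → x < y → x ≼ y
<⇒≼ {x} {y} (c , 0<c , N , h) = eventually N λ n N≤n →
  ℚ.≤-trans (x≤x+y (ℚ.<⇒≤ 0<c)) (h n N≤n)

-- Square roots, inverses, logarithms and approximations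

-- For r a term of √ x and u = 1/(n+1) its precision, r² and (r + u)² enclose
-- max(x, 0), and their difference (2r + u)u vanishes because r stays bounded.
√-square : ∀ {x} → 0ℝ ≼ x → √ x * √ x ≈ x
√-square {x} (wrap 0≤x) = wrap below ⊣ wrap above
  where
  root : ℕ → ℚ
  root n = seq (√ x) n
  bounds : ∀ n → root n ℚ.* root n ℚ.≤ 0ℚ ℚ.⊔ seq x n
               × 0ℚ ℚ.⊔ seq x n ℚ.≤ (root n ℚ.+ 1 /suc n) ℚ.* (root n ℚ.+ 1 /suc n)
  bounds n = √ℚ-bounds (0ℚ ℚ.⊔ seq x n) n (ℚ.p≤p⊔q 0ℚ (seq x n))
  below : √ x * √ x ≤ x
  below e 0<e =
    let N , h = 0≤x e 0<e
    in N , λ n N≤n → ℚ.≤-trans (proj₁ (bounds n))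
         (ℚ.⊔-lub {seq x n ℚ.+ e} {0ℚ} {seq x n} (h n N≤n) (x≤x+y {seq x n} (ℚ.<⇒≤ 0<e)))
  above : x ≤ √ x * √ x
  above e 0<e =
    let B , N , 1≤B , hB = bounded (√ x)
        0≤B = ℚ.≤-trans 0≤1 1≤B
        K = (B ℚ.+ B) ℚ.+ 1ℚ
        0<K = ℚ.<-≤-trans (ι-pos 0) (subst (1ℚ ℚ.≤_) (ℚ.+-comm 1ℚ (B ℚ.+ B)) (x≤x+y (ℚ.+-mono-≤ 0≤B 0≤B)))
        d , 0<d , Kd≡e = divide 0<K 0<e
        k , 1/k≤d = archimedean d 0<d
    in N ℕ.⊔ k , λ n N≤n →
      let r = root n
          u = 1 /suc n
          0≤u = /suc-nonNeg 1 n
          r≤B = ℚ.≤-trans (p≤∣p∣ r) (hB n (⊔ˡ N k N≤n))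
          u≤d = ℚ.≤-trans (/suc-antimono (⊔ʳ N k N≤n)) 1/k≤d
          u≤1 = /suc-antimono {0} {n} ℕ.z≤n
      in ℚ.≤-trans (ℚ.p≤q⊔p 0ℚ (seq x n)) (ℚ.≤-trans (proj₂ (bounds n)) (ℚ.≤-trans
           (ℚ.≤-reflexive (solve 2 (λ r u → (r :+ u) :* (r :+ u) := r :* r :+ ((r :+ r) :+ u) :* u) refl r u))
           (ℚ.+-monoʳ-≤ (r ℚ.* r) (ℚ.≤-trans
             (*-mono {(r ℚ.+ r) ℚ.+ u} {K} {u} {d} (ℚ.+-mono-≤ (ℚ.+-mono-≤ (0≤root n) (0≤root n)) 0≤u)
               (ℚ.<⇒≤ 0<d) (ℚ.+-mono-≤ (ℚ.+-mono-≤ r≤B r≤B) u≤1) u≤d)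
             (ℚ.≤-reflexive Kd≡e)))))
    where
    0≤root : ∀ n → 0ℚ ℚ.≤ root n
    0≤root n = √ℚ-nonNeg (0ℚ ℚ.⊔ seq x n) n

0≼√ : ∀ x → 0ℝ ≼ √ x
0≼√ x = pointwise-≼ λ n → √ℚ-nonNeg (0ℚ ℚ.⊔ seq x n) n

inv-pos : ∀ {q} (0<q : 0ℚ ℚ.< q) → 0ℚ ℚ.< inv 0<q
inv-pos {q} 0<q = ℚ.positive⁻¹ (inv 0<q) {{ℚ.1/pos⇒pos q {{ℚ.positive 0<q}}}}

0≼inverse : ∀ x (0<x : 0ℝ < x) → 0ℝ ≼ inverse x 0<x
0≼inverse x (c , 0<c , _) = pointwise-≼ λ n → ℚ.<⇒≤ (inv-pos (0<c⊔q (seq x n) 0<c))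

*-inverse : ∀ x (0<x : 0ℝ < x) → x * inverse x 0<x ≈ 1ℝ
*-inverse x (c , 0<c , N , h) =
  eventually N (λ n N≤n → ℚ.≤-reflexive (exact n N≤n)) ⊣
  eventually N (λ n N≤n → ℚ.≤-reflexive (sym (exact n N≤n)))
  where
  exact : ∀ n → N ℕ.≤ n → seq x n ℚ.* inv (0<c⊔q (seq x n) 0<c) ≡ 1ℚ
  exact n N≤n = trans (ℚ.*-comm (seq x n) i)
    (trans (cong (i ℚ.*_) (sym (ℚ.p≤q⇒p⊔q≡q (subst (ℚ._≤ seq x n) (ℚ.+-identityˡ c) (h n N≤n)))))
      (inv-* (0<c⊔q (seq x n) 0<c)))
    where i = inv (0<c⊔q (seq x n) 0<c)

-- A term a/(n+1) of log₂ x satisfies xⁿ⁺¹ < 2ᵃ⁺¹, so 2ˡ ≤ xᵏ gives l(n+1) ≤ k(a+1),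
-- and the error k/(n+1) vanishes in the limit.
log₂-lower : ∀ x l k N → (∀ n → N ℕ.≤ n → ι 2 ^ℚ l ℚ.≤ (1ℚ ℚ.⊔ seq x n) ^ℚ k) →
             fromℕ l ≼ fromℕ k * log₂ x
log₂-lower x l k N h = wrap λ e 0<e →
  let d , 0<d , Kd≡e = divide (ι-pos k) 0<e
      M , 1/M≤d = archimedean d 0<d
  in N ℕ.⊔ M , λ n N≤n →
    let X = 1ℚ ℚ.⊔ seq x n
        1≤X = ℚ.p≤p⊔q 1ℚ (seq x n)
        a = log₂ℕ X n
        P = suc n
        l*P≤ : l ℕ.* P ℕ.≤ suc a ℕ.* k
        l*P≤ = 2^-cancel-≤ (l ℕ.* P) (suc a ℕ.* k) (subst₂ ℚ._≤_
          (ℚ^.^-assocʳ (ι 2) l P) (ℚ^.^-assocʳ (ι 2) (suc a) k)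
          (ℚ.≤-trans (^-mono P (^-nonNeg l (ι-nonNeg 2)) (h n (⊔ˡ N M N≤n)))
            (ℚ.≤-trans
              (ℚ.≤-reflexive (trans (ℚ^.^-assocʳ X k P)
                (trans (cong (X ^ℚ_) (ℕ.*-comm k P)) (sym (ℚ^.^-assocʳ X P k)))))
              (^-mono k (^-nonNeg P (ℚ.≤-trans 0≤1 1≤X)) (proj₂ (log₂ℕ-bounds X n 1≤X))))))
        scaled : ι l ℚ.≤ ι k ℚ.* (a /suc n) ℚ.+ ι k ℚ.* (1 /suc n)
        scaled = *-cancelʳ (ι-pos n) (subst₂ ℚ._≤_ (ι-* l P)
          (trans (ι-* (suc a) k) (trans (cong (ℚ._* ι k)
            (trans (ι-+ 1 a) (cong₂ ℚ._+_ (sym (/suc-* 1 n)) (sym (/suc-* a n)))))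
            (solve 4 (λ u P b k → (u :* P :+ b :* P) :* k := (k :* b :+ k :* u) :* P)
              refl (1 /suc n) (ι P) (a /suc n) (ι k))))
          (ι-mono {l ℕ.* P} {suc a ℕ.* k} l*P≤))
    in ℚ.≤-trans scaled (ℚ.+-monoʳ-≤ (ι k ℚ.* (a /suc n)) (ℚ.≤-trans
         (*-mono {ι k} {ι (suc k)} {1 /suc n} {d} (ι-nonNeg k) (ℚ.<⇒≤ 0<d)
           (ι-mono {k} {suc k} (ℕ.n≤1+n k))
           (ℚ.≤-trans (/suc-antimono (⊔ʳ N M N≤n)) 1/M≤d))
         (ℚ.≤-reflexive Kd≡e)))

fromℕ-mono : ∀ {a b} → a ℕ.≤ b → fromℕ a ≼ fromℕ b
fromℕ-mono {a} {b} a≤b = fromℚ-mono (ι-mono {a} {b} a≤b)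

fromℕ-cancel : ∀ {a b} → fromℕ a ≼ fromℕ b → a ℕ.≤ b
fromℕ-cancel {a} {b} h = ℕ.≮⇒≥ λ b<a → ℚ.<-irrefl refl
  (ℚ.<-≤-trans (ι-mono-< b<a) (fromℚ-cancel h))

0≼fromℕ : ∀ k → 0ℝ ≼ fromℕ k
0≼fromℕ k = fromℚ-mono (ι-nonNeg k)

positive⇒large : ∀ {x} → 0ℝ < x → ∃ λ k → 1ℝ ≼ fromℕ (suc k) * x
positive⇒large {x} (c , 0<c , N , h) =
  let k , 1/k≤c = archimedean c 0<c
  in k , eventually N λ n N≤n → subst (ℚ._≤ ι (suc k) ℚ.* seq x n)
       (trans (ℚ.*-comm (ι (suc k)) (1 /suc k)) (/suc-* 1 k))
       (*-monoʳ {1 /suc k} {seq x n} (ι-nonNeg (suc k))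
         (ℚ.≤-trans 1/k≤c (subst (ℚ._≤ seq x n) (ℚ.+-identityˡ c) (h n N≤n))))

-- The reading f k, with denominator k + 1, is within 1 of (k + 1) x.
module _ {f : ℕ → ℕ} {x : ℝ} (f≈x : Approximates f x) (k : ℕ) where

  private
    scale-error : ι (suc k) ℚ.* (f k /suc k ℚ.+ 1 /suc k) ≡ ι (suc (f k))
    scale-error = trans
      (solve 3 (λ K a u → K :* (a :+ u) := u :* K :+ a :* K) refl (ι (suc k)) (f k /suc k) (1 /suc k))
      (trans (cong₂ ℚ._+_ (/suc-* 1 k) (/suc-* (f k) k)) (sym (ι-+ 1 (f k))))

  approximation-≥ : fromℕ (suc k) * x ≼ fromℕ (suc (f k))
  approximation-≥ = begin
    fromℕ (suc k) * x
      ≲⟨ *-monoˡ-≼ (fromℕ (suc k)) (0≼fromℕ (suc k)) (≼-trans x≼ (+-mono-≼ (wrap (f≈x k)) ≼-refl)) ⟩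
    fromℕ (suc k) * (fromℚ (1 /suc k) + fromℚ (f k /suc k))
      ≈⟨ pointwise (λ n → trans (cong (ι (suc k) ℚ.*_) (ℚ.+-comm (1 /suc k) (f k /suc k))) (scale-error)) ⟩
    fromℕ (suc (f k)) ∎
    where
    x≼ : x ≼ ∣ x - fromℚ (f k /suc k) ∣ + fromℚ (f k /suc k)
    x≼ = pointwise-≼ λ n → subst (ℚ._≤ ℚ.∣ seq x n ℚ.- f k /suc k ∣ ℚ.+ f k /suc k)
      (solve 2 (λ x a → (x :- a) :+ a := x) refl (seq x n) (f k /suc k))
      (ℚ.+-monoˡ-≤ (f k /suc k) (p≤∣p∣ (seq x n ℚ.- f k /suc k)))

  approximation-≤ : fromℕ (f k) ≼ fromℕ (suc k) * x + 1ℝ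
  approximation-≤ = begin
    fromℕ (f k)
      ≈⟨ pointwise (λ n → sym (trans (ℚ.*-comm (ι (suc k)) (f k /suc k)) (/suc-* (f k) k))) ⟩
    fromℕ (suc k) * fromℚ (f k /suc k)
      ≲⟨ *-monoˡ-≼ (fromℕ (suc k)) (0≼fromℕ (suc k)) (≼-trans ≼x+ (+-mono-≼ ≼-refl (wrap (f≈x k)))) ⟩
    fromℕ (suc k) * (x + fromℚ (1 /suc k))
      ≈⟨ pointwise (λ n → trans (ℚ.*-distribˡ-+ (ι (suc k)) (seq x n) (1 /suc k))
           (cong (ι (suc k) ℚ.* seq x n ℚ.+_) (trans (ℚ.*-comm (ι (suc k)) (1 /suc k)) (/suc-* 1 k)))) ⟩
    fromℕ (suc k) * x + 1ℝ ∎
    where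
    ≼x+ : fromℚ (f k /suc k) ≼ x + ∣ x - fromℚ (f k /suc k) ∣
    ≼x+ = pointwise-≼ λ n → subst (ℚ._≤ seq x n ℚ.+ ℚ.∣ seq x n ℚ.- f k /suc k ∣)
      (solve 2 (λ x a → x :+ (:- (x :- a)) := a) refl (seq x n) (f k /suc k))
      (ℚ.+-monoʳ-≤ (seq x n) (subst (ℚ.- (seq x n ℚ.- f k /suc k) ℚ.≤_)
        (ℚ.∣-p∣≡∣p∣ (seq x n ℚ.- f k /suc k)) (p≤∣p∣ (ℚ.- (seq x n ℚ.- f k /suc k)))))

-- The potential

surplus : ∀ {l r} d → 0ℚ ℚ.≤ d → l ℚ.+ d ≡ r → l ℚ.≤ r
surplus {l} d 0≤d eq = subst (l ℚ.≤_) eq (x≤x+y 0≤d)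

+-nonNeg : ∀ {a b} → 0ℚ ℚ.≤ a → 0ℚ ℚ.≤ b → 0ℚ ℚ.≤ a ℚ.+ b
+-nonNeg = ℚ.+-mono-≤

1-nonNeg : ∀ {a} → a ℚ.≤ 1ℚ → 0ℚ ℚ.≤ 1ℚ ℚ.- a
1-nonNeg {a} a≤1 = subst (ℚ._≤ 1ℚ ℚ.- a) (ℚ.+-inverseʳ a) (ℚ.+-monoˡ-≤ (ℚ.- a) a≤1)

-- A rational substitute for exp(η(X - Y)). The second base exceeds 1/(1 + η)
-- slightly, as its product with 1 + η is 1 + η³, and stays a polynomial in η.
weight : ℚ → ℕ → ℕ → ℚ
weight η X Y = (1ℚ ℚ.+ η) ^ℚ X ℚ.* ((1ℚ ℚ.- η) ℚ.+ η ℚ.* η) ^ℚ Y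

weight-+ : ∀ η X A Y B → weight η (X ℕ.+ A) (Y ℕ.+ B) ≡ weight η X Y ℚ.* weight η A B
weight-+ η X A Y B = trans
  (cong₂ ℚ._*_ (ℚ^.^-homo-* a X A) (ℚ^.^-homo-* b Y B))
  (solve 4 (λ x x′ y y′ → (x :* x′) :* (y :* y′) := (x :* y) :* (x′ :* y′)) refl
    (a ^ℚ X) (a ^ℚ A) (b ^ℚ Y) (b ^ℚ B))
  where
  a = 1ℚ ℚ.+ η
  b = (1ℚ ℚ.- η) ℚ.+ η ℚ.* η

module _ {η : ℚ} (0≤η : 0ℚ ℚ.≤ η) (η≤1 : η ℚ.≤ 1ℚ) where

  private
    a b κ : ℚ
    a = 1ℚ ℚ.+ η
    b = (1ℚ ℚ.- η) ℚ.+ η ℚ.* η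
    κ = 1ℚ ℚ.- η
    0≤κ : 0ℚ ℚ.≤ κ
    0≤κ = 1-nonNeg η≤1
    0≤ηη : 0ℚ ℚ.≤ η ℚ.* η
    0≤ηη = *-nonNeg 0≤η 0≤η
    0≤a : 0ℚ ℚ.≤ a
    0≤a = +-nonNeg 0≤1 0≤η
    0≤b : 0ℚ ℚ.≤ b
    0≤b = +-nonNeg 0≤κ 0≤ηη

  weight-nonNeg : ∀ X Y → 0ℚ ℚ.≤ weight η X Y
  weight-nonNeg X Y = *-nonNeg (^-nonNeg X 0≤a) (^-nonNeg Y 0≤b)

  -- The two bases have product 1 + η³ ≥ 1, so Y of the X factors 1 + η outweigh
  -- all the factors of the second kind.
  1≤weight : ∀ X Y → Y ℕ.≤ X → 1ℚ ℚ.≤ weight η X Y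
  1≤weight X Y Y≤X = subst (1ℚ ℚ.≤_) eq
    (*-mono {1ℚ} {a ^ℚ (X ℕ.∸ Y)} {1ℚ} {(a ℚ.* b) ^ℚ Y} 0≤1 (^-nonNeg Y (*-nonNeg 0≤a 0≤b))
      (1≤^ (X ℕ.∸ Y) (x≤x+y 0≤η))
      (1≤^ Y (surplus ((η ℚ.* η) ℚ.* η) (*-nonNeg 0≤ηη 0≤η)
        (solve 1 (λ η → con 1ℚ :+ (η :* η) :* η := (con 1ℚ :+ η) :* ((con 1ℚ :- η) :+ η :* η)) refl η))))
    where
    eq : a ^ℚ (X ℕ.∸ Y) ℚ.* (a ℚ.* b) ^ℚ Y ≡ a ^ℚ X ℚ.* b ^ℚ Y
    eq = trans (cong (a ^ℚ (X ℕ.∸ Y) ℚ.*_) (ℚ^.^-distrib-* a b Y))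
      (trans (sym (ℚ.*-assoc (a ^ℚ (X ℕ.∸ Y)) (a ^ℚ Y) (b ^ℚ Y)))
        (cong (ℚ._* b ^ℚ Y) (trans (sym (ℚ^.^-homo-* a (X ℕ.∸ Y) Y)) (cong (a ^ℚ_) (ℕ.m∸n+n≡m Y≤X)))))

  private
    rise fall : ∀ {n} → Polynomial n → Polynomial n
    rise η = con 1ℚ :+ η
    fall η = (con 1ℚ :- η) :+ η :* η
    expansion : ∀ {n} → ℕ → ℕ → Polynomial n → Polynomial n
    expansion A B η = (con 1ℚ :+ con (ι 3) :* (η :* η)) :+ η :* (con (ι A) :- con (ι B))

  -- The expansion of (1 + η)ᴬ⁻ᴮ to first order, with all later terms absorbed
  -- in 3η². In each case the slack is η² times a factor that is visibly
  -- nonnegative for η in [0, 1].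
  weight-bound : ∀ A B → A ℕ.≤ 2 → B ℕ.≤ 2 →
    weight η A B ℚ.≤ (1ℚ ℚ.+ ι 3 ℚ.* (η ℚ.* η)) ℚ.+ η ℚ.* (ι A ℚ.- ι B)
  weight-bound 0 0 _ _ = surplus ((η ℚ.* η) ℚ.* (ι 3))
    (*-nonNeg 0≤ηη (ι-nonNeg 3))
    (solve 1 (λ η → con 1ℚ :* con 1ℚ :+ (η :* η) :* (con (ι 3))
      := expansion 0 0 η) refl η)
  weight-bound 1 0 _ _ = surplus ((η ℚ.* η) ℚ.* (ι 3))
    (*-nonNeg 0≤ηη (ι-nonNeg 3))
    (solve 1 (λ η → (rise η :* con 1ℚ) :* con 1ℚ :+ (η :* η) :* (con (ι 3))
      := expansion 1 0 η) refl η)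
  weight-bound 2 0 _ _ = surplus ((η ℚ.* η) ℚ.* (ι 2))
    (*-nonNeg 0≤ηη (ι-nonNeg 2))
    (solve 1 (λ η → (rise η :* (rise η :* con 1ℚ)) :* con 1ℚ :+ (η :* η) :* (con (ι 2))
      := expansion 2 0 η) refl η)
  weight-bound 0 1 _ _ = surplus ((η ℚ.* η) ℚ.* (ι 2))
    (*-nonNeg 0≤ηη (ι-nonNeg 2))
    (solve 1 (λ η → con 1ℚ :* (fall η :* con 1ℚ) :+ (η :* η) :* (con (ι 2))
      := expansion 0 1 η) refl η)
  weight-bound 1 1 _ _ = surplus ((η ℚ.* η) ℚ.* (ι 2 ℚ.+ κ))
    (*-nonNeg 0≤ηη (+-nonNeg (ι-nonNeg 2) 0≤κ))
    (solve 1 (λ η → (rise η :* con 1ℚ) :* (fall η :* con 1ℚ) :+ (η :* η) :* (con (ι 2) :+ (con 1ℚ :- η))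
      := expansion 1 1 η) refl η)
  weight-bound 2 1 _ _ = surplus ((η ℚ.* η) ℚ.* ((1ℚ ℚ.+ κ) ℚ.+ κ ℚ.* a))
    (*-nonNeg 0≤ηη (+-nonNeg (+-nonNeg 0≤1 0≤κ) (*-nonNeg 0≤κ 0≤a)))
    (solve 1 (λ η → (rise η :* (rise η :* con 1ℚ)) :* (fall η :* con 1ℚ)
      :+ (η :* η) :* ((con 1ℚ :+ (con 1ℚ :- η)) :+ (con 1ℚ :- η) :* rise η)
      := expansion 2 1 η) refl η)
  weight-bound 0 2 _ _ = surplus ((η ℚ.* η) ℚ.* (η ℚ.* (1ℚ ℚ.+ κ)))
    (*-nonNeg 0≤ηη (*-nonNeg 0≤η (+-nonNeg 0≤1 0≤κ)))
    (solve 1 (λ η → con 1ℚ :* (fall η :* (fall η :* con 1ℚ)) :+ (η :* η) :* (η :* (con 1ℚ :+ (con 1ℚ :- η)))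
      := expansion 0 2 η) refl η)
  weight-bound 1 2 _ _ = surplus ((η ℚ.* η) ℚ.* ((1ℚ ℚ.+ κ) ℚ.+ (η ℚ.* η) ℚ.* κ))
    (*-nonNeg 0≤ηη (+-nonNeg (+-nonNeg 0≤1 0≤κ) (*-nonNeg 0≤ηη 0≤κ)))
    (solve 1 (λ η → (rise η :* con 1ℚ) :* (fall η :* (fall η :* con 1ℚ))
      :+ (η :* η) :* ((con 1ℚ :+ (con 1ℚ :- η)) :+ (η :* η) :* (con 1ℚ :- η))
      := expansion 1 2 η) refl η)
  weight-bound 2 2 _ _ = surplus ((η ℚ.* η) ℚ.* ((κ ℚ.+ κ) ℚ.+ (κ ℚ.* a) ℚ.* (1ℚ ℚ.+ η ℚ.* η)))
    (*-nonNeg 0≤ηη (+-nonNeg (+-nonNeg 0≤κ 0≤κ) (*-nonNeg (*-nonNeg 0≤κ 0≤a) (+-nonNeg 0≤1 0≤ηη))))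
    (solve 1 (λ η → (rise η :* (rise η :* con 1ℚ)) :* (fall η :* (fall η :* con 1ℚ))
      :+ (η :* η) :* (((con 1ℚ :- η) :+ (con 1ℚ :- η))
                     :+ ((con 1ℚ :- η) :* rise η) :* (con 1ℚ :+ η :* η))
      := expansion 2 2 η) refl η)
  weight-bound (suc (suc (suc _))) _ (ℕ.s≤s (ℕ.s≤s ())) _
  weight-bound _ (suc (suc (suc _))) _ (ℕ.s≤s (ℕ.s≤s ()))

bernoulli⁺ : ∀ {z} n → 0ℚ ℚ.≤ z → 1ℚ ℚ.+ ι n ℚ.* z ℚ.≤ (1ℚ ℚ.+ z) ^ℚ n
bernoulli⁺ {z} zero    0≤z = ℚ.≤-reflexive (solve 1 (λ z → con 1ℚ :+ con (ι 0) :* z := con 1ℚ) refl z)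
bernoulli⁺ {z} (suc n) 0≤z = ℚ.≤-trans
  (surplus (ι n ℚ.* (z ℚ.* z)) (*-nonNeg (ι-nonNeg n) (*-nonNeg 0≤z 0≤z))
    (trans (cong (λ k → (1ℚ ℚ.+ k ℚ.* z) ℚ.+ ι n ℚ.* (z ℚ.* z)) (ι-+ 1 n))
      (solve 2 (λ k z → (con 1ℚ :+ (con 1ℚ :+ k) :* z) :+ k :* (z :* z)
                     := (con 1ℚ :+ z) :* (con 1ℚ :+ k :* z)) refl (ι n) z)))
  (*-monoʳ {1ℚ ℚ.+ ι n ℚ.* z} {(1ℚ ℚ.+ z) ^ℚ n} (+-nonNeg 0≤1 0≤z) (bernoulli⁺ n 0≤z))

^≤1 : ∀ {a} n → 0ℚ ℚ.≤ a → a ℚ.≤ 1ℚ → a ^ℚ n ℚ.≤ 1ℚ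
^≤1 {a} n 0≤a a≤1 = ℚ.≤-trans (^-mono n 0≤a a≤1) (ℚ.≤-reflexive (1^≡1 n))
  where
  1^≡1 : ∀ n → 1ℚ ^ℚ n ≡ 1ℚ
  1^≡1 zero    = refl
  1^≡1 (suc n) = trans (ℚ.*-identityˡ (1ℚ ^ℚ n)) (1^≡1 n)

power-reciprocal : ∀ {x y} n → 0ℚ ℚ.≤ x → 0ℚ ℚ.≤ y → x ℚ.* y ℚ.≤ 1ℚ → ∀ {B} → B ℚ.≤ y ^ℚ n →
                   x ^ℚ n ℚ.* B ℚ.≤ 1ℚ
power-reciprocal {x} {y} n 0≤x 0≤y xy≤1 {B} B≤ = ℚ.≤-trans
  (*-monoʳ {B} {y ^ℚ n} (^-nonNeg n 0≤x) B≤)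
  (subst (ℚ._≤ 1ℚ) (ℚ^.^-distrib-* x y n) (^≤1 n (*-nonNeg 0≤x 0≤y) xy≤1))

-- Bernoulli's inequality bounds powers from below. Applied to a near reciprocal
-- 1 + z or 1 - z of x it bounds the powers of x from above, in product form so
-- that no division occurs.
power-upper : ∀ {x z} n → 0ℚ ℚ.≤ x → 0ℚ ℚ.≤ z → x ℚ.* (1ℚ ℚ.+ z) ℚ.≤ 1ℚ →
              x ^ℚ n ℚ.* (1ℚ ℚ.+ ι n ℚ.* z) ℚ.≤ 1ℚ
power-upper n 0≤x 0≤z h = power-reciprocal n 0≤x (+-nonNeg 0≤1 0≤z) h (bernoulli⁺ n 0≤z)

power-lower : ∀ {x z} n → 0ℚ ℚ.≤ x → 0ℚ ℚ.≤ z → z ℚ.≤ 1ℚ → x ℚ.* (1ℚ ℚ.- z) ℚ.≤ 1ℚ →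
              x ^ℚ n ℚ.* (1ℚ ℚ.- ι n ℚ.* z) ℚ.≤ 1ℚ
power-lower n 0≤x 0≤z z≤1 h = power-reciprocal n 0≤x (1-nonNeg z≤1) h (bernoulli n 0≤z z≤1)

-- Combines two of the bounds in product form: P Q ≤ P Q (B B′ κ) ≤ κ.
reciprocals : ∀ {P Q B B′ κ} → 0ℚ ℚ.≤ P → 0ℚ ℚ.≤ Q → 0ℚ ℚ.≤ B′ → 0ℚ ℚ.≤ κ →
              P ℚ.* B ℚ.≤ 1ℚ → 0ℚ ℚ.≤ B → Q ℚ.* B′ ℚ.≤ 1ℚ → 1ℚ ℚ.≤ (B ℚ.* B′) ℚ.* κ →
              P ℚ.* Q ℚ.≤ κ
reciprocals {P} {Q} {B} {B′} {κ} 0≤P 0≤Q 0≤B′ 0≤κ PB≤1 0≤B QB′≤1 1≤ = ℚ.≤-trans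
  (subst (ℚ._≤ (P ℚ.* Q) ℚ.* ((B ℚ.* B′) ℚ.* κ)) (ℚ.*-identityʳ (P ℚ.* Q))
    (*-monoʳ {1ℚ} {(B ℚ.* B′) ℚ.* κ} (*-nonNeg 0≤P 0≤Q) 1≤))
  (ℚ.≤-trans
    (ℚ.≤-reflexive (solve 5 (λ P Q B B′ κ → (P :* Q) :* ((B :* B′) :* κ) := ((P :* B) :* (Q :* B′)) :* κ)
      refl P Q B B′ κ))
    (subst (((P ℚ.* B) ℚ.* (Q ℚ.* B′)) ℚ.* κ ℚ.≤_) (ℚ.*-identityˡ κ)
      (*-monoˡ {(P ℚ.* B) ℚ.* (Q ℚ.* B′)} {1ℚ} 0≤κ
        (*-mono {P ℚ.* B} {1ℚ} {Q ℚ.* B′} {1ℚ} (*-nonNeg 0≤P 0≤B) 0≤1 PB≤1 QB′≤1))))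

halving : ∀ {η} m → 0ℚ ℚ.≤ η → η ℚ.≤ 1ℚ → ι m ℚ.* η ≡ 1ℚ → (1ℚ ℚ.- η) ^ℚ m ℚ.≤ ½
halving {η} m 0≤η η≤1 mη≡1 = *-cancelʳ (ι-pos 1)
  (subst (λ z → (1ℚ ℚ.- η) ^ℚ m ℚ.* (1ℚ ℚ.+ z) ℚ.≤ 1ℚ) mη≡1
    (power-upper m (1-nonNeg η≤1) 0≤η
      (surplus (η ℚ.* η) (*-nonNeg 0≤η 0≤η)
        (solve 1 (λ η → (con 1ℚ :- η) :* (con 1ℚ :+ η) :+ η :* η := con 1ℚ) refl η))))

-- Blocks of trials

growth : ℚ → ℕ → ℚ
growth η c = 1ℚ ℚ.+ ι c ℚ.* (η ℚ.* η)

decay : ℚ → ℕ → ℚ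
decay η c = 1ℚ ℚ.- ι c ℚ.* (η ℚ.* η)

-- D trials and their share 32 of the threshold form a block. The mean of Z is at
-- most 25/D = 200η for close distributions, whence the growth 203 = 200 + 3 of a
-- trial, and at least 49/D = 392η for distant ones, whence the decay 389 = 392 - 3.
module Block (D : ℕ) (η : ℚ) (0≤η : 0ℚ ℚ.≤ η) (η≤ : η ℚ.≤ 1 /suc 199)
             (Dη≡ : ι D ℚ.* η ≡ 1 /suc 7) where

  private
    w a b : ℚ
    w = 1 /suc 199 ℚ.- η
    a = 1ℚ ℚ.+ η
    b = (1ℚ ℚ.- η) ℚ.+ η ℚ.* η
    0≤w : 0ℚ ℚ.≤ w
    0≤w = subst (ℚ._≤ w) (ℚ.+-inverseʳ η) (ℚ.+-monoˡ-≤ (ℚ.- η) η≤)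
    ηη≤ : η ℚ.* η ℚ.≤ 1 /suc 39999
    ηη≤ = *-mono {η} {1 /suc 199} {η} {1 /suc 199} 0≤η (/suc-nonNeg 1 199) η≤ η≤
    0≤ηη : 0ℚ ℚ.≤ η ℚ.* η
    0≤ηη = *-nonNeg 0≤η 0≤η
    η²-small : ∀ c → c ℕ.≤ 40000 → ι c ℚ.* (η ℚ.* η) ℚ.≤ 1ℚ
    η²-small c c≤ = *-mono {ι c} {ι 40000} {η ℚ.* η} {1 /suc 39999} (ι-nonNeg c) (/suc-nonNeg 1 39999)
      (ι-mono {c} {40000} c≤) ηη≤
    Dη²≡ : ∀ c → ι D ℚ.* (ι c ℚ.* (η ℚ.* η)) ≡ (ι c ℚ.* (1 /suc 7)) ℚ.* η
    Dη²≡ c = trans (solve 3 (λ d c η → d :* (c :* (η :* η)) := (c :* (d :* η)) :* η) refl (ι D) (ι c) η)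
      (cong (λ z → (ι c ℚ.* z) ℚ.* η) Dη≡)

  η≤1 : η ℚ.≤ 1ℚ
  η≤1 = ℚ.≤-trans η≤ (/suc-antimono {0} {199} ℕ.z≤n)

  private
    0≤b : 0ℚ ℚ.≤ b
    0≤b = +-nonNeg (1-nonNeg η≤1) 0≤ηη
    0≤1-η : 0ℚ ℚ.≤ 1ℚ ℚ.- η
    0≤1-η = 1-nonNeg η≤1

  0≤growth : ∀ c → 0ℚ ℚ.≤ growth η c
  0≤growth c = +-nonNeg 0≤1 (*-nonNeg (ι-nonNeg c) 0≤ηη)

  0≤decay : ∀ c → c ℕ.≤ 40000 → 0ℚ ℚ.≤ decay η c
  0≤decay c c≤ = 1-nonNeg (η²-small c c≤)

  -- As 32 exceeds 25 by enough, (1 + 32η(1 - η))(1 - 203η/8)(1 - η) ≥ 1 for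
  -- η ≤ 1/200. Its expansion has negative terms, which disappear when one of
  -- their factors η is written as 1/200 - w.
  rising-block : b ^ℚ 32 ℚ.* growth η 203 ^ℚ D ℚ.≤ 1ℚ ℚ.- η
  rising-block = reciprocals {B = 1ℚ ℚ.+ ι 32 ℚ.* z} {B′ = 1ℚ ℚ.- ι D ℚ.* y}
    (^-nonNeg 32 0≤b) (^-nonNeg D (0≤growth 203)) 0≤B′ 0≤1-η
    (power-upper 32 0≤b 0≤z (surplus (z ℚ.* z) (*-nonNeg 0≤z 0≤z)
      (solve 1 (λ η → let z = η :* (con 1ℚ :- η) in
         ((con 1ℚ :- η) :+ η :* η) :* (con 1ℚ :+ z) :+ z :* z := con 1ℚ) refl η)))
    (+-nonNeg 0≤1 (*-nonNeg (ι-nonNeg 32) 0≤z))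
    (power-lower D (0≤growth 203) (*-nonNeg (ι-nonNeg 203) 0≤ηη) (η²-small 203 (ℕ.m≤m+n 203 _))
      (surplus (y ℚ.* y) (*-nonNeg 0≤y 0≤y)
        (solve 1 (λ y → (con 1ℚ :+ y) :* (con 1ℚ :- y) :+ y :* y := con 1ℚ) refl y)))
    (subst (λ t → 1ℚ ℚ.≤ ((1ℚ ℚ.+ ι 32 ℚ.* z) ℚ.* (1ℚ ℚ.- t)) ℚ.* (1ℚ ℚ.- η)) (sym (Dη²≡ 203)) key)
    where
    z y c₀ c₁ c₂ c₃ : ℚ
    z = η ℚ.* (1ℚ ℚ.- η)
    y = ι 203 ℚ.* (η ℚ.* η)
    0≤z : 0ℚ ℚ.≤ z
    0≤z = *-nonNeg 0≤η 0≤1-η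
    0≤y : 0ℚ ℚ.≤ y
    0≤y = *-nonNeg (ι-nonNeg 203) 0≤ηη
    c₀ = 439 /suc 319
    c₁ = 6805 /suc 7
    c₂ = 82597 /suc 49
    c₃ = ι 812
    0≤B′ : 0ℚ ℚ.≤ 1ℚ ℚ.- ι D ℚ.* y
    0≤B′ = subst (λ t → 0ℚ ℚ.≤ 1ℚ ℚ.- t) (sym (Dη²≡ 203))
      (subst (0ℚ ℚ.≤_) (solve 1 (λ η → con (1397 /suc 1599) :+ con (203 /suc 7) :* (con (1 /suc 199) :- η)
         := con 1ℚ :- (con (ι 203) :* con (1 /suc 7)) :* η) refl η)
        (+-nonNeg (/suc-nonNeg 1397 1599) (*-nonNeg (/suc-nonNeg 203 7) 0≤w)))
    key : 1ℚ ℚ.≤ ((1ℚ ℚ.+ ι 32 ℚ.* z) ℚ.* (1ℚ ℚ.- (ι 203 ℚ.* (1 /suc 7)) ℚ.* η)) ℚ.* (1ℚ ℚ.- η)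
    key = surplus (η ℚ.* (c₀ ℚ.+ c₁ ℚ.* w) ℚ.+ (η ℚ.* (η ℚ.* η)) ℚ.* (c₂ ℚ.+ c₃ ℚ.* w))
      (+-nonNeg
        (*-nonNeg 0≤η (+-nonNeg (/suc-nonNeg 439 319) (*-nonNeg (/suc-nonNeg 6805 7) 0≤w)))
        (*-nonNeg (*-nonNeg 0≤η 0≤ηη) (+-nonNeg (/suc-nonNeg 82597 49) (*-nonNeg (ι-nonNeg 812) 0≤w))))
      (solve 1 (λ η → let w = con (1 /suc 199) :- η in
         con 1ℚ :+ (η :* (con (439 /suc 319) :+ con (6805 /suc 7) :* w)
                    :+ (η :* (η :* η)) :* (con (82597 /suc 49) :+ con (ι 812) :* w))
         := ((con 1ℚ :+ con (ι 32) :* (η :* (con 1ℚ :- η)))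
             :* (con 1ℚ :- (con (ι 203) :* con (1 /suc 7)) :* η)) :* (con 1ℚ :- η)) refl η)

  -- As 49 exceeds 32 by enough, (1 - 32η)(1 + 389η/8)(1 - η) ≥ 1, by the same
  -- rewriting.
  falling-block : a ^ℚ 32 ℚ.* decay η 389 ^ℚ D ℚ.≤ 1ℚ ℚ.- η
  falling-block = reciprocals {B = 1ℚ ℚ.- ι 32 ℚ.* η} {B′ = 1ℚ ℚ.+ ι D ℚ.* y}
    (^-nonNeg 32 (+-nonNeg 0≤1 0≤η)) (^-nonNeg D (0≤decay 389 (ℕ.m≤m+n 389 _)))
    (+-nonNeg 0≤1 (*-nonNeg (ι-nonNeg D) 0≤y)) 0≤1-η
    (power-lower 32 (+-nonNeg 0≤1 0≤η) 0≤η η≤1 (surplus (η ℚ.* η) 0≤ηη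
      (solve 1 (λ η → (con 1ℚ :+ η) :* (con 1ℚ :- η) :+ η :* η := con 1ℚ) refl η)))
    0≤B
    (power-upper D (0≤decay 389 (ℕ.m≤m+n 389 _)) 0≤y
      (surplus (y ℚ.* y) (*-nonNeg 0≤y 0≤y)
        (solve 1 (λ y → (con 1ℚ :- y) :* (con 1ℚ :+ y) :+ y :* y := con 1ℚ) refl y)))
    (subst (λ t → 1ℚ ℚ.≤ ((1ℚ ℚ.- ι 32 ℚ.* η) ℚ.* (1ℚ ℚ.+ t)) ℚ.* (1ℚ ℚ.- η)) (sym (Dη²≡ 389)) key)
    where
    y : ℚ
    y = ι 389 ℚ.* (η ℚ.* η)
    0≤y : 0ℚ ℚ.≤ y
    0≤y = *-nonNeg (ι-nonNeg 389) 0≤ηη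
    0≤B : 0ℚ ℚ.≤ 1ℚ ℚ.- ι 32 ℚ.* η
    0≤B = subst (0ℚ ℚ.≤_) (solve 1 (λ η → con (168 /suc 199) :+ con (ι 32) :* (con (1 /suc 199) :- η)
         := con 1ℚ :- con (ι 32) :* η) refl η)
      (+-nonNeg (/suc-nonNeg 168 199) (*-nonNeg (ι-nonNeg 32) 0≤w))
    key : 1ℚ ℚ.≤ ((1ℚ ℚ.- ι 32 ℚ.* η) ℚ.* (1ℚ ℚ.+ (ι 389 ℚ.* (1 /suc 7)) ℚ.* η)) ℚ.* (1ℚ ℚ.- η)
    key = surplus (η ℚ.* (12419 /suc 1599 ℚ.+ (12581 /suc 7) ℚ.* w) ℚ.+ (η ℚ.* (η ℚ.* η)) ℚ.* ι 1556)
      (+-nonNeg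
        (*-nonNeg 0≤η (+-nonNeg (/suc-nonNeg 12419 1599) (*-nonNeg (/suc-nonNeg 12581 7) 0≤w)))
        (*-nonNeg (*-nonNeg 0≤η 0≤ηη) (ι-nonNeg 1556)))
      (solve 1 (λ η → let w = con (1 /suc 199) :- η in
         con 1ℚ :+ (η :* (con (12419 /suc 1599) :+ con (12581 /suc 7) :* w)
                    :+ (η :* (η :* η)) :* con (ι 1556))
         := ((con 1ℚ :- con (ι 32) :* η)
             :* (con 1ℚ :+ (con (ι 389) :* con (1 /suc 7)) :* η)) :* (con 1ℚ :- η)) refl η)

  -- Since 8Dη = 1, a number of 8D blocks halves the potential.
  amplified : ∀ {x g} L → 0ℚ ℚ.≤ x → 0ℚ ℚ.≤ g → x ^ℚ 32 ℚ.* g ^ℚ D ℚ.≤ 1ℚ ℚ.- η →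
              let R = (8 ℕ.* D) ℕ.* L in g ^ℚ (D ℕ.* R) ℚ.* x ^ℚ (32 ℕ.* R) ℚ.≤ ½ ^ℚ L
  amplified {x} {g} L 0≤x 0≤g block = ℚ.≤-trans (ℚ.≤-reflexive regroup)
    (ℚ.≤-trans (^-mono R (*-nonNeg (^-nonNeg 32 0≤x) (^-nonNeg D 0≤g)) block)
    (ℚ.≤-trans (ℚ.≤-reflexive (sym (ℚ^.^-assocʳ (1ℚ ℚ.- η) (8 ℕ.* D) L)))
      (^-mono L (^-nonNeg (8 ℕ.* D) 0≤1-η) (halving (8 ℕ.* D) 0≤η η≤1 8Dη≡1))))
    where
    R = (8 ℕ.* D) ℕ.* L
    8Dη≡1 : ι (8 ℕ.* D) ℚ.* η ≡ 1ℚ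
    8Dη≡1 = trans (cong (ℚ._* η) (ι-* 8 D)) (trans (ℚ.*-assoc (ι 8) (ι D) η) (cong (ι 8 ℚ.*_) Dη≡))
    regroup : g ^ℚ (D ℕ.* R) ℚ.* x ^ℚ (32 ℕ.* R) ≡ (x ^ℚ 32 ℚ.* g ^ℚ D) ^ℚ R
    regroup = trans (ℚ.*-comm (g ^ℚ (D ℕ.* R)) (x ^ℚ (32 ℕ.* R)))
      (trans (cong₂ ℚ._*_ (sym (ℚ^.^-assocʳ x 32 R)) (sym (ℚ^.^-assocʳ g D R)))
        (sym (ℚ^.^-distrib-* (x ^ℚ 32) (g ^ℚ D) R)))

  rising-potential : ∀ L → let R = (8 ℕ.* D) ℕ.* L in
    growth η 203 ^ℚ (D ℕ.* R) ℚ.* weight η 0 (32 ℕ.* R) ℚ.≤ ½ ^ℚ L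
  rising-potential L = subst (ℚ._≤ ½ ^ℚ L)
    (cong (growth η 203 ^ℚ (D ℕ.* R) ℚ.*_) (sym (ℚ.*-identityˡ (b ^ℚ (32 ℕ.* R)))))
    (amplified L 0≤b (0≤growth 203) rising-block)
    where R = (8 ℕ.* D) ℕ.* L

  falling-potential : ∀ L → let R = (8 ℕ.* D) ℕ.* L in
    decay η 389 ^ℚ (D ℕ.* R) ℚ.* weight η (32 ℕ.* R) 0 ℚ.≤ ½ ^ℚ L
  falling-potential L = subst (ℚ._≤ ½ ^ℚ L)
    (cong (decay η 389 ^ℚ (D ℕ.* R) ℚ.*_) (sym (ℚ.*-identityʳ (a ^ℚ (32 ℕ.* R)))))
    (amplified L (+-nonNeg 0≤1 0≤η) (0≤decay 389 (ℕ.m≤m+n 389 _)) falling-block)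
    where R = (8 ℕ.* D) ℕ.* L

-- Expectations and agreements

∑-mono : ∀ {n} {u v : Vector ℝ n} → (∀ i → u i ≼ v i) → ∑ u ≼ ∑ v
∑-mono {zero}  h = ≼-refl
∑-mono {suc n} h = +-mono-≼ (h zero) (∑-mono λ i → h (suc i))

𝔼 : ∀ {n} → Distribution n → Vector ℝ n → ℝ
𝔼 p f = ∑ λ i → prob p i * f i

𝔼-mono : ∀ {n} (p : Distribution n) {f g : Vector ℝ n} → (∀ i → f i ≼ g i) → 𝔼 p f ≼ 𝔼 p g
𝔼-mono p h = ∑-mono λ i → *-monoˡ-≼ (prob p i) (wrap (nonNeg p i)) (h i)

𝔼-cong : ∀ {n} (p : Distribution n) {f g : Vector ℝ n} → (∀ i → f i ≈ g i) → 𝔼 p f ≈ 𝔼 p g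
𝔼-cong p h = 𝔼-mono p (λ i → to (h i)) ⊣ 𝔼-mono p (λ i → from (h i))

∑-affine : ∀ {n} (w f g : Vector ℝ n) c b k →
  seq (∑ λ i → w i * (c + b * (f i - g i))) k ≡
  seq c k ℚ.* seq (∑ w) k ℚ.+ seq b k ℚ.* (seq (∑ λ i → w i * f i) k ℚ.- seq (∑ λ i → w i * g i) k)
∑-affine {zero} w f g c b k =
  solve 2 (λ c b → con 0ℚ := c :* con 0ℚ :+ b :* (con 0ℚ :- con 0ℚ)) refl (seq c k) (seq b k)
∑-affine {suc n} w f g c b k =
  trans (cong (seq (w zero) k ℚ.* (seq c k ℚ.+ seq b k ℚ.* (seq (f zero) k ℚ.- seq (g zero) k)) ℚ.+_)
          (∑-affine (tail w) (tail f) (tail g) c b k))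
    (solve 8 (λ w f g c b W F G →
       w :* (c :+ b :* (f :- g)) :+ (c :* W :+ b :* (F :- G))
       := c :* (w :+ W) :+ b :* ((w :* f :+ F) :- (w :* g :+ G))) refl
       (seq (w zero) k) (seq (f zero) k) (seq (g zero) k) (seq c k) (seq b k)
       (seq (∑ (tail w)) k) (seq (∑ λ i → w (suc i) * f (suc i)) k) (seq (∑ λ i → w (suc i) * g (suc i)) k))

𝔼-affine : ∀ {n} (p : Distribution n) c b (f g : Vector ℝ n) →
           𝔼 p (λ i → c + b * (f i - g i)) ≈ c + b * (𝔼 p f - 𝔼 p g)
𝔼-affine p c b f g = begin-equality
  𝔼 p (λ i → c + b * (f i - g i))           ≈⟨ pointwise (∑-affine (prob p) f g c b) ⟩
  c * ∑ (prob p) + b * (𝔼 p f - 𝔼 p g)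
    ≈⟨ +-cong (*-congˡ-≈ c (wrap (proj₁ (total p)) ⊣ wrap (proj₂ (total p)))) ⟩
  c * 1ℝ + b * (𝔼 p f - 𝔼 p g)              ≈⟨ pointwise (λ k → cong (ℚ._+ _) (ℚ.*-identityʳ (seq c k))) ⟩
  c + b * (𝔼 p f - 𝔼 p g)                   ∎
  where
  +-cong : ∀ {x y z} → x ≈ y → x + z ≈ y + z
  +-cong (x≼y ⊣ y≼x) = +-mono-≼ x≼y ≼-refl ⊣ +-mono-≼ y≼x ≼-refl

𝔼-const : ∀ {n} (p : Distribution n) c → 𝔼 p (λ _ → c) ≈ c
𝔼-const p c = begin-equality
  𝔼 p (λ _ → c)                    ≈⟨ 𝔼-cong p (λ _ → pointwise λ k → expand (seq c k)) ⟩
  𝔼 p (λ _ → c + 0ℝ * (0ℝ - 0ℝ))   ≈⟨ 𝔼-affine p c 0ℝ (λ _ → 0ℝ) (λ _ → 0ℝ) ⟩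
  c + 0ℝ * (𝔼 p (λ _ → 0ℝ) - 𝔼 p (λ _ → 0ℝ))
    ≈⟨ pointwise (λ k → trans
         (cong (seq c k ℚ.+_) (ℚ.*-zeroˡ (seq (𝔼 p (λ _ → 0ℝ) - 𝔼 p (λ _ → 0ℝ)) k)))
         (ℚ.+-identityʳ (seq c k))) ⟩
  c                                ∎
  where
  expand : ∀ c → c ≡ c ℚ.+ 0ℚ ℚ.* (0ℚ ℚ.- 0ℚ)
  expand = solve 1 (λ c → c := c :+ con 0ℚ :* (con 0ℚ :- con 0ℚ)) refl

-- The indicator of i = j, in the form in which truncated subtraction computes it.
coincide : ∀ {n} → Fin n → Fin n → ℕ
coincide i j = 1 ℕ.∸ ((toℕ i ℕ.∸ toℕ j) ℕ.+ (toℕ j ℕ.∸ toℕ i))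

agree : ∀ {n} → Fin n → Fin n → ℝ
agree i j = fromℕ (coincide i j)

coincide≤1 : ∀ {n} (i j : Fin n) → coincide i j ℕ.≤ 1
coincide≤1 i j = ℕ.m∸n≤m 1 ((toℕ i ℕ.∸ toℕ j) ℕ.+ (toℕ j ℕ.∸ toℕ i))

coincide-≡ : ∀ {n} (i : Fin n) → coincide i i ≡ 1
coincide-≡ zero    = refl
coincide-≡ (suc i) = coincide-≡ i

coincide-≢ : ∀ {n} (i j : Fin n) → j ≢ i → coincide i j ≡ 0
coincide-≢ zero    zero    j≢i = contradiction refl j≢i
coincide-≢ zero    (suc j) j≢i = ℕ.0∸n≡0 (toℕ j)
coincide-≢ (suc i) zero    j≢i = ℕ.0∸n≡0 (toℕ i ℕ.+ 0)
coincide-≢ (suc i) (suc j) j≢i = coincide-≢ i j λ j≡i → j≢i (cong suc j≡i)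

∑-zero : ∀ {n} (w : Vector ℝ n) (f : Fin n → ℕ) → (∀ j → f j ≡ 0) → ∀ k →
         seq (∑ λ j → w j * fromℕ (f j)) k ≡ 0ℚ
∑-zero {zero}  w f f≡0 k = refl
∑-zero {suc n} w f f≡0 k = cong₂ ℚ._+_ {v = 0ℚ}
  (trans (cong (λ z → seq (w zero) k ℚ.* ι z) (f≡0 zero)) (ℚ.*-zeroʳ (seq (w zero) k)))
  (∑-zero (tail w) (λ j → f (suc j)) (λ j → f≡0 (suc j)) k)

∑-indicator : ∀ {n} (w : Vector ℝ n) (f : Fin n → ℕ) i → f i ≡ 1 → (∀ j → j ≢ i → f j ≡ 0) → ∀ k →
              seq (∑ λ j → w j * fromℕ (f j)) k ≡ seq (w i) k
∑-indicator w f zero f≡1 f≡0 k = trans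
  (cong₂ ℚ._+_
    (trans (cong (λ z → seq (w zero) k ℚ.* ι z) f≡1) (ℚ.*-identityʳ (seq (w zero) k)))
    (∑-zero (tail w) (λ j → f (suc j)) (λ j → f≡0 (suc j) λ ()) k))
  (ℚ.+-identityʳ (seq (w zero) k))
∑-indicator w f (suc i) f≡1 f≡0 k = trans
  (cong₂ ℚ._+_
    (trans (cong (λ z → seq (w zero) k ℚ.* ι z) (f≡0 zero λ ())) (ℚ.*-zeroʳ (seq (w zero) k)))
    (∑-indicator (tail w) (λ j → f (suc j)) i f≡1
      (λ j j≢i → f≡0 (suc j) λ { refl → j≢i refl }) k))
  (ℚ.+-identityˡ (seq (w (suc i)) k))

𝔼-agree : ∀ {n} (p : Distribution n) i → 𝔼 p (agree i) ≈ prob p i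
𝔼-agree p i = pointwise (∑-indicator (prob p) (coincide i) i (coincide-≡ i) (coincide-≢ i))

-- A single probability is the mean of an indicator.
prob≼1 : ∀ {n} (p : Distribution n) i → prob p i ≼ 1ℝ
prob≼1 p i = begin
  prob p i       ≈⟨ 𝔼-agree p i ⟨
  𝔼 p (agree i)      ≲⟨ 𝔼-mono p (λ j → fromℕ-mono {coincide i j} {1} (coincide≤1 i j)) ⟩
  𝔼 p (λ _ → 1ℝ) ≈⟨ 𝔼-const p 1ℝ ⟩
  1ℝ             ∎

module _ {n} (p q : Distribution n) where

  -- The squared distance.
  μ : ℝ
  μ = ∑ λ i → (p ⊖ q) i ^ 2

  𝔼⁴ : (Fin n → Fin n → Fin n → Fin n → ℝ) → ℝ
  𝔼⁴ f = 𝔼 p λ x₁ → 𝔼 p λ x₂ → 𝔼 q λ y₁ → 𝔼 q λ y₂ → f x₁ x₂ y₁ y₂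

  𝔼⁴-mono : ∀ {f g : Fin n → Fin n → Fin n → Fin n → ℝ} →
            (∀ x₁ x₂ y₁ y₂ → f x₁ x₂ y₁ y₂ ≼ g x₁ x₂ y₁ y₂) → 𝔼⁴ f ≼ 𝔼⁴ g
  𝔼⁴-mono h = 𝔼-mono p λ x₁ → 𝔼-mono p λ x₂ → 𝔼-mono q λ y₁ → 𝔼-mono q λ y₂ → h x₁ x₂ y₁ y₂

  𝔼⁴-complement : ∀ c f → 𝔼⁴ (λ x₁ x₂ y₁ y₂ → 1ℝ - c * f x₁ x₂ y₁ y₂) ≈ 1ℝ - c * 𝔼⁴ f
  𝔼⁴-complement c f = begin-equality
    𝔼⁴ (λ x₁ x₂ y₁ y₂ → 1ℝ - c * f x₁ x₂ y₁ y₂)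
      ≈⟨ (𝔼-cong p λ x₁ → 𝔼-cong p λ x₂ → 𝔼-cong q λ y₁ → affine q (f x₁ x₂ y₁)) ⟩
    𝔼 p (λ x₁ → 𝔼 p λ x₂ → 𝔼 q λ y₁ → 1ℝ - c * 𝔼 q (f x₁ x₂ y₁))
      ≈⟨ (𝔼-cong p λ x₁ → 𝔼-cong p λ x₂ → affine q λ y₁ → 𝔼 q (f x₁ x₂ y₁)) ⟩
    𝔼 p (λ x₁ → 𝔼 p λ x₂ → 1ℝ - c * 𝔼 q (λ y₁ → 𝔼 q (f x₁ x₂ y₁)))
      ≈⟨ (𝔼-cong p λ x₁ → affine p λ x₂ → 𝔼 q λ y₁ → 𝔼 q (f x₁ x₂ y₁)) ⟩
    𝔼 p (λ x₁ → 1ℝ - c * 𝔼 p (λ x₂ → 𝔼 q λ y₁ → 𝔼 q (f x₁ x₂ y₁)))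
      ≈⟨ (affine p λ x₁ → 𝔼 p λ x₂ → 𝔼 q λ y₁ → 𝔼 q (f x₁ x₂ y₁)) ⟩
    1ℝ - c * 𝔼⁴ f ∎
    where
    affine : ∀ (p : Distribution n) (f : Vector ℝ n) → 𝔼 p (λ i → 1ℝ - c * f i) ≈ 1ℝ - c * 𝔼 p f
    affine p f = begin-equality
      𝔼 p (λ i → 1ℝ - c * f i)
        ≈⟨ 𝔼-cong p (λ i → pointwise λ k →
             solve 2 (λ c f → con 1ℚ :- c :* f := con 1ℚ :+ c :* (con 0ℚ :- f)) refl (seq c k) (seq (f i) k)) ⟩
      𝔼 p (λ i → 1ℝ + c * (0ℝ - f i))          ≈⟨ 𝔼-affine p 1ℝ c (λ _ → 0ℝ) f ⟩
      1ℝ + c * (𝔼 p (λ _ → 0ℝ) - 𝔼 p f)        ≈⟨ 1+c[_-] (𝔼-const p 0ℝ) ⟩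
      1ℝ + c * (0ℝ - 𝔼 p f)
        ≈⟨ pointwise (λ k → solve 2 (λ c f → con 1ℚ :+ c :* (con 0ℚ :- f) := con 1ℚ :- c :* f) refl
             (seq c k) (seq (𝔼 p f) k)) ⟩
      1ℝ - c * 𝔼 p f ∎
      where
      1+c[_-] : ∀ {x y z} → x ≈ y → 1ℝ + c * (x - z) ≈ 1ℝ + c * (y - z)
      1+c[_-] {x} {y} {z} (x≼y ⊣ y≼x) =
        let e = *-congˡ-≈ c (+-mono-≼ x≼y (≼-refl { - z}) ⊣ +-mono-≼ y≼x ≼-refl)
        in +-mono-≼ ≼-refl (to e) ⊣ +-mono-≼ ≼-refl (from e)

  excess : Fin n → Fin n → Fin n → Fin n → ℝ
  excess x₁ x₂ y₁ y₂ = (agree x₁ x₂ + agree y₁ y₂) - (agree x₁ y₁ + agree x₂ y₂)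

  -- Averaging over one sample at a time turns each coincidence into a
  -- probability, and then into an inner product of the two distributions.
  𝔼⁴-excess : ∀ c b → 𝔼⁴ (λ x₁ x₂ y₁ y₂ → c + b * excess x₁ x₂ y₁ y₂) ≈ c + b * μ
  𝔼⁴-excess c b = begin-equality
    𝔼⁴ (λ x₁ x₂ y₁ y₂ → c + b * excess x₁ x₂ y₁ y₂)
      ≈⟨ (𝔼-cong p λ x₁ → 𝔼-cong p λ x₂ → 𝔼-cong q λ y₁ → over-y₂ x₁ x₂ y₁) ⟩
    𝔼 p (λ x₁ → 𝔼 p λ x₂ → 𝔼 q λ y₁ → (c + b * (agree x₁ x₂ - Q x₂)) + b * (Q y₁ - agree x₁ y₁))
      ≈⟨ (𝔼-cong p λ x₁ → 𝔼-cong p λ x₂ → over-y₁ x₁ x₂) ⟩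
    𝔼 p (λ x₁ → 𝔼 p λ x₂ → (c + b * (𝔼 q Q - Q x₁)) + b * (agree x₁ x₂ - Q x₂))
      ≈⟨ 𝔼-cong p over-x₂ ⟩
    𝔼 p (λ x₁ → (c + b * (𝔼 q Q - 𝔼 p Q)) + b * (P x₁ - Q x₁))
      ≈⟨ 𝔼-affine p (c + b * (𝔼 q Q - 𝔼 p Q)) b P Q ⟩
    (c + b * (𝔼 q Q - 𝔼 p Q)) + b * (𝔼 p P - 𝔼 p Q)
      ≈⟨ pointwise (λ k → trans
           (solve 5 (λ c b qq pq pp → (c :+ b :* (qq :- pq)) :+ b :* (pp :- pq)
              := c :+ b :* ((qq :- pq) :+ (pp :- pq))) refl
              (seq c k) (seq b k) (seq (𝔼 q Q) k) (seq (𝔼 p Q) k) (seq (𝔼 p P) k))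
           (cong (λ z → seq c k ℚ.+ seq b k ℚ.* z) (moments (prob p) (prob q) k))) ⟩
    c + b * μ ∎
    where
    P = prob p
    Q = prob q
    affine-cong : ∀ c b {x y u v} → x ≈ y → u ≈ v → c + b * (x - u) ≈ c + b * (y - v)
    affine-cong c b (x≼y ⊣ y≼x) (u≼v ⊣ v≼u) =
      let e = *-congˡ-≈ b (+-mono-≼ x≼y (neg-anti-≼ v≼u) ⊣ +-mono-≼ y≼x (neg-anti-≼ u≼v))
      in +-mono-≼ ≼-refl (to e) ⊣ +-mono-≼ ≼-refl (from e)
    over-y₂ : ∀ x₁ x₂ y₁ → 𝔼 q (λ y₂ → c + b * excess x₁ x₂ y₁ y₂)
                         ≈ (c + b * (agree x₁ x₂ - Q x₂)) + b * (Q y₁ - agree x₁ y₁)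
    over-y₂ x₁ x₂ y₁ = begin-equality
      𝔼 q (λ y₂ → c + b * excess x₁ x₂ y₁ y₂)
        ≈⟨ 𝔼-cong q (λ y₂ → pointwise λ k →
             solve 6 (λ c b s t u v → c :+ b :* ((s :+ t) :- (u :+ v))
               := (c :+ b :* (s :- u)) :+ b :* (t :- v)) refl
               (seq c k) (seq b k) (seq (agree x₁ x₂) k) (seq (agree y₁ y₂) k)
               (seq (agree x₁ y₁) k) (seq (agree x₂ y₂) k)) ⟩
      𝔼 q (λ y₂ → c′ + b * (agree y₁ y₂ - agree x₂ y₂))   ≈⟨ 𝔼-affine q c′ b (agree y₁) (agree x₂) ⟩
      c′ + b * (𝔼 q (agree y₁) - 𝔼 q (agree x₂))          ≈⟨ affine-cong c′ b (𝔼-agree q y₁) (𝔼-agree q x₂) ⟩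
      c′ + b * (Q y₁ - Q x₂)
        ≈⟨ pointwise (λ k →
             solve 6 (λ c b s u t v → (c :+ b :* (s :- u)) :+ b :* (t :- v)
               := (c :+ b :* (s :- v)) :+ b :* (t :- u)) refl
               (seq c k) (seq b k) (seq (agree x₁ x₂) k) (seq (agree x₁ y₁) k) (seq (Q y₁) k) (seq (Q x₂) k)) ⟩
      (c + b * (agree x₁ x₂ - Q x₂)) + b * (Q y₁ - agree x₁ y₁) ∎
      where c′ = c + b * (agree x₁ x₂ - agree x₁ y₁)
    over-y₁ : ∀ x₁ x₂ → 𝔼 q (λ y₁ → (c + b * (agree x₁ x₂ - Q x₂)) + b * (Q y₁ - agree x₁ y₁))
                      ≈ (c + b * (𝔼 q Q - Q x₁)) + b * (agree x₁ x₂ - Q x₂)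
    over-y₁ x₁ x₂ = begin-equality
      𝔼 q (λ y₁ → c′ + b * (Q y₁ - agree x₁ y₁))      ≈⟨ 𝔼-affine q c′ b Q (agree x₁) ⟩
      c′ + b * (𝔼 q Q - 𝔼 q (agree x₁))               ≈⟨ affine-cong c′ b ≈-refl (𝔼-agree q x₁) ⟩
      c′ + b * (𝔼 q Q - Q x₁)
        ≈⟨ pointwise (λ k →
             solve 4 (λ c s b t → (c :+ s) :+ b :* t := (c :+ b :* t) :+ s) refl
               (seq c k) (seq (b * (agree x₁ x₂ - Q x₂)) k) (seq b k) (seq (𝔼 q Q - Q x₁) k)) ⟩
      (c + b * (𝔼 q Q - Q x₁)) + b * (agree x₁ x₂ - Q x₂) ∎
      where c′ = c + b * (agree x₁ x₂ - Q x₂)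
    over-x₂ : ∀ x₁ → 𝔼 p (λ x₂ → (c + b * (𝔼 q Q - Q x₁)) + b * (agree x₁ x₂ - Q x₂))
                   ≈ (c + b * (𝔼 q Q - 𝔼 p Q)) + b * (P x₁ - Q x₁)
    over-x₂ x₁ = begin-equality
      𝔼 p (λ x₂ → c′ + b * (agree x₁ x₂ - Q x₂))      ≈⟨ 𝔼-affine p c′ b (agree x₁) Q ⟩
      c′ + b * (𝔼 p (agree x₁) - 𝔼 p Q)               ≈⟨ affine-cong c′ b (𝔼-agree p x₁) ≈-refl ⟩
      c′ + b * (P x₁ - 𝔼 p Q)
        ≈⟨ pointwise (λ k →
             solve 6 (λ c b s u t v → (c :+ b :* (s :- u)) :+ b :* (t :- v)
               := (c :+ b :* (s :- v)) :+ b :* (t :- u)) refl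
               (seq c k) (seq b k) (seq (𝔼 q Q) k) (seq (Q x₁) k) (seq (P x₁) k) (seq (𝔼 p Q) k)) ⟩
      (c + b * (𝔼 q Q - 𝔼 p Q)) + b * (P x₁ - Q x₁) ∎
      where c′ = c + b * (𝔼 q Q - Q x₁)
    moments : ∀ {n} (u v : Vector ℝ n) k →
      (seq (∑ λ i → v i * v i) k ℚ.- seq (∑ λ i → u i * v i) k) ℚ.+
      (seq (∑ λ i → u i * u i) k ℚ.- seq (∑ λ i → u i * v i) k) ≡ seq (∑ λ i → (u i - v i) ^ 2) k
    moments {zero}  u v k = refl
    moments {suc n} u v k = trans
      (solve 5 (λ u v VV UV UU →
         ((v :* v :+ VV) :- (u :* v :+ UV)) :+ ((u :* u :+ UU) :- (u :* v :+ UV))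
         := (u :- v) :* ((u :- v) :* con 1ℚ) :+ ((VV :- UV) :+ (UU :- UV))) refl
         (seq (u zero) k) (seq (v zero) k) (seq (∑ λ i → v (suc i) * v (suc i)) k)
         (seq (∑ λ i → u (suc i) * v (suc i)) k) (seq (∑ λ i → u (suc i) * u (suc i)) k))
      (cong (seq ((u zero - v zero) ^ 2) k ℚ.+_) (moments (tail u) (tail v) k))

  0≼μ : 0ℝ ≼ μ
  0≼μ = nonneg λ i → pointwise-≼ λ k → square (seq ((p ⊖ q) i) k)
    where
    square : ∀ a → 0ℚ ℚ.≤ a ℚ.* (a ℚ.* 1ℚ)
    square a with ℚ.≤-total 0ℚ a
    ... | inj₁ 0≤a = *-nonNeg 0≤a (*-nonNeg 0≤a 0≤1)
    ... | inj₂ a≤0 = subst (0ℚ ℚ.≤_) (solve 1 (λ a → :- a :* :- a := a :* (a :* con 1ℚ)) refl a)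
      (*-nonNeg (ℚ.neg-antimono-≤ a≤0) (ℚ.neg-antimono-≤ a≤0))
    nonneg : ∀ {n} {v : Vector ℝ n} → (∀ i → 0ℝ ≼ v i) → 0ℝ ≼ ∑ v
    nonneg {zero}  h = ≼-refl
    nonneg {suc n} h = ≼-trans (pointwise-≼ λ _ → ℚ.≤-refl) (+-mono-≼ (h zero) (nonneg λ i → h (suc i)))

  -- (u - v)² = u² + v² - 2uv is at most u + v for u and v in [0, 1].
  μ≼2 : μ ≼ fromℕ 2
  μ≼2 = begin
    μ                            ≲⟨ ∑-mono bound ⟩
    ∑ (λ i → prob p i + prob q i)  ≈⟨ pointwise (∑-+ (prob p) (prob q)) ⟩
    ∑ (prob p) + ∑ (prob q)      ≲⟨ +-mono-≼ (wrap (proj₁ (total p))) (wrap (proj₁ (total q))) ⟩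
    1ℝ + 1ℝ                      ≈⟨ pointwise (λ _ → sym (ι-+ 1 1)) ⟩
    fromℕ 2                      ∎
    where
    bound : ∀ i → (p ⊖ q) i ^ 2 ≼ prob p i + prob q i
    bound i = difference (u * (1ℝ - u) + (v * (1ℝ - v) + (u * v + u * v)))
      (sum (0≼* 0≼u (0≼difference (prob≼1 p i))) (sum (0≼* 0≼v (0≼difference (prob≼1 q i)))
        (sum (0≼* 0≼u 0≼v) (0≼* 0≼u 0≼v))))
      λ k → solve 2 (λ u v → (u :- v) :* ((u :- v) :* con 1ℚ)
          :+ (u :* (con 1ℚ :- u) :+ (v :* (con 1ℚ :- v) :+ (u :* v :+ u :* v))) := u :+ v) refl (seq u k) (seq v k)
      where
      u = prob p i
      v = prob q i
      0≼u : 0ℝ ≼ u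
      0≼u = wrap (nonNeg p i)
      0≼v : 0ℝ ≼ v
      0≼v = wrap (nonNeg q i)
      sum : ∀ {x y} → 0ℝ ≼ x → 0ℝ ≼ y → 0ℝ ≼ x + y
      sum 0≼x 0≼y = ≼-trans (pointwise-≼ λ _ → ℚ.≤-refl) (+-mono-≼ 0≼x 0≼y)
    ∑-+ : ∀ {n} (u v : Vector ℝ n) k → seq (∑ λ i → u i + v i) k ≡ seq (∑ u) k ℚ.+ seq (∑ v) k
    ∑-+ {zero}  u v k = refl
    ∑-+ {suc n} u v k = trans (cong (seq (u zero) k ℚ.+ seq (v zero) k ℚ.+_) (∑-+ (tail u) (tail v) k))
      (solve 4 (λ u v U V → (u :+ v) :+ (U :+ V) := (u :+ U) :+ (v :+ V)) refl
        (seq (u zero) k) (seq (v zero) k) (seq (∑ (tail u)) k) (seq (∑ (tail v)) k))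

-- One trial as a program

out counter product factor reading one five eight εIndex εLack δIndex δLack bits : Var
out     = 0
counter = 1
product = 2
factor  = 3
reading = 4
one     = 5
five    = 6
eight   = 7
εIndex  = 8
εLack   = 9
δIndex  = 10
δLack   = 11
bits    = 12

blockSize blocks trials inside across x₁ x₂ y₁ y₂ : Var
blockSize = 13
blocks    = 14
trials    = 15
inside    = 16
across    = 17
x₁        = 18
x₂        = 19
y₁        = 20
y₂        = 21

-- Registers below 4 are scratch space of the subroutines. The others are
-- addressed by their offset in statements about a subroutine, so that the
-- comparison with a scratch register reduces even for an unknown offset.
saved offset : ℕ → Var
saved k  = 4 ℕ.+ k
offset x = x ℕ.∸ 4

-- Free of branches, so that every trial takes the same time.
count : Var → Var → Var → Program
count tally x y =
  sub product x y ∷ sub factor y x ∷ add product product factor ∷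
  sub product one product ∷ add tally tally product ∷ []

tallies : Program
tallies =
  count inside x₁ x₂ ++ count inside y₁ y₂ ++ count across x₁ y₁ ++ count across x₂ y₂ ++
  sub trials trials one ∷ []

trial : Program
trial = sampleP x₁ ∷ sampleP x₂ ∷ sampleQ y₁ ∷ sampleQ y₂ ∷ tallies

verdict : Program
verdict = sub product inside across ∷ sub out one product ∷ []

trialLoop : Program
trialLoop = while≢0 trials trial ∷ verdict

trialTime : ℕ → ℕ
trialTime r = r ℕ.* 26 ℕ.+ 3

update-same : ∀ (f : ℕ → ℕ) x a → update f x a x ≡ a
update-same f x a = cong (λ b → if b then a else f x) (≡ᵇ-refl x)
  where
  ≡ᵇ-refl : ∀ x → (x ℕ.≡ᵇ x) ≡ true
  ≡ᵇ-refl zero    = refl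
  ≡ᵇ-refl (suc x) = ≡ᵇ-refl x

update-other : ∀ (f : ℕ → ℕ) x a y → (y ℕ.≡ᵇ x) ≡ false → update f x a y ≡ f y
update-other f x a y y≢x = cong (λ b → if b then a else f y) y≢x

agreement : Memory → Var → Var → ℕ
agreement s x y = var s one ℕ.∸ ((var s x ℕ.∸ var s y) ℕ.+ (var s y ℕ.∸ var s x))

-- Deterministic execution is treated on its own, because both a bound on the
-- time and a probability carry over from the end of a run to its start.
module Runs {n} (p q : Distribution n) (δ̂ ε̂ : ℕ → ℕ) where

  open Execution p q δ̂ ε̂

  infix 4 _⟶[_]_
  data _⟶[_]_ : Config → ℕ → Config → Set where
    stay : ∀ {c} → c ⟶[ 0 ] c
    tick : ∀ {c K s c′ k c″} → step c (K , s) ≡ goto c′ → c′ ⟶[ k ] c″ → (c ∷ K , s) ⟶[ suc k ] c″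

  infixr 5 _then_
  _then_ : ∀ {c j c′ k c″} → c ⟶[ j ] c′ → c′ ⟶[ k ] c″ → c ⟶[ j ℕ.+ k ] c″
  stay     then r′ = r′
  tick e r then r′ = tick e (r then r′)

  run-halts : ∀ {c k c′ t} → c ⟶[ k ] c′ → HaltsWithin t c′ → HaltsWithin (k ℕ.+ t) c
  run-halts stay h = h
  run-halts {t = t} (tick {k = k} e r) h = subst (AllNext (HaltsWithin (k ℕ.+ t))) (sym e) (run-halts r h)

  run-Pr : ∀ {c k c′} o t → c ⟶[ k ] c′ → Pr o (k ℕ.+ t) c ≡ Pr o t c′
  run-Pr o t stay = refl
  run-Pr o t (tick {k = k} e r) = trans (cong (expect (Pr o (k ℕ.+ t))) e) (run-Pr o t r)

  enter : ∀ x b K s {v} → var s x ≡ suc v → (while≢0 x b ∷ K , s) ⟶[ 1 ] (b ++ while≢0 x b ∷ K , s)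
  enter x b K s eq = tick (cong (λ w → goto (branch w (b ++ while≢0 x b ∷ K) K , s)) eq) stay

  leave : ∀ x b K s → var s x ≡ 0 → (while≢0 x b ∷ K , s) ⟶[ 1 ] (K , s)
  leave x b K s eq = tick (cong (λ w → goto (branch w (b ++ while≢0 x b ∷ K) K , s)) eq) stay

  Unchanged : ℕ → Memory → Memory → Set
  Unchanged S s s′ = ∀ y → (y ℕ.≡ᵇ S) ≡ false → var s′ (saved y) ≡ var s (saved y)

  count-run : ∀ S x y K s → ∃ λ s′ → (count (saved S) (saved x) (saved y) ++ K , s) ⟶[ 5 ] (K , s′)
    × var s′ (saved S) ≡ var s (saved S) ℕ.+ agreement s (saved x) (saved y) × Unchanged S s s′
  count-run S x y K s = setVar (saved S) (var s₄ (saved S) ℕ.+ var s₄ product) s₄ ,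
    tick refl (tick refl (tick refl (tick refl (tick refl stay)))) ,
    update-same (var s₄) (saved S) (var s₄ (saved S) ℕ.+ var s₄ product) ,
    λ z z≢S → update-other (var s₄) (saved S) (var s₄ (saved S) ℕ.+ var s₄ product) (saved z) z≢S
    where
    s₁ s₂ s₃ s₄ : Memory
    s₁ = setVar product (var s (saved x) ℕ.∸ var s (saved y)) s
    s₂ = setVar factor (var s₁ (saved y) ℕ.∸ var s₁ (saved x)) s₁
    s₃ = setVar product (var s₂ product ℕ.+ var s₂ factor) s₂
    s₄ = setVar product (var s₃ one ℕ.∸ var s₃ product) s₃

  agreement-≡ : ∀ {s s′} x y → var s′ one ≡ var s one → var s′ x ≡ var s x → var s′ y ≡ var s y →
                agreement s′ x y ≡ agreement s x y
  agreement-≡ x y one≡ x≡ y≡ = cong₂ ℕ._∸_ one≡ (cong₂ (λ a b → (a ℕ.∸ b) ℕ.+ (b ℕ.∸ a)) x≡ y≡)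

  tallies-run : ∀ K s → ∃ λ s′ → (tallies ++ K , s) ⟶[ 21 ] (K , s′)
    × var s′ one ≡ var s one
    × var s′ trials ≡ var s trials ℕ.∸ var s one
    × var s′ inside ≡ var s inside ℕ.+ agreement s x₁ x₂ ℕ.+ agreement s y₁ y₂
    × var s′ across ≡ var s across ℕ.+ agreement s x₁ y₁ ℕ.+ agreement s x₂ y₂
  tallies-run K s =
    case count-run (offset inside) (offset x₁) (offset x₂) _ s of λ { (s₁ , r₁ , e₁ , k₁) →
    case count-run (offset inside) (offset y₁) (offset y₂) _ s₁ of λ { (s₂ , r₂ , e₂ , k₂) →
    case count-run (offset across) (offset x₁) (offset y₁) _ s₂ of λ { (s₃ , r₃ , e₃ , k₃) →
    case count-run (offset across) (offset x₂) (offset y₂) (sub trials trials one ∷ K) s₃ of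
      λ { (s₄ , r₄ , e₄ , k₄) →
    let same₂ : ∀ y → (y ℕ.≡ᵇ offset inside) ≡ false → var s₂ (saved y) ≡ var s (saved y)
        same₂ = λ y h → trans (k₂ y h) (k₁ y h)
        same₃ : ∀ y → (y ℕ.≡ᵇ offset inside) ≡ false → (y ℕ.≡ᵇ offset across) ≡ false →
                var s₃ (saved y) ≡ var s (saved y)
        same₃ = λ y h h′ → trans (k₃ y h′) (same₂ y h)
        same₄ : ∀ y → (y ℕ.≡ᵇ offset inside) ≡ false → (y ℕ.≡ᵇ offset across) ≡ false →
                var s₄ (saved y) ≡ var s (saved y)
        same₄ = λ y h h′ → trans (k₄ y h′) (same₃ y h h′)
    in setVar trials (var s₄ trials ℕ.∸ var s₄ one) s₄ ,
       (r₁ then r₂ then r₃ then r₄ then tick refl stay) ,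
       same₄ (offset one) refl refl ,
       cong₂ ℕ._∸_ (same₄ (offset trials) refl refl) (same₄ (offset one) refl refl) ,
       trans (k₄ (offset inside) refl) (trans (k₃ (offset inside) refl) (trans e₂
         (cong₂ ℕ._+_ e₁ (agreement-≡ {s} {s₁} y₁ y₂
           (k₁ (offset one) refl) (k₁ (offset y₁) refl) (k₁ (offset y₂) refl))))) ,
       trans e₄ (cong₂ ℕ._+_
         (trans e₃ (cong₂ ℕ._+_ (same₂ (offset across) refl)
           (agreement-≡ {s} {s₂} x₁ y₁
             (same₂ (offset one) refl) (same₂ (offset x₁) refl) (same₂ (offset y₁) refl))))
         (agreement-≡ {s} {s₃} x₂ y₂
           (same₃ (offset one) refl refl) (same₃ (offset x₂) refl refl) (same₃ (offset y₂) refl refl))) }}}}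

-- The trial loop

module Trials {n} (p q : Distribution n) (δ̂ ε̂ : ℕ → ℕ) where

  open Execution p q δ̂ ε̂
  open Runs p q δ̂ ε̂

  sampled : Memory → Fin n → Fin n → Fin n → Fin n → Memory
  sampled s i₁ i₂ j₁ j₂ = setVar y₂ (suc (toℕ j₂)) (setVar y₁ (suc (toℕ j₁))
    (setVar x₂ (suc (toℕ i₂)) (setVar x₁ (suc (toℕ i₁)) s)))

  trial-run : ∀ s i₁ i₂ j₁ j₂ {r X Y} →
    var s trials ≡ suc r → var s one ≡ 1 → var s inside ≡ X → var s across ≡ Y →
    ∃ λ s′ → (tallies ++ trialLoop , sampled s i₁ i₂ j₁ j₂) ⟶[ 21 ] (trialLoop , s′)
      × var s′ trials ≡ r × var s′ one ≡ 1
      × var s′ inside ≡ X ℕ.+ coincide i₁ i₂ ℕ.+ coincide j₁ j₂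
      × var s′ across ≡ Y ℕ.+ coincide i₁ j₁ ℕ.+ coincide i₂ j₂
  trial-run s i₁ i₂ j₁ j₂ {r} {X} {Y} r≡ one≡ X≡ Y≡ =
    case tallies-run trialLoop (sampled s i₁ i₂ j₁ j₂) of λ { (s′ , run , one′ , trials′ , inside′ , across′) →
    s′ , run , trans trials′ (cong₂ ℕ._∸_ r≡ one≡) , trans one′ one≡ ,
    trans inside′ (cong₂ (λ x u → x ℕ.+ (u ℕ.∸ ((toℕ i₁ ℕ.∸ toℕ i₂) ℕ.+ (toℕ i₂ ℕ.∸ toℕ i₁)))
      ℕ.+ (u ℕ.∸ ((toℕ j₁ ℕ.∸ toℕ j₂) ℕ.+ (toℕ j₂ ℕ.∸ toℕ j₁)))) X≡ one≡) ,
    trans across′ (cong₂ (λ y u → y ℕ.+ (u ℕ.∸ ((toℕ i₁ ℕ.∸ toℕ j₁) ℕ.+ (toℕ j₁ ℕ.∸ toℕ i₁)))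
      ℕ.+ (u ℕ.∸ ((toℕ i₂ ℕ.∸ toℕ j₂) ℕ.+ (toℕ j₂ ℕ.∸ toℕ i₂)))) Y≡ one≡) }

  -- Both notions compute by executing the program. As records they keep their
  -- arguments intact, so that a statement about a trial does not unfold into the
  -- memory after each of its steps.
  record Halts (t : ℕ) (c : Config) : Set where
    constructor halts
    field halting : HaltsWithin t c

  record Yields (o : Outcome) (ψ : ℝ) (t : ℕ) (c : Config) : Set where
    constructor yields
    field yielding : ψ ≼ Pr o t c

  open Halts public
  open Yields public

  sampleP-halts : ∀ {t x K s} → (∀ i → Halts t (K , setVar x (suc (toℕ i)) s)) → Halts (suc t) (sampleP x ∷ K , s)
  sampleP-halts h = halts λ i → halting (h i)

  sampleQ-halts : ∀ {t x K s} → (∀ i → Halts t (K , setVar x (suc (toℕ i)) s)) → Halts (suc t) (sampleQ x ∷ K , s)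
  sampleQ-halts h = halts λ i → halting (h i)

  sampleP-yields : ∀ {o t x K s} (f : Vector ℝ n) → (∀ i → Yields o (f i) t (K , setVar x (suc (toℕ i)) s)) →
                   Yields o (𝔼 p f) (suc t) (sampleP x ∷ K , s)
  sampleP-yields f h = yields (𝔼-mono p λ i → yielding (h i))

  sampleQ-yields : ∀ {o t x K s} (f : Vector ℝ n) → (∀ i → Yields o (f i) t (K , setVar x (suc (toℕ i)) s)) →
                   Yields o (𝔼 q f) (suc t) (sampleQ x ∷ K , s)
  sampleQ-yields f h = yields (𝔼-mono q λ i → yielding (h i))

  weaken : ∀ {o ψ ψ′ t c} → ψ ≼ ψ′ → Yields o ψ′ t c → Yields o ψ t c
  weaken ψ≼ψ′ (yields h) = yields (≼-trans ψ≼ψ′ h)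

  run-yields : ∀ {o ψ c k c′ t} → c ⟶[ k ] c′ → Yields o ψ t c′ → Yields o ψ (k ℕ.+ t) c
  run-yields {o} {ψ} {t = t} r (yields h) = yields (subst (ψ ≼_) (sym (run-Pr o t r)) h)

  run-Halts : ∀ {c k c′ t} → c ⟶[ k ] c′ → Halts t c′ → Halts (k ℕ.+ t) c
  run-Halts r (halts h) = halts (run-halts r h)

  trials-halt : ∀ r s → var s trials ≡ r → var s one ≡ 1 → Halts (trialTime r) (trialLoop , s)
  trials-halt zero s r≡ one≡ = run-Halts (leave trials trial verdict s r≡) (halts tt)
  trials-halt (suc r) s r≡ one≡ = run-Halts (enter trials trial verdict s r≡)
    (sampleP-halts λ i₁ → sampleP-halts λ i₂ → sampleQ-halts λ j₁ → sampleQ-halts λ j₂ →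
      case trial-run s i₁ i₂ j₁ j₂ r≡ one≡ refl refl of λ { (s′ , run , r′ , one′ , _) →
        run-Halts run (trials-halt r s′ r′ one′) })

  after : (ℕ → ℕ → ℚ) → ℕ → ℕ → Fin n → Fin n → Fin n → Fin n → ℝ
  after v X Y i₁ i₂ j₁ j₂ = fromℚ (v (X ℕ.+ coincide i₁ i₂ ℕ.+ coincide j₁ j₂)
                                     (Y ℕ.+ coincide i₁ j₁ ℕ.+ coincide i₂ j₂))

  -- By induction over the remaining trials, gʳ v is a bound on the probability of a
  -- wrong verdict if a trial multiplies v by at most g on average (drift) and v
  -- bounds the indicator of a wrong verdict at the end (final).
  module Potential (o : Outcome) (v : ℕ → ℕ → ℚ) (g : ℚ) (0≤g : 0ℚ ℚ.≤ g)
    (final : ∀ X Y s → var s out ≡ 1 ℕ.∸ (X ℕ.∸ Y) → 1ℝ - fromℚ (v X Y) ≼ indicator o (outcome s))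
    (drift : ∀ X Y → 𝔼⁴ p q (after v X Y) ≼ fromℚ (g ℚ.* v X Y)) where

    trials-succeed : ∀ r s X Y → var s trials ≡ r → var s one ≡ 1 → var s inside ≡ X → var s across ≡ Y →
                     Yields o (1ℝ - fromℚ (g ^ℚ r ℚ.* v X Y)) (trialTime r) (trialLoop , s)
    trials-succeed zero s X Y r≡ one≡ X≡ Y≡ = run-yields (leave trials trial verdict s r≡)
      (weaken (pointwise-≼ λ _ → ℚ.≤-reflexive (cong (λ z → 1ℚ ℚ.- z) (ℚ.*-identityˡ (v X Y))))
        (yields (final X Y s″ (cong₂ ℕ._∸_ one≡ (cong₂ ℕ._∸_ X≡ Y≡)))))
      where
      s′ s″ : Memory
      s′ = setVar product (var s inside ℕ.∸ var s across) s
      s″ = setVar out (var s′ one ℕ.∸ var s′ product) s′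
    trials-succeed (suc r) s X Y r≡ one≡ X≡ Y≡ = run-yields (enter trials trial verdict s r≡)
      (weaken average
        (sampleP-yields (λ i₁ → 𝔼 p λ i₂ → 𝔼 q λ j₁ → 𝔼 q (f i₁ i₂ j₁)) λ i₁ →
         sampleP-yields (λ i₂ → 𝔼 q λ j₁ → 𝔼 q (f i₁ i₂ j₁)) λ i₂ →
         sampleQ-yields (λ j₁ → 𝔼 q (f i₁ i₂ j₁)) λ j₁ →
         sampleQ-yields (f i₁ i₂ j₁) λ j₂ →
         case trial-run s i₁ i₂ j₁ j₂ r≡ one≡ X≡ Y≡ of
           λ { (s′ , run , r′ , one′ , X″ , Y″) → run-yields run
             (weaken (pointwise-≼ λ _ → ℚ.≤-refl)
               (trials-succeed r s′ _ _ r′ one′ X″ Y″)) }))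
      where
      c : ℝ
      c = fromℚ (g ^ℚ r)
      0≼c : 0ℝ ≼ c
      0≼c = pointwise-≼ λ _ → ^-nonNeg r 0≤g
      complement-anti : ∀ {x y} → x ≼ y → 1ℝ - y ≼ 1ℝ - x
      complement-anti {x} {y} h = +-mono-≼ {1ℝ} {1ℝ} { - y} { - x} ≼-refl (neg-anti-≼ h)
      f : Fin n → Fin n → Fin n → Fin n → ℝ
      f i₁ i₂ j₁ j₂ = 1ℝ - c * after v X Y i₁ i₂ j₁ j₂
      average : 1ℝ - fromℚ (g ^ℚ suc r ℚ.* v X Y) ≼ 𝔼⁴ p q (λ i₁ i₂ j₁ j₂ → 1ℝ - c * after v X Y i₁ i₂ j₁ j₂)
      average =
        ≼-trans {_} {1ℝ - c * 𝔼⁴ p q (after v X Y)}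
          (≼-trans {_} {1ℝ - c * fromℚ (g ℚ.* v X Y)}
            (pointwise-≼ λ _ → ℚ.≤-reflexive (cong (λ z → 1ℚ ℚ.- z)
              (solve 3 (λ a b c → (a :* b) :* c := b :* (a :* c)) refl g (g ^ℚ r) (v X Y))))
            (complement-anti {c * 𝔼⁴ p q (after v X Y)} {c * fromℚ (g ℚ.* v X Y)}
              (*-monoˡ-≼ {𝔼⁴ p q (after v X Y)} {fromℚ (g ℚ.* v X Y)} c 0≼c (drift X Y))))
          (from (𝔼⁴-complement p q c (after v X Y)))

-- Error probability of the trials

module Errors {n} (p q : Distribution n) (δ̂ ε̂ : ℕ → ℕ)
              (D : ℕ) (η : ℚ) (0≤η : 0ℚ ℚ.≤ η) (η≤ : η ℚ.≤ 1 /suc 199) (Dη≡ : ι D ℚ.* η ≡ 1 /suc 7) where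

  open Execution p q δ̂ ε̂
  open Trials p q δ̂ ε̂
  open Block D η 0≤η η≤ Dη≡

  private
    -- The part of weight-bound that is independent of the outcome of the trial.
    base : ℚ → ℚ
    base w = w ℚ.* (1ℚ ℚ.+ ι 3 ℚ.* (η ℚ.* η))

  weight-after : ∀ X Y a b c d → a ℕ.≤ 1 → b ℕ.≤ 1 → c ℕ.≤ 1 → d ℕ.≤ 1 →
    let w = weight η X Y in
    weight η (X ℕ.+ a ℕ.+ b) (Y ℕ.+ c ℕ.+ d) ℚ.≤ base w ℚ.+ (w ℚ.* η) ℚ.* ((ι a ℚ.+ ι b) ℚ.- (ι c ℚ.+ ι d))
  weight-after X Y a b c d a≤1 b≤1 c≤1 d≤1 = ℚ.≤-trans
    (ℚ.≤-reflexive (trans (cong₂ (weight η) (ℕ.+-assoc X a b) (ℕ.+-assoc Y c d))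
      (weight-+ η X (a ℕ.+ b) Y (c ℕ.+ d))))
    (ℚ.≤-trans (*-monoʳ {weight η (a ℕ.+ b) (c ℕ.+ d)} (weight-nonNeg 0≤η η≤1 X Y)
      (weight-bound 0≤η η≤1 (a ℕ.+ b) (c ℕ.+ d) (ℕ.+-mono-≤ a≤1 b≤1) (ℕ.+-mono-≤ c≤1 d≤1)))
    (ℚ.≤-reflexive (trans
      (cong₂ (λ x y → w ℚ.* ((1ℚ ℚ.+ ι 3 ℚ.* (η ℚ.* η)) ℚ.+ η ℚ.* (x ℚ.- y))) (ι-+ a b) (ι-+ c d))
      (solve 4 (λ w k η z → w :* (k :+ η :* z) := w :* k :+ (w :* η) :* z) refl
        w (1ℚ ℚ.+ ι 3 ℚ.* (η ℚ.* η)) η ((ι a ℚ.+ ι b) ℚ.- (ι c ℚ.+ ι d))))))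
    where w = weight η X Y

  -- The mean of Z enters the bound of weight-after linearly.
  drift-up : ∀ X Y → μ p q ≼ fromℚ (ι 200 ℚ.* η) →
             𝔼⁴ p q (after (weight η) X Y) ≼ fromℚ (growth η 203 ℚ.* weight η X Y)
  drift-up X Y μ≼ =
    ≼-trans {_} {c + b * μ p q} (≼-trans {_} {𝔼⁴ p q (λ i₁ i₂ j₁ j₂ → c + b * excess p q i₁ i₂ j₁ j₂)}
      (𝔼⁴-mono p q {after (weight η) X Y} {λ i₁ i₂ j₁ j₂ → c + b * excess p q i₁ i₂ j₁ j₂}
        λ i₁ i₂ j₁ j₂ → pointwise-≼ λ _ →
          weight-after X Y (coincide i₁ i₂) (coincide j₁ j₂) (coincide i₁ j₁) (coincide i₂ j₂)
            (coincide≤1 i₁ i₂) (coincide≤1 j₁ j₂) (coincide≤1 i₁ j₁) (coincide≤1 i₂ j₂))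
      (to (𝔼⁴-excess p q c b)))
      (≼-trans {_} {c + b * fromℚ (ι 200 ℚ.* η)}
        (+-mono-≼ {c} {c} {b * μ p q} {b * fromℚ (ι 200 ℚ.* η)} ≼-refl (*-monoˡ-≼ {μ p q} b 0≼b μ≼))
        (pointwise-≼ λ _ → ℚ.≤-reflexive (solve 2 (λ w η →
          w :* (con 1ℚ :+ con (ι 3) :* (η :* η)) :+ (w :* η) :* (con (ι 200) :* η)
          := (con 1ℚ :+ con (ι 203) :* (η :* η)) :* w) refl w η)))
    where
    w = weight η X Y
    b c : ℝ
    b = fromℚ (w ℚ.* η)
    c = fromℚ (base w)
    0≼b : 0ℝ ≼ b
    0≼b = fromℚ-mono (*-nonNeg (weight-nonNeg 0≤η η≤1 X Y) 0≤η)

  drift-down : ∀ X Y → fromℚ (ι 392 ℚ.* η) ≼ μ p q →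
               𝔼⁴ p q (after (λ x y → weight η y x) X Y) ≼ fromℚ (decay η 389 ℚ.* weight η Y X)
  drift-down X Y ≼μ =
    ≼-trans {_} {c + (- b) * μ p q} (≼-trans {_} {𝔼⁴ p q (λ i₁ i₂ j₁ j₂ → c + (- b) * excess p q i₁ i₂ j₁ j₂)}
      (𝔼⁴-mono p q {after (λ x y → weight η y x) X Y} {λ i₁ i₂ j₁ j₂ → c + (- b) * excess p q i₁ i₂ j₁ j₂}
        λ i₁ i₂ j₁ j₂ → pointwise-≼ λ _ → ℚ.≤-trans
          (weight-after Y X (coincide i₁ j₁) (coincide i₂ j₂) (coincide i₁ i₂) (coincide j₁ j₂)
            (coincide≤1 i₁ j₁) (coincide≤1 i₂ j₂) (coincide≤1 i₁ i₂) (coincide≤1 j₁ j₂))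
          (ℚ.≤-reflexive (solve 4 (λ c b x y → c :+ b :* (x :- y) := c :+ (:- b) :* (y :- x)) refl
            (base w) (w ℚ.* η) (ι (coincide i₁ j₁) ℚ.+ ι (coincide i₂ j₂))
            (ι (coincide i₁ i₂) ℚ.+ ι (coincide j₁ j₂)))))
      (to (𝔼⁴-excess p q c (- b))))
      (difference (b * (μ p q - fromℚ (ι 392 ℚ.* η)))
        (0≼* {b} {μ p q - fromℚ (ι 392 ℚ.* η)} 0≼b (0≼difference {fromℚ (ι 392 ℚ.* η)} {μ p q} ≼μ)) λ k →
        solve 3 (λ w η m →
          (w :* (con 1ℚ :+ con (ι 3) :* (η :* η)) :+ (:- (w :* η)) :* m) :+ (w :* η) :* (m :- con (ι 392) :* η)
          := (con 1ℚ :- con (ι 389) :* (η :* η)) :* w) refl w η (seq (μ p q) k))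
    where
    w = weight η Y X
    b c : ℝ
    b = fromℚ (w ℚ.* η)
    c = fromℚ (base w)
    0≼b : 0ℝ ≼ b
    0≼b = fromℚ-mono (*-nonNeg (weight-nonNeg 0≤η η≤1 Y X) 0≤η)

  accepting : ∀ s {k} → var s out ≡ suc k → outcome s ≡ accept
  accepting s eq with var s 0
  accepting s () | zero
  ... | suc _ = refl

  rejecting : ∀ s → var s out ≡ 0 → outcome s ≡ reject
  rejecting s eq with var s 0
  ... | zero = refl
  rejecting s () | suc _

  accepted : ∀ X Y s → var s out ≡ 1 ℕ.∸ (X ℕ.∸ Y) → X ℕ.≤ Y → outcome s ≡ accept
  accepted X Y s eq X≤Y = accepting s (trans eq (cong (1 ℕ.∸_) (ℕ.m≤n⇒m∸n≡0 X≤Y)))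

  rejected : ∀ X Y s → var s out ≡ 1 ℕ.∸ (X ℕ.∸ Y) → Y ℕ.< X → outcome s ≡ reject
  rejected X Y s eq Y<X = rejecting s (trans eq (ℕ.m≤n⇒m∸n≡0 (ℕ.m<n⇒0<n∸m Y<X)))

  verdict-bound : ∀ o o′ v → 0ℚ ℚ.≤ v → (o′ ≢ o → 1ℚ ℚ.≤ v) → 1ℝ - fromℚ v ≼ indicator o o′
  verdict-bound o o′ v 0≤v 1≤v = bound o o′ 1≤v
    where
    right : 1ℝ - fromℚ v ≼ 1ℝ
    right = pointwise-≼ λ _ → surplus v 0≤v (solve 1 (λ v → (con 1ℚ :- v) :+ v := con 1ℚ) refl v)
    wrong : 1ℚ ℚ.≤ v → 1ℝ - fromℚ v ≼ 0ℝ
    wrong 1≤v = pointwise-≼ λ _ → subst (1ℚ ℚ.- v ℚ.≤_) (ℚ.+-inverseʳ v) (ℚ.+-monoˡ-≤ (ℚ.- v) 1≤v)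
    bound : ∀ o o′ → (o′ ≢ o → 1ℚ ℚ.≤ v) → 1ℝ - fromℚ v ≼ indicator o o′
    bound accept accept 1≤v = right
    bound accept reject 1≤v = wrong (1≤v λ ())
    bound reject accept 1≤v = wrong (1≤v λ ())
    bound reject reject 1≤v = right

  final-accept : ∀ X Y s → var s out ≡ 1 ℕ.∸ (X ℕ.∸ Y) → 1ℝ - fromℚ (weight η X Y) ≼ indicator accept (outcome s)
  final-accept X Y s eq = verdict-bound accept (outcome s) (weight η X Y) (weight-nonNeg 0≤η η≤1 X Y)
    λ wrong → 1≤weight 0≤η η≤1 X Y (ℕ.<⇒≤ (ℕ.≰⇒> λ X≤Y → wrong (accepted X Y s eq X≤Y)))

  final-reject : ∀ X Y s → var s out ≡ 1 ℕ.∸ (X ℕ.∸ Y) → 1ℝ - fromℚ (weight η Y X) ≼ indicator reject (outcome s)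
  final-reject X Y s eq = verdict-bound reject (outcome s) (weight η Y X) (weight-nonNeg 0≤η η≤1 Y X)
    λ wrong → 1≤weight 0≤η η≤1 Y X (ℕ.≮⇒≥ λ Y<X → wrong (rejected X Y s eq Y<X))

  module _ (L : ℕ) (s : Memory) (trials≡ : var s trials ≡ D ℕ.* ((8 ℕ.* D) ℕ.* L)) (one≡ : var s one ≡ 1)
           (inside≡ : var s inside ≡ 0) (across≡ : var s across ≡ 32 ℕ.* ((8 ℕ.* D) ℕ.* L)) where

    private
      1-mono : ∀ {u v} → u ℚ.≤ v → 1ℝ - fromℚ v ≼ 1ℝ - fromℚ u
      1-mono u≤v = pointwise-≼ λ _ → ℚ.+-monoʳ-≤ 1ℚ (ℚ.neg-antimono-≤ u≤v)

    accepts-close : μ p q ≼ fromℚ (ι 200 ℚ.* η) →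
                    Yields accept (1ℝ - fromℚ (½ ^ℚ L)) (trialTime (D ℕ.* ((8 ℕ.* D) ℕ.* L))) (trialLoop , s)
    accepts-close μ≼ = weaken (1-mono (rising-potential L))
      (Potential.trials-succeed accept (weight η) (growth η 203) (0≤growth 203) final-accept
        (λ X Y → drift-up X Y μ≼) (D ℕ.* ((8 ℕ.* D) ℕ.* L)) s 0 (32 ℕ.* ((8 ℕ.* D) ℕ.* L))
        trials≡ one≡ inside≡ across≡)

    rejects-far : fromℚ (ι 392 ℚ.* η) ≼ μ p q →
                  Yields reject (1ℝ - fromℚ (½ ^ℚ L)) (trialTime (D ℕ.* ((8 ℕ.* D) ℕ.* L))) (trialLoop , s)
    rejects-far ≼μ = weaken (1-mono (falling-potential L))
      (Potential.trials-succeed reject (λ X Y → weight η Y X) (decay η 389) (0≤decay 389 (ℕ.m≤m+n 389 _))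
        final-reject
        (λ X Y → drift-down X Y ≼μ) (D ℕ.* ((8 ℕ.* D) ℕ.* L)) s 0 (32 ℕ.* ((8 ℕ.* D) ℕ.* L))
        trials≡ one≡ inside≡ across≡)

-- The program and its deterministic part

multiplyLoop : Cmd
multiplyLoop = while≢0 counter (add product product factor ∷ sub counter counter one ∷ [])

-- Repeated addition: the product of x and y takes a time proportional to y.
multiply : Var → Var → Program
multiply x y =
  const factor 0 ∷ add factor factor x ∷ const counter 0 ∷ add counter counter y ∷
  const product 0 ∷ multiplyLoop ∷ []

multiplyTime : ℕ → ℕ
multiplyTime i = 5 ℕ.+ (i ℕ.* 3 ℕ.+ 1)

doublings : ℕ → Var → Program
doublings k x = replicate k (add x x x)

-- A linear search is fast enough, since it stops at an index of the order of 1/ε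
-- and the time may be of the order of ε⁻⁴.
εSearch : Cmd
εSearch = while≢0 εLack (add εIndex εIndex one ∷ readε reading εIndex ∷ sub εLack eight reading ∷ [])

-- Here the time may only be logarithmic in 1/δ, so the precision doubles.
δSearch : Cmd
δSearch = while≢0 δLack
  (add bits bits one ∷ add δIndex δIndex δIndex ∷ add δIndex δIndex one ∷
   readδ reading δIndex ∷ sub δLack five reading ∷ [])

-- With N = k + 1 and L bits: D = N², R = 8DL, DR trials, and a head start of 32R
-- for the agreements between the samples.
prepare : Program
prepare =
  add εIndex εIndex one ∷
  multiply εIndex εIndex ++ const blockSize 0 ∷ add blockSize blockSize product ∷
  multiply blockSize bits ++ const blocks 0 ∷ add blocks blocks product ∷
  doublings 3 blocks ++
  multiply blocks blockSize ++ const trials 0 ∷ add trials trials product ∷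
  const across 0 ∷ add across across blocks ∷ doublings 5 across ++
  const inside 0 ∷ []

prepareTime : ℕ → ℕ → ℕ
prepareTime N L =
  1 ℕ.+ (multiplyTime N ℕ.+ (2 ℕ.+ (multiplyTime L ℕ.+ (2 ℕ.+ (3 ℕ.+
    (multiplyTime (N ℕ.* N) ℕ.+ (4 ℕ.+ (5 ℕ.+ 1))))))))

main : Program
main = εSearch ∷ const bits 1 ∷ δSearch ∷ prepare ++ trialLoop

-- A reading of at least 5 with denominator 8 certifies δ ≥ 1/2.
precise : Program
precise =
  const δIndex 7 ∷ readδ reading δIndex ∷ sub δLack five reading ∷
  if≢0 δLack main (flip out ∷ []) ∷ []

-- A reading of at least 8 with denominator 4 certifies ε ≥ 7/4 > √2.
tester : Program
tester =
  const one 1 ∷ const five 5 ∷ const eight 8 ∷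
  const εIndex 3 ∷ readε reading εIndex ∷ sub εLack eight reading ∷
  if≢0 εLack precise (const out 1 ∷ []) ∷ []

-- The index of the reading of δ with denominator 4 · 2ˡ.
δPrecision : ℕ → ℕ
δPrecision zero    = 3
δPrecision (suc l) = δPrecision l ℕ.+ δPrecision l ℕ.+ 1

-- The trace of a search from k that makes e iterations before h vanishes.
data FirstZero (h : ℕ → ℕ) : ℕ → ℕ → Set where
  found : ∀ {k} → h k ≡ 0 → FirstZero h k 0
  next  : ∀ {k e v} → h k ≡ suc v → FirstZero h (suc k) e → FirstZero h k (suc e)

firstZero : ∀ h k m → h (m ℕ.+ k) ≡ 0 → ∃ (FirstZero h k)
firstZero h k zero    hm≡0 = 0 , found hm≡0
firstZero h k (suc m) hm≡0 with h k in eq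
... | zero  = 0 , found eq
... | suc _ =
  let e , search = firstZero h (suc k) m (trans (cong h (ℕ.+-suc m k)) hm≡0)
  in suc e , next eq search

at-zero : ∀ {h k e} → FirstZero h k e → h (e ℕ.+ k) ≡ 0
at-zero (found eq) = eq
at-zero {h} {k} {suc e} (next _ search) = trans (cong h (sym (ℕ.+-suc e k))) (at-zero search)

before-zero : ∀ {h k e} → FirstZero h k (suc e) → h (e ℕ.+ k) ≢ 0
before-zero {e = zero}      (next eq _)     hk≡0 = contradiction (trans (sym eq) hk≡0) λ ()
before-zero {h} {k} {suc e} (next _ search) hk≡0 = before-zero search (trans (cong h (ℕ.+-suc e k)) hk≡0)

module Setup {n} (p q : Distribution n) (δ̂ ε̂ : ℕ → ℕ) where

  open Execution p q δ̂ ε̂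
  open Runs p q δ̂ ε̂

  multiplyLoop-run : ∀ i K s → var s one ≡ 1 → var s counter ≡ i →
    ∃ λ s′ → (multiplyLoop ∷ K , s) ⟶[ i ℕ.* 3 ℕ.+ 1 ] (K , s′)
      × var s′ product ≡ var s product ℕ.+ i ℕ.* var s factor
      × (∀ y → var s′ (saved y) ≡ var s (saved y))
  multiplyLoop-run zero K s one≡ i≡ =
    s , leave counter _ K s i≡ , sym (ℕ.+-identityʳ (var s product)) , λ _ → refl
  multiplyLoop-run (suc i) K s one≡ i≡ =
    case multiplyLoop-run i K s₂ one≡ (cong₂ ℕ._∸_ i≡ one≡) of λ { (s′ , run , product′ , kept) →
    s′ , (enter counter _ K s i≡ then tick refl (tick refl run)) ,
    trans product′ (ℕ.+-assoc (var s product) (var s factor) (i ℕ.* var s factor)) , kept }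
    where
    s₁ s₂ : Memory
    s₁ = setVar product (var s product ℕ.+ var s factor) s
    s₂ = setVar counter (var s₁ counter ℕ.∸ var s₁ one) s₁

  multiply-run : ∀ x y K s {a i} → var s one ≡ 1 → var s (saved x) ≡ a → var s (saved y) ≡ i →
    ∃ λ s′ → (multiply (saved x) (saved y) ++ K , s) ⟶[ multiplyTime i ] (K , s′)
      × var s′ product ≡ i ℕ.* a
      × (∀ y → var s′ (saved y) ≡ var s (saved y))
  multiply-run x y K s {a} {i} one≡ a≡ i≡ =
    case multiplyLoop-run i K s₃ one≡ i≡ of λ { (s′ , run , product′ , kept) →
    s′ , tick refl (tick refl (tick refl (tick refl (tick refl run)))) ,
    trans product′ (cong (i ℕ.*_) a≡) , kept }
    where
    s₁ s₂ s₃ : Memory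
    s₁ = setVar factor (0 ℕ.+ var s (saved x)) (setVar factor 0 s)
    s₂ = setVar counter (0 ℕ.+ var s₁ (saved y)) (setVar counter 0 s₁)
    s₃ = setVar product 0 s₂

  doublings-run : ∀ k x K s → ∃ λ s′ → (doublings k (saved x) ++ K , s) ⟶[ k ] (K , s′)
    × var s′ (saved x) ≡ 2 ℕ.^ k ℕ.* var s (saved x) × Unchanged x s s′
  doublings-run zero x K s = s , stay , sym (ℕ.*-identityˡ (var s (saved x))) , λ _ _ → refl
  doublings-run (suc k) x K s =
    case doublings-run k x K s₁ of λ { (s′ , run , x′ , kept) →
    s′ , tick refl run ,
    trans x′ (trans (cong (2 ℕ.^ k ℕ.*_) (update-same (var s) (saved x) (v ℕ.+ v)))
      (trans (cong (λ z → 2 ℕ.^ k ℕ.* (v ℕ.+ z)) (sym (ℕ.+-identityʳ v)))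
        (trans (sym (ℕ.*-assoc (2 ℕ.^ k) 2 v)) (cong (ℕ._* v) (ℕ.*-comm (2 ℕ.^ k) 2))))) ,
    λ y y≢x → trans (kept y y≢x) (update-other (var s) (saved x) (v ℕ.+ v) (saved y) y≢x) }
    where
    v = var s (saved x)
    s₁ : Memory
    s₁ = setVar (saved x) (v ℕ.+ v) s

  εSearch-run : ∀ {k e} K s → FirstZero (λ i → 8 ℕ.∸ ε̂ i) k e →
    var s one ≡ 1 → var s eight ≡ 8 → var s εIndex ≡ k → var s εLack ≡ 8 ℕ.∸ ε̂ k →
    ∃ λ s′ → (εSearch ∷ K , s) ⟶[ e ℕ.* 4 ℕ.+ 1 ] (K , s′)
      × var s′ εIndex ≡ e ℕ.+ k × var s′ one ≡ 1
      × var s′ five ≡ var s five × var s′ δIndex ≡ var s δIndex × var s′ δLack ≡ var s δLack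
  εSearch-run K s (found h≡) one≡ eight≡ k≡ lack≡ =
    s , leave εLack _ K s (trans lack≡ h≡) , k≡ , one≡ , refl , refl , refl
  εSearch-run {k} {suc e} K s (next h≡ search) one≡ eight≡ k≡ lack≡ =
    case εSearch-run K s₃ search one≡ eight≡ suc-k≡ (cong₂ (λ a b → a ℕ.∸ ε̂ b) eight≡ suc-k≡) of
    λ { (s′ , run , k′ , kept) →
    s′ , (enter εLack _ K s (trans lack≡ h≡) then tick refl (tick refl (tick refl run))) ,
    trans k′ (ℕ.+-suc e k) , kept }
    where
    s₁ s₂ s₃ : Memory
    s₁ = setVar εIndex (var s εIndex ℕ.+ var s one) s
    s₂ = setVar reading (ε̂ (var s₁ εIndex)) s₁
    s₃ = setVar εLack (var s₂ eight ℕ.∸ var s₂ reading) s₂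
    suc-k≡ : var s εIndex ℕ.+ var s one ≡ suc k
    suc-k≡ = trans (cong₂ ℕ._+_ k≡ one≡) (ℕ.+-comm k 1)

  δSearch-run : ∀ {l e} K s → FirstZero (λ i → 5 ℕ.∸ δ̂ (δPrecision i)) l e →
    var s one ≡ 1 → var s five ≡ 5 → var s bits ≡ l → var s δIndex ≡ δPrecision l →
    var s δLack ≡ 5 ℕ.∸ δ̂ (δPrecision l) →
    ∃ λ s′ → (δSearch ∷ K , s) ⟶[ e ℕ.* 6 ℕ.+ 1 ] (K , s′)
      × var s′ bits ≡ e ℕ.+ l × var s′ one ≡ 1 × var s′ εIndex ≡ var s εIndex
  δSearch-run K s (found h≡) one≡ five≡ l≡ index≡ lack≡ =
    s , leave δLack _ K s (trans lack≡ h≡) , l≡ , one≡ , refl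
  δSearch-run {l} {suc e} K s (next h≡ search) one≡ five≡ l≡ index≡ lack≡ =
    case δSearch-run K s₅ search one≡ five≡ (trans (cong₂ ℕ._+_ l≡ one≡) (ℕ.+-comm l 1)) index′
      (cong₂ (λ a b → a ℕ.∸ δ̂ b) five≡ index′) of
    λ { (s′ , run , l′ , kept) →
    s′ , (enter δLack _ K s (trans lack≡ h≡) then
      tick refl (tick refl (tick refl (tick refl (tick refl run))))) ,
    trans l′ (ℕ.+-suc e l) , kept }
    where
    s₁ s₂ s₃ s₄ s₅ : Memory
    s₁ = setVar bits (var s bits ℕ.+ var s one) s
    s₂ = setVar δIndex (var s₁ δIndex ℕ.+ var s₁ δIndex) s₁
    s₃ = setVar δIndex (var s₂ δIndex ℕ.+ var s₂ one) s₂
    s₄ = setVar reading (δ̂ (var s₃ δIndex)) s₃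
    s₅ = setVar δLack (var s₄ five ℕ.∸ var s₄ reading) s₄
    index′ : var s δIndex ℕ.+ var s δIndex ℕ.+ var s one ≡ δPrecision (suc l)
    index′ = cong₂ (λ y u → y ℕ.+ y ℕ.+ u) index≡ one≡

  prepare-run : ∀ {k L} K s → var s one ≡ 1 → var s εIndex ≡ k → var s bits ≡ L →
    let N = suc k; D = N ℕ.* N; R = (8 ℕ.* D) ℕ.* L in
    ∃ λ s′ → (prepare ++ K , s) ⟶[ prepareTime N L ] (K , s′)
      × var s′ trials ≡ D ℕ.* R × var s′ one ≡ 1 × var s′ inside ≡ 0 × var s′ across ≡ 32 ℕ.* R
  prepare-run {k} {L} K s one≡ k≡ L≡ =
    case multiply-run (offset εIndex) (offset εIndex) K₁ s₁ one≡ N≡ N≡ of λ { (s₂ , run₂ , D≡ , kept₂) →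
    let s₃ = setVar blockSize (0 ℕ.+ var s₂ product) (setVar blockSize 0 s₂) in
    case multiply-run (offset blockSize) (offset bits) K₃ s₃ (trans (kept₂ (offset one)) one≡) D≡
           (trans (kept₂ (offset bits)) L≡) of λ { (s₄ , run₄ , LD≡ , kept₄) →
    let s₅ = setVar blocks (0 ℕ.+ var s₄ product) (setVar blocks 0 s₄) in
    case doublings-run 3 (offset blocks) K₅ s₅ of λ { (s₆ , run₆ , R≡ , kept₆) →
    let R≡′ : var s₆ blocks ≡ (8 ℕ.* D) ℕ.* L
        R≡′ = trans R≡ (trans (cong (8 ℕ.*_) LD≡)
                (trans (cong (8 ℕ.*_) (ℕ.*-comm L D)) (sym (ℕ.*-assoc 8 D L))))
        one₆ : var s₆ one ≡ 1
        one₆ = trans (kept₆ (offset one) refl) (trans (kept₄ (offset one)) (trans (kept₂ (offset one)) one≡))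
        D≡′ : var s₆ blockSize ≡ D
        D≡′ = trans (kept₆ (offset blockSize) refl) (trans (kept₄ (offset blockSize)) D≡)
    in
    case multiply-run (offset blocks) (offset blockSize) K₆ s₆ one₆ R≡′ D≡′ of λ { (s₇ , run₇ , M≡ , kept₇) →
    let s₈ = setVar across (0 ℕ.+ var s₇ blocks) (setVar across 0
               (setVar trials (0 ℕ.+ var s₇ product) (setVar trials 0 s₇))) in
    case doublings-run 5 (offset across) K₈ s₈ of λ { (s₉ , run₉ , across≡ , kept₉) →
    setVar inside 0 s₉ ,
    tick refl (run₂ then tick refl (tick refl (run₄ then tick refl (tick refl (run₆ then
      run₇ then tick refl (tick refl (tick refl (tick refl (run₉ then tick refl stay))))))))) ,
    trans (kept₉ (offset trials) refl) M≡ ,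
    trans (kept₉ (offset one) refl) (trans (kept₇ (offset one)) one₆) ,
    refl ,
    trans across≡ (cong (32 ℕ.*_) (trans (kept₇ (offset blocks)) R≡′)) }}}}}
    where
    N D : ℕ
    N = suc k
    D = N ℕ.* N
    K₈ K₆ K₅ K₃ K₁ : Program
    K₈ = const inside 0 ∷ K
    K₆ = const trials 0 ∷ add trials trials product ∷
         const across 0 ∷ add across across blocks ∷ doublings 5 across ++ K₈
    K₅ = multiply blocks blockSize ++ K₆
    K₃ = const blocks 0 ∷ add blocks blocks product ∷ doublings 3 blocks ++ K₅
    K₁ = const blockSize 0 ∷ add blockSize blockSize product ∷ multiply blockSize bits ++ K₃
    s₁ : Memory
    s₁ = setVar εIndex (var s εIndex ℕ.+ var s one) s
    N≡ : var s εIndex ℕ.+ var s one ≡ N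
    N≡ = trans (cong₂ ℕ._+_ k≡ one≡) (ℕ.+-comm k 1)

-- What the readings of ε and δ say

reading-≥ : ∀ f x → Approximates f x → ∀ k c → suc c ℕ.≤ f k → fromℕ c ≼ fromℕ (suc k) * x
reading-≥ f x f≈x k c c<fk = difference {fromℕ c} {fromℕ (suc k) * x}
  ((fromℕ (suc k) * x + 1ℝ) - fromℕ (suc c))
  (0≼difference {fromℕ (suc c)}
    (≼-trans {_} {fromℕ (f k)} (fromℕ-mono {suc c} {f k} c<fk) (approximation-≤ {f} {x} f≈x k)))
  λ n → trans (cong (λ z → ι c ℚ.+ ((ι (suc k) ℚ.* seq x n ℚ.+ 1ℚ) ℚ.- z)) (ι-+ 1 c))
    (solve 2 (λ c y → c :+ ((y :+ con 1ℚ) :- (con 1ℚ :+ c)) := y) refl (ι c) (ι (suc k) ℚ.* seq x n))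

reading-< : ∀ f x → Approximates f x → ∀ k c → f k ℕ.< c → fromℕ (suc k) * x ≼ fromℕ c
reading-< f x f≈x k c fk<c =
  ≼-trans {_} {fromℕ (suc (f k))} (approximation-≥ {f} {x} f≈x k) (fromℕ-mono {suc (f k)} {c} fk<c)

readings-grow : ∀ f x → Approximates f x → 0ℝ < x → ∀ c → ∃ λ K → ∀ k → K ℕ.≤ k → c ℕ.≤ f k
readings-grow f x f≈x 0<x c =
  let k₀ , 1≼ = positive⇒large {x} 0<x
  in suc c ℕ.* suc k₀ , λ k K≤k → ℕ.s≤s⁻¹ (fromℕ-cancel {suc c} {suc (f k)}
    (≼-trans {_} {fromℕ (suc c) * (fromℕ (suc k₀) * x)}
      (≼-trans {_} {fromℕ (suc c) * 1ℝ} (pointwise-≼ λ _ → ℚ.≤-reflexive (sym (ℚ.*-identityʳ (ι (suc c)))))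
        (*-monoˡ-≼ {1ℝ} {fromℕ (suc k₀) * x} (fromℕ (suc c)) (0≼fromℕ (suc c)) 1≼))
      (≼-trans {_} {fromℕ (suc k) * x}
        (≼-trans {_} {x * fromℕ (suc c ℕ.* suc k₀)}
          (pointwise-≼ λ n → ℚ.≤-reflexive (trans
            (solve 3 (λ a b x → a :* (b :* x) := x :* (a :* b)) refl (ι (suc c)) (ι (suc k₀)) (seq x n))
            (cong (seq x n ℚ.*_) (sym (ι-* (suc c) (suc k₀))))))
          (≼-trans {_} {x * fromℕ (suc k)}
            (*-monoˡ-≼ {fromℕ (suc c ℕ.* suc k₀)} {fromℕ (suc k)} x (<⇒≼ 0<x)
              (fromℕ-mono {suc c ℕ.* suc k₀} {suc k} (ℕ.m≤n⇒m≤1+n K≤k)))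
            (pointwise-≼ λ n → ℚ.≤-reflexive (ℚ.*-comm (seq x n) (ι (suc k))))))
        (approximation-≥ {f} {x} f≈x k))))

suc-δPrecision : ∀ l → suc (δPrecision l) ≡ 4 ℕ.* 2 ℕ.^ l
suc-δPrecision zero    = refl
suc-δPrecision (suc l) = trans (step (δPrecision l))
  (trans (cong (2 ℕ.*_) (suc-δPrecision l))
    (trans (sym (ℕ.*-assoc 2 4 (2 ℕ.^ l))) (ℕ.*-assoc 4 2 (2 ℕ.^ l))))
  where
  step : ∀ y → suc (y ℕ.+ y ℕ.+ 1) ≡ 2 ℕ.* suc y
  step = solveℕ 1 (λ y → conℕ 1 :+ℕ (y :+ℕ y :+ℕ conℕ 1) :=ℕ conℕ 2 :*ℕ (conℕ 1 :+ℕ y)) refl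

δPrecision-grows : ∀ l → l ℕ.≤ δPrecision l
δPrecision-grows zero    = ℕ.z≤n
δPrecision-grows (suc l) = subst (ℕ._≤ δPrecision (suc l)) (ℕ.+-comm l 1)
  (ℕ.+-monoˡ-≤ 1 (ℕ.≤-trans (δPrecision-grows l) (ℕ.m≤m+n (δPrecision l) (δPrecision l))))

½^*2^ : ∀ L → ½ ^ℚ L ℚ.* ι (2 ℕ.^ L) ≡ 1ℚ
½^*2^ L = trans (cong (½ ^ℚ L ℚ.*_) (ι-^ 2 L)) (trans (sym (ℚ^.^-distrib-* ½ (ι 2) L)) (power-of-1 L))
  where
  power-of-1 : ∀ L → (½ ℚ.* ι 2) ^ℚ L ≡ 1ℚ
  power-of-1 zero    = refl
  power-of-1 (suc L) = trans (ℚ.*-identityˡ ((½ ℚ.* ι 2) ^ℚ L)) (power-of-1 L)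

-- Multiplication by 2⁻ᴸ/4 turns the certificate of the δ search into 2⁻ᴸ ≤ x.
½^≼ : ∀ {x} L → fromℕ 4 ≼ fromℕ (4 ℕ.* 2 ℕ.^ L) * x → fromℚ (½ ^ℚ L) ≼ x
½^≼ {x} L h =
  ≼-trans {_} {c * fromℕ 4}
    (pointwise-≼ λ _ → ℚ.≤-reflexive (solve 1 (λ h → h := (con (1 /suc 3) :* h) :* con (ι 4)) refl (½ ^ℚ L)))
    (≼-trans {_} {c * (fromℕ (4 ℕ.* 2 ℕ.^ L) * x)} (*-monoˡ-≼ {fromℕ 4} {fromℕ (4 ℕ.* 2 ℕ.^ L) * x} c 0≼c h)
      (pointwise-≼ λ n → ℚ.≤-reflexive (trans
        (cong (λ z → (1 /suc 3 ℚ.* ½ ^ℚ L) ℚ.* (z ℚ.* seq x n)) (ι-* 4 (2 ℕ.^ L)))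
        (trans (solve 3 (λ h t x → (con (1 /suc 3) :* h) :* ((con (ι 4) :* t) :* x) := (h :* t) :* x) refl
          (½ ^ℚ L) (ι (2 ℕ.^ L)) (seq x n))
          (trans (cong (ℚ._* seq x n) (½^*2^ L)) (ℚ.*-identityˡ (seq x n)))))))
  where
  c : ℝ
  c = fromℚ (1 /suc 3 ℚ.* ½ ^ℚ L)
  0≼c : 0ℝ ≼ c
  0≼c = fromℚ-mono (*-nonNeg (/suc-nonNeg 1 3) (^-nonNeg L (ℚ.<⇒≤ 0<½)))

2≤2^ : ∀ l → ι 2 ℚ.≤ ι 2 ^ℚ suc l
2≤2^ l = subst (ι 2 ℚ.≤_) (ι-^ 2 (suc l)) (ι-mono {2} {2 ℕ.^ suc l} (ℕ.^-monoʳ-≤ 2 {1} {suc l} (ℕ.s≤s ℕ.z≤n)))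

-- For W = 2ˡ⁺¹ the hypothesis reads W ≤ (11/8)x, and 8W ≤ W⁴ ≤ (11/8)⁴ x⁴ ≤ 4x⁴
-- because W ≥ 2.
reciprocal-power : ∀ l x y → 0ℚ ℚ.≤ x → x ℚ.* y ≡ 1ℚ → ι (4 ℕ.* 2 ℕ.^ suc l) ℚ.* y ℚ.≤ 11 /suc 1 →
                   ι 2 ^ℚ suc (suc l) ℚ.≤ x ^ℚ 4
reciprocal-power l x y 0≤x xy≡1 h = *-cancelʳ (ι-pos 3) (ℚ.≤-trans 8W≤W⁴ (ℚ.≤-trans (^-mono 4 0≤W W≤) x-side))
  where
  W c : ℚ
  W = ι 2 ^ℚ suc l
  c = 11 /suc 7
  0≤W : 0ℚ ℚ.≤ W
  0≤W = ^-nonNeg (suc l) (ι-nonNeg 2)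
  W≤ : W ℚ.≤ c ℚ.* x
  W≤ = *-cancelʳ (ι-pos 3) (subst₂ ℚ._≤_
    (trans (cong (λ z → z ℚ.* y ℚ.* x) (trans (ι-* 4 (2 ℕ.^ suc l)) (cong (ι 4 ℚ.*_) (ι-^ 2 (suc l)))))
      (trans (solve 3 (λ w x y → (con (ι 4) :* w) :* y :* x := (w :* con (ι 4)) :* (x :* y)) refl W x y)
        (trans (cong ((W ℚ.* ι 4) ℚ.*_) xy≡1) (ℚ.*-identityʳ (W ℚ.* ι 4)))))
    (solve 1 (λ x → con (11 /suc 1) :* x := (con (11 /suc 7) :* x) :* con (ι 4)) refl x)
    (*-monoˡ {ι (4 ℕ.* 2 ℕ.^ suc l) ℚ.* y} {11 /suc 1} 0≤x h))
  8W≤W⁴ : (ι 2 ℚ.* W) ℚ.* ι 4 ℚ.≤ W ^ℚ 4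
  8W≤W⁴ = subst (ℚ._≤ W ^ℚ 4) (solve 1 (λ w → w :* con (ι 8) := (con (ι 2) :* w) :* con (ι 4)) refl W)
    (*-monoʳ {ι 8} {W ^ℚ 3} 0≤W (^-mono {ι 2} {W} 3 (ι-nonNeg 2) (2≤2^ l)))
  x-side : (c ℚ.* x) ^ℚ 4 ℚ.≤ x ^ℚ 4 ℚ.* ι 4
  x-side = surplus ((1743 /suc 4095) ℚ.* x ^ℚ 4) (*-nonNeg (/suc-nonNeg 1743 4095) (^-nonNeg 4 0≤x))
    (solve 1 (λ x → let x⁴ = x :* (x :* (x :* (x :* con 1ℚ))); cx = con (11 /suc 7) :* x in
       cx :* (cx :* (cx :* (cx :* con 1ℚ))) :+ con (1743 /suc 4095) :* x⁴ := x⁴ :* con (ι 4)) refl x)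

-- The last failed reading gives 4 · 2ˡ⁺¹ x ≤ 5, hence all late terms of x satisfy
-- it with 11/2 in place of 5, and 1/x has fourth power at least 2ˡ⁺².
log₂-inverse-lower : ∀ x (0<x : 0ℝ < x) l → fromℕ (4 ℕ.* 2 ℕ.^ suc l) * x ≼ fromℕ 5 →
                     fromℕ (suc (suc l)) ≼ fromℕ 4 * log₂ (inverse x 0<x)
log₂-inverse-lower x 0<x@(c , 0<c , N , h) l (wrap k) =
  let M , k′ = k ½ 0<½
  in log₂-lower (inverse x 0<x) (suc (suc l)) 4 (N ℕ.⊔ M) λ n N≤n →
    let y   = c ℚ.⊔ seq x n
        0<y = 0<c⊔q (seq x n) 0<c
        i   = inv 0<y
        0≤i = ℚ.<⇒≤ (inv-pos 0<y)
        y≡  = ℚ.p≤q⇒p⊔q≡q (subst (ℚ._≤ seq x n) (ℚ.+-identityˡ c) (h n (⊔ˡ N M N≤n)))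
    in ℚ.≤-trans
         (reciprocal-power l i y 0≤i (inv-* 0<y)
           (subst (λ z → ι (4 ℕ.* 2 ℕ.^ suc l) ℚ.* z ℚ.≤ 11 /suc 1) (sym y≡) (k′ n (⊔ʳ N M N≤n))))
         (^-mono 4 0≤i (ℚ.p≤q⊔p 1ℚ i))

0≼log₂ : ∀ x → 0ℝ ≼ log₂ x
0≼log₂ x = pointwise-≼ λ n → /suc-nonNeg (log₂ℕ (1ℚ ℚ.⊔ seq x n) n) n

-- Running time

setupTime : ℕ → ℕ → ℕ → ℕ → ℕ
setupTime e ℓ N L =
  6 ℕ.+ (1 ℕ.+ (3 ℕ.+ (1 ℕ.+ ((e ℕ.* 4 ℕ.+ 1) ℕ.+ (1 ℕ.+ ((ℓ ℕ.* 6 ℕ.+ 1) ℕ.+ prepareTime N L))))))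

totalTime : ℕ → ℕ → ℕ → ℕ → ℕ
totalTime e ℓ N L = setupTime e ℓ N L ℕ.+ trialTime ((N ℕ.* N) ℕ.* ((8 ℕ.* (N ℕ.* N)) ℕ.* L))

-- There are 8N⁴L trials of 26 steps each, and N⁴L also bounds every other count.
totalTime-≤ : ∀ e ℓ N L → 1 ℕ.≤ N → 1 ℕ.≤ L → e ℕ.≤ N → ℓ ℕ.≤ L →
              totalTime e ℓ N L ℕ.≤ 280 ℕ.* ((N ℕ.* N) ℕ.* (N ℕ.* N) ℕ.* L)
totalTime-≤ e ℓ N L 1≤N 1≤L e≤N ℓ≤L = ℕ.≤-trans (ℕ.≤-reflexive expand)
  (ℕ.≤-trans (ℕ.+-mono-≤ (ℕ.+-mono-≤ (ℕ.+-mono-≤ (ℕ.+-mono-≤ (ℕ.+-mono-≤ (ℕ.+-mono-≤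
      (ℕ.*-monoʳ-≤ 53 1≤B) (ℕ.*-monoʳ-≤ 4 (ℕ.≤-trans e≤N N≤B))) (ℕ.*-monoʳ-≤ 6 (ℕ.≤-trans ℓ≤L L≤B)))
      (ℕ.*-monoʳ-≤ 3 N≤B)) (ℕ.*-monoʳ-≤ 3 L≤B)) (ℕ.*-monoʳ-≤ 3 D≤B)) (ℕ.≤-refl {208 ℕ.* B}))
    (ℕ.≤-reflexive (collect B)))
  where
  D B : ℕ
  D = N ℕ.* N
  B = D ℕ.* D ℕ.* L
  instance
    N≢0 : ℕ.NonZero N
    N≢0 = ℕ.>-nonZero 1≤N
    L≢0 : ℕ.NonZero L
    L≢0 = ℕ.>-nonZero 1≤L
    D≢0 : ℕ.NonZero D
    D≢0 = ℕ.m*n≢0 N N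
    DD≢0 : ℕ.NonZero (D ℕ.* D)
    DD≢0 = ℕ.m*n≢0 D D
  D≤B : D ℕ.≤ B
  D≤B = ℕ.≤-trans (ℕ.m≤m*n D D) (ℕ.m≤m*n (D ℕ.* D) L)
  N≤B : N ℕ.≤ B
  N≤B = ℕ.≤-trans (ℕ.m≤m*n N N) D≤B
  L≤B : L ℕ.≤ B
  L≤B = ℕ.m≤n*m L (D ℕ.* D)
  1≤B : 1 ℕ.≤ B
  1≤B = ℕ.≤-trans 1≤N N≤B
  expand : totalTime e ℓ N L ≡
    53 ℕ.* 1 ℕ.+ 4 ℕ.* e ℕ.+ 6 ℕ.* ℓ ℕ.+ 3 ℕ.* N ℕ.+ 3 ℕ.* L ℕ.+ 3 ℕ.* D ℕ.+ 208 ℕ.* B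
  expand = solveℕ 5 (λ e ℓ N L D →
    (conℕ 6 :+ℕ (conℕ 1 :+ℕ (conℕ 3 :+ℕ (conℕ 1 :+ℕ ((e :*ℕ conℕ 4 :+ℕ conℕ 1) :+ℕ (conℕ 1 :+ℕ
      ((ℓ :*ℕ conℕ 6 :+ℕ conℕ 1) :+ℕ
      (conℕ 1 :+ℕ ((conℕ 5 :+ℕ (N :*ℕ conℕ 3 :+ℕ conℕ 1)) :+ℕ (conℕ 2 :+ℕ
      ((conℕ 5 :+ℕ (L :*ℕ conℕ 3 :+ℕ conℕ 1)) :+ℕ (conℕ 2 :+ℕ (conℕ 3 :+ℕ
      ((conℕ 5 :+ℕ (D :*ℕ conℕ 3 :+ℕ conℕ 1)) :+ℕ (conℕ 4 :+ℕ (conℕ 5 :+ℕ conℕ 1))))))))))))))))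
      :+ℕ ((D :*ℕ ((conℕ 8 :*ℕ D) :*ℕ L)) :*ℕ conℕ 26 :+ℕ conℕ 3)
    :=ℕ conℕ 53 :*ℕ conℕ 1 :+ℕ conℕ 4 :*ℕ e :+ℕ conℕ 6 :*ℕ ℓ :+ℕ conℕ 3 :*ℕ N :+ℕ conℕ 3 :*ℕ L :+ℕ conℕ 3 :*ℕ D
        :+ℕ conℕ 208 :*ℕ (D :*ℕ D :*ℕ L)) refl e ℓ N L D
  collect : ∀ B → 53 ℕ.* B ℕ.+ 4 ℕ.* B ℕ.+ 6 ℕ.* B ℕ.+ 3 ℕ.* B ℕ.+ 3 ℕ.* B ℕ.+ 3 ℕ.* B ℕ.+ 208 ℕ.* B ≡ 280 ℕ.* B
  collect = solveℕ 1 (λ B → conℕ 53 :*ℕ B :+ℕ conℕ 4 :*ℕ B :+ℕ conℕ 6 :*ℕ B :+ℕ conℕ 3 :*ℕ B :+ℕ conℕ 3 :*ℕ B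
    :+ℕ conℕ 3 :*ℕ B :+ℕ conℕ 208 :*ℕ B :=ℕ conℕ 280 :*ℕ B) refl

-- 280 · 10⁴ · 4, from t ≤ 280 N⁴L with N ≤ 10/ε and L ≤ 4 log₂(1/δ).
constant : ℕ
constant = 11200000

module Budget (X G : ℝ) (0≼X : 0ℝ ≼ X) (0≼G : 0ℝ ≼ G) where

  budget : ℝ
  budget = fromℕ constant * (1ℝ + X ^ 4 * G)

  private
    0≼W : 0ℝ ≼ X ^ 4 * G
    0≼W = 0≼* {X ^ 4} {G} (proj₁ (^-mono-≼ {X} {X} 4 0≼X ≼-refl)) 0≼G

  constant-time : ∀ {t} → t ℕ.≤ constant → fromℕ t ≼ budget
  constant-time {t} t≤ = ≼-trans {_} {fromℕ constant} (fromℕ-mono {t} {constant} t≤)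
    (difference {fromℕ constant} {budget} (fromℕ constant * (X ^ 4 * G))
      (0≼* {fromℕ constant} {X ^ 4 * G} (0≼fromℕ constant) 0≼W)
      λ n → solve 2 (λ c w → c :+ c :* w := c :* (con 1ℚ :+ w)) refl (ι constant) (seq (X ^ 4 * G) n))

  testing-time : ∀ {t} N L → t ℕ.≤ 280 ℕ.* ((N ℕ.* N) ℕ.* (N ℕ.* N) ℕ.* L) →
                 fromℕ N ≼ fromℕ 10 * X → fromℕ L ≼ fromℕ 4 * G → fromℕ t ≼ budget
  testing-time {t} N L t≤ N≼ L≼ =
    ≼-trans {_} {fromℕ 280 * (fromℕ N ^ 4 * fromℕ L)}
      (≼-trans {_} {fromℕ T} (fromℕ-mono {t} {T} t≤)
        (pointwise-≼ λ _ → ℚ.≤-reflexive (trans (ι-* 280 ((N ℕ.* N) ℕ.* (N ℕ.* N) ℕ.* L)) (cong (ι 280 ℚ.*_)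
          (trans (ι-* ((N ℕ.* N) ℕ.* (N ℕ.* N)) L) (cong (ℚ._* ι L)
            (trans (ι-* (N ℕ.* N) (N ℕ.* N)) (trans (cong (λ z → z ℚ.* z) (ι-* N N))
              (solve 1 (λ n → (n :* n) :* (n :* n) := n :* (n :* (n :* (n :* con 1ℚ)))) refl (ι N))))))))))
    (≼-trans {_} {fromℕ 280 * ((fromℕ 10 * X) ^ 4 * (fromℕ 4 * G))}
      (*-monoˡ-≼ {fromℕ N ^ 4 * fromℕ L} {(fromℕ 10 * X) ^ 4 * (fromℕ 4 * G)} (fromℕ 280) (0≼fromℕ 280)
        (*-mono-≼ {fromℕ N ^ 4} {(fromℕ 10 * X) ^ 4} {fromℕ L} {fromℕ 4 * G} (proj₁ N⁴)
          (≼-trans {_} {fromℕ L} (0≼fromℕ L) L≼) (proj₂ N⁴) L≼))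
      (difference {fromℕ 280 * ((fromℕ 10 * X) ^ 4 * (fromℕ 4 * G))} {budget} (fromℕ constant) (0≼fromℕ constant)
        λ n → solve 2 (λ x g → let z = con (ι 10) :* x in
          con (ι 280) :* ((z :* (z :* (z :* (z :* con 1ℚ)))) :* (con (ι 4) :* g)) :+ con (ι constant)
          := con (ι constant) :* (con 1ℚ :+ (x :* (x :* (x :* (x :* con 1ℚ)))) :* g)) refl (seq X n) (seq G n)))
    where
    T : ℕ
    T = 280 ℕ.* ((N ℕ.* N) ℕ.* (N ℕ.* N) ℕ.* L)
    N⁴ : 0ℝ ≼ fromℕ N ^ 4 × fromℕ N ^ 4 ≼ (fromℕ 10 * X) ^ 4
    N⁴ = ^-mono-≼ {fromℕ N} {fromℕ 10 * X} 4 (0≼fromℕ N) N≼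

-- The distance compared with ε

module Distance {n} (p q : Distribution n) (ε : ℝ) (0≼ε : 0ℝ ≼ ε) where

  close⇒ : ‖ p ⊖ q ‖₂ ≤ ½ℝ * ε → μ p q ≼ (½ℝ * ε) * (½ℝ * ε)
  close⇒ h = ≼-trans {_} {√ μ p q * √ μ p q} (from (√-square (0≼μ p q)))
    (square-mono {√ μ p q} {½ℝ * ε} (0≼√ (μ p q)) (wrap h))

  far⇒ : ε < ‖ p ⊖ q ‖₂ → ε * ε ≼ μ p q
  far⇒ h = ≼-trans {_} {√ μ p q * √ μ p q} (square-mono {ε} {√ μ p q} 0≼ε (<⇒≼ {ε} {√ μ p q} h))
    (to (√-square (0≼μ p q)))

  -- 49/16 ≤ ε² ≤ ‖p - q‖² ≤ 2 is absurd.
  not-far : fromℕ 7 ≼ fromℕ 4 * ε → ¬ (ε < ‖ p ⊖ q ‖₂)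
  not-far 7≼4ε h = contradiction (fromℕ-cancel {49} {32} (
    ≼-trans {_} {fromℕ 7 * fromℕ 7} (pointwise-≼ λ _ → ℚ.≤-refl) (
    ≼-trans {_} {(fromℕ 4 * ε) * (fromℕ 4 * ε)}
      (square-mono {fromℕ 7} {fromℕ 4 * ε} (0≼fromℕ 7) 7≼4ε)
    (≼-trans {_} {fromℕ 16 * (ε * ε)}
      (pointwise-≼ λ k → ℚ.≤-reflexive (solve 1 (λ x →
        (con (ι 4) :* x) :* (con (ι 4) :* x) := con (ι 16) :* (x :* x)) refl (seq ε k)))
    (≼-trans {_} {fromℕ 16 * fromℕ 2}
      (*-monoˡ-≼ {ε * ε} {fromℕ 2} (fromℕ 16) (0≼fromℕ 16)
        (≼-trans {_} {μ p q} (far⇒ h) (μ≼2 p q)))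
      (pointwise-≼ λ _ → ℚ.≤-refl))))))
    (ℕ.<⇒≱ (ℕ.m≤m+n 33 16))

  module _ (N : ℕ) {η : ℚ} (0≤η : 0ℚ ℚ.≤ η) (N²η≡ : ι (N ℕ.* N) ℚ.* η ≡ 1 /suc 7) where

    private
      c : ℝ
      c = fromℚ (ι 8 ℚ.* η)
      0≼c : 0ℝ ≼ c
      0≼c = fromℚ-mono (*-nonNeg (ι-nonNeg 8) 0≤η)
      -- 8ηN² = 1.
      normalise : ∀ z → z ≡ (ι 8 ℚ.* η) ℚ.* ((ι N ℚ.* ι N) ℚ.* z)
      normalise z = sym (trans
        (solve 3 (λ η n z → (con (ι 8) :* η) :* (n :* z) := (con (ι 8) :* (n :* η)) :* z) refl η (ι N ℚ.* ι N) z)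
        (trans (cong (λ w → (ι 8 ℚ.* w) ℚ.* z) (trans (cong (ℚ._* η) (sym (ι-* N N))) N²η≡)) (ℚ.*-identityˡ z)))

    close-bound : fromℕ N * ε ≼ fromℕ 10 → ‖ p ⊖ q ‖₂ ≤ ½ℝ * ε → μ p q ≼ fromℚ (ι 200 ℚ.* η)
    close-bound Nε≼10 h =
      ≼-trans {_} {(½ℝ * ε) * (½ℝ * ε)} (close⇒ h)
      (≼-trans {_} {c * (fromℚ (1 /suc 3) * ((fromℕ N * ε) * (fromℕ N * ε)))}
        (pointwise-≼ λ k → ℚ.≤-reflexive (trans (normalise ((½ ℚ.* seq ε k) ℚ.* (½ ℚ.* seq ε k)))
          (solve 3 (λ c m x → c :* ((m :* m) :* ((con ½ :* x) :* (con ½ :* x)))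
            := c :* (con (1 /suc 3) :* ((m :* x) :* (m :* x)))) refl (ι 8 ℚ.* η) (ι N) (seq ε k))))
      (≼-trans {_} {c * (fromℚ (1 /suc 3) * (fromℕ 10 * fromℕ 10))}
        (*-monoˡ-≼ {fromℚ (1 /suc 3) * ((fromℕ N * ε) * (fromℕ N * ε))}
                   {fromℚ (1 /suc 3) * (fromℕ 10 * fromℕ 10)} c 0≼c
          (*-monoˡ-≼ {(fromℕ N * ε) * (fromℕ N * ε)} {fromℕ 10 * fromℕ 10} (fromℚ (1 /suc 3))
                     (fromℚ-mono (/suc-nonNeg 1 3))
            (square-mono {fromℕ N * ε} {fromℕ 10} (0≼* {fromℕ N} {ε} (0≼fromℕ N) 0≼ε) Nε≼10)))
        (pointwise-≼ λ k → ℚ.≤-reflexive (solve 1 (λ η →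
          (con (ι 8) :* η) :* (con (1 /suc 3) :* (con (ι 10) :* con (ι 10))) := con (ι 200) :* η) refl η))))

    far-bound : fromℕ 7 ≼ fromℕ N * ε → ε < ‖ p ⊖ q ‖₂ → fromℚ (ι 392 ℚ.* η) ≼ μ p q
    far-bound 7≼Nε h =
      ≼-trans {_} {c * (fromℕ 7 * fromℕ 7)}
        (pointwise-≼ λ k → ℚ.≤-reflexive (solve 1 (λ η →
          con (ι 392) :* η := (con (ι 8) :* η) :* (con (ι 7) :* con (ι 7))) refl η))
      (≼-trans {_} {c * ((fromℕ N * ε) * (fromℕ N * ε))}
        (*-monoˡ-≼ {fromℕ 7 * fromℕ 7} {(fromℕ N * ε) * (fromℕ N * ε)} c 0≼c
          (square-mono {fromℕ 7} {fromℕ N * ε} (0≼fromℕ 7) 7≼Nε))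
      (≼-trans {_} {ε * ε}
        (pointwise-≼ λ k → ℚ.≤-reflexive (trans
          (solve 3 (λ c m x → c :* ((m :* x) :* (m :* x)) := c :* ((m :* m) :* (x :* x))) refl
            (ι 8 ℚ.* η) (ι N) (seq ε k)) (sym (normalise (seq ε k ℚ.* seq ε k)))))
        (far⇒ h)))

≼-inverse : ∀ x (0<x : 0ℝ < x) a b → fromℕ a * x ≼ fromℕ b → fromℕ a ≼ fromℕ b * inverse x 0<x
≼-inverse x 0<x a b h =
  ≼-trans {_} {fromℕ a * (x * inverse x 0<x)}
    (≼-trans {_} {fromℕ a * 1ℝ} (pointwise-≼ λ _ → ℚ.≤-reflexive (sym (ℚ.*-identityʳ (ι a))))
      (from (*-congˡ-≈ (fromℕ a) {x * inverse x 0<x} {1ℝ} (*-inverse x 0<x))))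
  (≼-trans {_} {inverse x 0<x * (fromℕ a * x)}
    (pointwise-≼ λ k → ℚ.≤-reflexive (solve 3 (λ a x i → a :* (x :* i) := i :* (a :* x)) refl
      (ι a) (seq x k) (seq (inverse x 0<x) k)))
  (≼-trans {_} {inverse x 0<x * fromℕ b}
    (*-monoˡ-≼ {fromℕ a * x} {fromℕ b} (inverse x 0<x) (0≼inverse x 0<x) h)
    (pointwise-≼ λ k → ℚ.≤-reflexive (ℚ.*-comm (seq (inverse x 0<x) k) (ι b)))))

-- (m + 1)/m ≤ 5/4 for m ≥ 4.
next-reading : ∀ {x} m → 4 ℕ.≤ m → 0ℝ ≼ x → fromℕ m * x ≼ fromℕ 8 → fromℕ (suc m) * x ≼ fromℕ 10
next-reading {x} m 4≤m 0≼x h =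
  ≼-trans {_} {x * fromℚ ((5 /suc 3) ℚ.* ι m)}
    (≼-trans {_} {x * fromℕ (suc m)} (pointwise-≼ λ k → ℚ.≤-reflexive (ℚ.*-comm (ι (suc m)) (seq x k)))
      (*-monoˡ-≼ {fromℕ (suc m)} {fromℚ ((5 /suc 3) ℚ.* ι m)} x 0≼x (fromℚ-mono grow)))
  (≼-trans {_} {fromℚ (5 /suc 3) * (fromℕ m * x)}
    (pointwise-≼ λ k → ℚ.≤-reflexive (solve 2 (λ m x → x :* (con (5 /suc 3) :* m)
      := con (5 /suc 3) :* (m :* x)) refl
      (ι m) (seq x k)))
  (≼-trans {_} {fromℚ (5 /suc 3) * fromℕ 8}
    (*-monoˡ-≼ {fromℕ m * x} {fromℕ 8} (fromℚ (5 /suc 3)) (fromℚ-mono (/suc-nonNeg 5 3)) h)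
    (pointwise-≼ λ _ → ℚ.≤-refl)))
  where
  grow : ι (suc m) ℚ.≤ (5 /suc 3) ℚ.* ι m
  grow = subst₂ ℚ._≤_ (sym (ι-+ 1 m))
    (solve 1 (λ m → con (1 /suc 3) :* m :+ m := con (5 /suc 3) :* m) refl (ι m))
    (ℚ.+-monoˡ-≤ (ι m) (*-monoʳ {ι 4} {ι m} (/suc-nonNeg 1 3) (ι-mono {4} {m} 4≤m)))

-- Correctness of the test

module Correctness
  (δ ε : ℝ) (0<δ : 0ℝ < δ) (0<ε : 0ℝ < ε)
  (δ̂ ε̂ : ℕ → ℕ) (δ̂≈δ : Approximates δ̂ δ) (ε̂≈ε : Approximates ε̂ ε)
  {n : ℕ} (p q : Distribution n) where

  open Execution p q δ̂ ε̂
  open Runs p q δ̂ ε̂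
  open Trials p q δ̂ ε̂
  open Setup p q δ̂ ε̂
  open Distance p q ε (<⇒≼ 0<ε)
  open Budget (inverse ε 0<ε) (log₂ (inverse δ 0<δ)) (0≼inverse ε 0<ε) (0≼log₂ (inverse δ 0<δ))

  Tested : Set
  Tested = Σ[ t ∈ ℕ ]
    ( Halts t (start tester)
    × fromℕ t ≼ budget
    × (‖ p ⊖ q ‖₂ ≤ ½ℝ * ε → Yields accept (1ℝ - δ) t (start tester))
    × (ε < ‖ p ⊖ q ‖₂ → Yields reject (1ℝ - δ) t (start tester)))

  if-nonzero : ∀ x b c K s {v} → var s x ≡ suc v → (if≢0 x b c ∷ K , s) ⟶[ 1 ] (b ++ K , s)
  if-nonzero x b c K s eq = tick (cong (λ w → goto (branch w b c ++ K , s)) eq) stay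

  if-zero : ∀ x b c K s → var s x ≡ 0 → (if≢0 x b c ∷ K , s) ⟶[ 1 ] (c ++ K , s)
  if-zero x b c K s eq = tick (cong (λ w → goto (branch w b c ++ K , s)) eq) stay

  εMissing δMissing : ℕ → ℕ
  εMissing k = 8 ℕ.∸ ε̂ k
  δMissing l = 5 ℕ.∸ δ̂ (δPrecision l)

  record Read (s : Memory) : Set where
    field
      one≡    : var s one ≡ 1
      five≡   : var s five ≡ 5
      eight≡  : var s eight ≡ 8
      εIndex≡ : var s εIndex ≡ 3
      εLack≡  : var s εLack ≡ εMissing 3

  open Read

  read-ε : ∃ λ s → (start tester ⟶[ 6 ] (if≢0 εLack precise (const out 1 ∷ []) ∷ [] , s)) × Read s
  read-ε = s₆ , tick refl (tick refl (tick refl (tick refl (tick refl (tick refl stay))))) ,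
    record { one≡ = refl ; five≡ = refl ; eight≡ = refl ; εIndex≡ = refl ; εLack≡ = refl }
    where
    s₄ s₅ s₆ : Memory
    s₄ = setVar εIndex 3 (setVar eight 8 (setVar five 5 (setVar one 1 (proj₂ (start tester)))))
    s₅ = setVar reading (ε̂ 3) s₄
    s₆ = setVar εLack (8 ℕ.∸ ε̂ 3) s₅

  read-δ : ∀ s → Read s →
    ∃ λ s′ → (precise , s) ⟶[ 3 ] (if≢0 δLack main (flip out ∷ []) ∷ [] , s′)
      × Read s′ × var s′ δIndex ≡ 7 × var s′ δLack ≡ δMissing 1
  read-δ s r = s₃ , tick refl (tick refl (tick refl stay)) ,
    record { one≡ = one≡ r ; five≡ = five≡ r ; eight≡ = eight≡ r ; εIndex≡ = εIndex≡ r ; εLack≡ = εLack≡ r } ,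
    refl , cong (ℕ._∸ δ̂ 7) (five≡ r)
    where
    s₁ s₂ s₃ : Memory
    s₁ = setVar δIndex 7 s
    s₂ = setVar reading (δ̂ 7) s₁
    s₃ = setVar δLack (var s₂ five ℕ.∸ var s₂ reading) s₂

  private
    0≼δ : 0ℝ ≼ δ
    0≼δ = <⇒≼ 0<δ
    complement : ∀ x → x ≼ δ → 1ℝ - δ ≼ 1ℝ - x
    complement x x≼δ = +-mono-≼ {1ℝ} {1ℝ} { - δ} { - x} ≼-refl (neg-anti-≼ {x} {δ} x≼δ)

  large-ε : εMissing 3 ≡ 0 → Tested
  large-ε none = case read-ε of λ { (s , run , r) →
    let run′ : start tester ⟶[ 8 ] ([] , setVar out 1 s)
        run′ = run then if-zero εLack precise (const out 1 ∷ []) [] s (trans (εLack≡ r) none) then tick refl stay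
    in 8
      , run-Halts {t = 0} run′ (halts tt)
      , constant-time {8} (ℕ.m≤m+n 8 11199992)
      , (λ _ → run-yields {t = 0} run′ (yields (≼-trans {_} {1ℝ - 0ℝ} (complement 0ℝ 0≼δ)
          (pointwise-≼ λ _ → ℚ.≤-refl))))
      , (λ h → contradiction h (not-far (reading-≥ ε̂ ε ε̂≈ε 3 7 (ℕ.m∸n≡0⇒m≤n none)))) }

  -- Both answers have probability 1/2, which is at least 1 - δ.
  large-δ : ∀ {v} → εMissing 3 ≡ suc v → δMissing 1 ≡ 0 → Tested
  large-δ some none = case read-ε of λ { (s , run , r) → case read-δ s r of λ { (s′ , run₂ , r′ , _ , lack≡) →
    let run′ : start tester ⟶[ 11 ] (flip out ∷ [] , s′)
        run′ = run then if-nonzero εLack precise (const out 1 ∷ []) [] s (trans (εLack≡ r) some) then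
               run₂ then if-zero δLack main (flip out ∷ []) [] s′ (trans lack≡ none)
    in 12
      , run-Halts {t = 1} run′ (halts λ _ → tt)
      , constant-time {12} (ℕ.m≤m+n 12 11199988)
      , (λ _ → run-yields {t = 1} run′ (yields (≼-trans {_} {1ℝ - ½ℝ} (complement ½ℝ ½≼δ)
          (pointwise-≼ λ _ → ℚ.≤-refl))))
      , (λ _ → run-yields {t = 1} run′ (yields (≼-trans {_} {1ℝ - ½ℝ} (complement ½ℝ ½≼δ)
          (pointwise-≼ λ _ → ℚ.≤-refl)))) }}
    where
    ½≼δ : ½ℝ ≼ δ
    ½≼δ = ≼-trans {_} {fromℚ (½ ^ℚ 1)} (pointwise-≼ λ _ → ℚ.≤-refl)
      (½^≼ {δ} 1 (reading-≥ δ̂ δ δ̂≈δ 7 4 (ℕ.m∸n≡0⇒m≤n none)))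

  module Searched {e ℓ : ℕ} (εSearched : FirstZero εMissing 3 (suc e))
                  (δSearched : FirstZero δMissing 1 (suc ℓ)) where

    k N L D R : ℕ
    k = suc e ℕ.+ 3
    N = suc k
    L = suc ℓ ℕ.+ 1
    D = N ℕ.* N
    R = (8 ℕ.* D) ℕ.* L

    private
      t : ℕ
      t = totalTime (suc e) (suc ℓ) N L

    setup : ∃ λ s → (start tester ⟶[ setupTime (suc e) (suc ℓ) N L ] (trialLoop , s))
      × var s trials ≡ D ℕ.* R × var s one ≡ 1 × var s inside ≡ 0 × var s across ≡ 32 ℕ.* R
    setup =
      case read-ε of λ { (s₁ , run₁ , r₁) →
      case read-δ s₁ r₁ of λ { (s₂ , run₂ , r₂ , index₂ , lack₂) →
      case εSearch-run (const bits 1 ∷ δSearch ∷ prepare ++ trialLoop) s₂ εSearched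
             (one≡ r₂) (eight≡ r₂) (εIndex≡ r₂) (εLack≡ r₂) of
        λ { (s₃ , run₃ , k≡ , one₃ , five₃ , index₃ , lack₃) →
      case δSearch-run (prepare ++ trialLoop) (setVar bits 1 s₃) δSearched one₃
             (trans five₃ (five≡ r₂)) refl (trans index₃ index₂) (trans lack₃ lack₂) of
        λ { (s₄ , run₄ , L≡ , one₄ , index₄) →
      case prepare-run trialLoop s₄ one₄ (trans index₄ k≡) L≡ of λ { (s₅ , run₅ , facts) →
      s₅ ,
      (run₁ then if-nonzero εLack precise (const out 1 ∷ []) [] s₁ (trans (εLack≡ r₁) (proj₂ ε-nonzero)) then
       run₂ then if-nonzero δLack main (flip out ∷ []) [] s₂ (trans lack₂ (proj₂ δ-nonzero)) then
       run₃ then tick refl (run₄ then run₅)) ,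
      facts }}}}}
      where
      first-nonzero : ∀ {h k e} → FirstZero h k (suc e) → ∃ λ v → h k ≡ suc v
      first-nonzero (next {v = v} eq _) = v , eq
      ε-nonzero = first-nonzero εSearched
      δ-nonzero = first-nonzero δSearched

    private
      -- η = 1/(8D), and N ≥ 5 makes it at most 1/200.
      0<D : 0ℚ ℚ.< ι D
      0<D = ι-pos (k ℕ.+ k ℕ.* N)
      step-size : ∃ λ η → 0ℚ ℚ.< η × ι D ℚ.* η ≡ 1 /suc 7
      step-size = divide 0<D (/suc-pos 0 7)
      η : ℚ
      η = proj₁ step-size
      0≤η : 0ℚ ℚ.≤ η
      0≤η = ℚ.<⇒≤ (proj₁ (proj₂ step-size))
      Dη≡ : ι D ℚ.* η ≡ 1 /suc 7
      Dη≡ = proj₂ (proj₂ step-size)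
      5≤N : 5 ℕ.≤ N
      5≤N = subst (5 ℕ.≤_) (cong (2 ℕ.+_) (ℕ.+-comm 3 e)) (ℕ.m≤m+n 5 e)
      η≤ : η ℚ.≤ 1 /suc 199
      η≤ = *-cancelʳ (ι-pos 24) (subst₂ ℚ._≤_ (ℚ.*-comm (ι 25) η) Dη≡
        (*-monoˡ {ι 25} {ι D} 0≤η (ι-mono {25} {D} (ℕ.*-mono-≤ 5≤N 5≤N))))

    open Errors p q δ̂ ε̂ D η 0≤η η≤ Dη≡

    private
      -- The successful reading bounds a parameter from below, and the failed one
      -- just before it bounds the parameter from above.
      ε-found : 8 ℕ.≤ ε̂ k
      ε-found = ℕ.m∸n≡0⇒m≤n (at-zero εSearched)
      ε-missed : ε̂ (e ℕ.+ 3) ℕ.< 8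
      ε-missed = ℕ.≰⇒> λ 8≤ → before-zero εSearched (ℕ.m≤n⇒m∸n≡0 8≤)
      δ-found : 5 ℕ.≤ δ̂ (δPrecision L)
      δ-found = ℕ.m∸n≡0⇒m≤n (at-zero δSearched)
      δ-missed : δ̂ (δPrecision (ℓ ℕ.+ 1)) ℕ.< 5
      δ-missed = ℕ.≰⇒> λ 5≤ → before-zero δSearched (ℕ.m≤n⇒m∸n≡0 5≤)
      7≼Nε : fromℕ 7 ≼ fromℕ N * ε
      7≼Nε = reading-≥ ε̂ ε ε̂≈ε k 7 ε-found
      Nε≼10 : fromℕ N * ε ≼ fromℕ 10
      Nε≼10 = next-reading {ε} k (ℕ.s≤s⁻¹ 5≤N) (<⇒≼ 0<ε) (reading-< ε̂ ε ε̂≈ε (e ℕ.+ 3) 8 ε-missed)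
      ½^L≼δ : fromℚ (½ ^ℚ L) ≼ δ
      ½^L≼δ = ½^≼ {δ} L (subst (λ z → fromℕ 4 ≼ fromℕ z * δ)
        {suc (δPrecision L)} {4 ℕ.* 2 ℕ.^ L} (suc-δPrecision L)
        (reading-≥ δ̂ δ δ̂≈δ (δPrecision L) 4 δ-found))
      L≼ : fromℕ L ≼ fromℕ 4 * log₂ (inverse δ 0<δ)
      L≼ = subst (λ z → fromℕ z ≼ fromℕ 4 * log₂ (inverse δ 0<δ)) {suc (suc ℓ)} {L} (ℕ.+-comm 1 (suc ℓ))
        (log₂-inverse-lower δ 0<δ ℓ (subst (λ z → fromℕ z * δ ≼ fromℕ 5)
          {suc (δPrecision (ℓ ℕ.+ 1))} {4 ℕ.* 2 ℕ.^ suc ℓ}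
          (trans (suc-δPrecision (ℓ ℕ.+ 1)) (cong (λ z → 4 ℕ.* 2 ℕ.^ z) (ℕ.+-comm ℓ 1)))
          (reading-< δ̂ δ δ̂≈δ (δPrecision (ℓ ℕ.+ 1)) 5 δ-missed)))

    by-trials : Tested
    by-trials = case setup of λ { (s , run , trials≡ , one≡ , inside≡ , across≡) → t
      , run-Halts run (trials-halt (D ℕ.* R) s trials≡ one≡)
      , testing-time {t} N L
          (totalTime-≤ (suc e) (suc ℓ) N L (ℕ.s≤s ℕ.z≤n) (ℕ.s≤s ℕ.z≤n)
            (ℕ.m≤n⇒m≤1+n (ℕ.m≤m+n (suc e) 3)) (ℕ.m≤m+n (suc ℓ) 1))
          (≼-inverse ε 0<ε N 10 Nε≼10) L≼
      , (λ h → weaken (complement (fromℚ (½ ^ℚ L)) ½^L≼δ)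
          (run-yields run (accepts-close L s trials≡ one≡ inside≡ across≡ (close-bound N 0≤η Dη≡ Nε≼10 h))))
      , (λ h → weaken (complement (fromℚ (½ ^ℚ L)) ½^L≼δ)
          (run-yields run (rejects-far L s trials≡ one≡ inside≡ across≡ (far-bound N 0≤η Dη≡ 7≼Nε h)))) }

  private
    ε-search : ∃ (FirstZero εMissing 3)
    ε-search = let K , large = readings-grow ε̂ ε ε̂≈ε 0<ε 8
      in firstZero εMissing 3 K (ℕ.m≤n⇒m∸n≡0 (large (K ℕ.+ 3) (ℕ.m≤m+n K 3)))

    δ-search : ∃ (FirstZero δMissing 1)
    δ-search = let K , large = readings-grow δ̂ δ δ̂≈δ 0<δ 5
      in firstZero δMissing 1 K (ℕ.m≤n⇒m∸n≡0 (large (δPrecision (K ℕ.+ 1))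
           (ℕ.≤-trans (ℕ.m≤m+n K 1) (δPrecision-grows (K ℕ.+ 1)))))

  tested : Tested
  tested = by-ε (proj₂ ε-search)
    where
    by-δ : ∀ {e ℓ} → FirstZero εMissing 3 (suc e) → FirstZero δMissing 1 ℓ → Tested
    by-δ (next some _)   (found none)     = large-δ some none
    by-δ ε-searched      δ-searched@(next _ _) = Searched.by-trials ε-searched δ-searched
    by-ε : ∀ {e} → FirstZero εMissing 3 e → Tested
    by-ε (found none)          = large-ε none
    by-ε ε-searched@(next _ _) = by-δ ε-searched (proj₂ δ-search)

theorem2 : Σ[ T ∈ Program ] Σ[ C ∈ ℕ ]
    ((δ ε : ℝ) (0<δ : 0ℝ < δ) (δ<1 : δ < 1ℝ) (0<ε : 0ℝ < ε)
    (δ̂ ε̂ : ℕ → ℕ) → Approximates δ̂ δ → Approximates ε̂ ε →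
    (n : ℕ) (p q : Distribution n) →
    let open Execution p q δ̂ ε̂ in
    Σ[ t ∈ ℕ ]
    ( HaltsWithin t (start T)
    × fromℕ t ≤ fromℕ C * (1ℝ + inverse ε 0<ε ^ 4 * log₂ (inverse δ 0<δ))
    × (‖ p ⊖ q ‖₂ ≤ ½ℝ * ε → 1ℝ - δ ≤ Pr accept t (start T))
    × (ε < ‖ p ⊖ q ‖₂ → 1ℝ - δ ≤ Pr reject t (start T))))
theorem2 = tester , constant , λ δ ε 0<δ δ<1 0<ε δ̂ ε̂ δ̂≈δ ε̂≈ε n p q →
  let open Correctness δ ε 0<δ 0<ε δ̂ ε̂ δ̂≈δ ε̂≈ε p q
      open Trials p q δ̂ ε̂ using (halting; yielding)
      t , terminates , fast , close , far = tested
  in t , halting terminates , unwrap fast ,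
     (λ h → unwrap (yielding (close h))) , (λ h → unwrap (yielding (far h)))
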